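{- Let $q$ be a prime power. Let $NG_0=1$ and, for $n\ge 1$, let $NG_n$ be the number of ordered pairs $(A,B)$ of commuting nilpotent $n\times n$ matrices over $\mathbb{F}_q$ (both $A$ and $B$ nilpotent, $AB=BA$). Then \[ \sum_{n \geq 0} \frac{NG_n u^n}{|\mathrm{GL}(n,q)|} = \prod_{i \geq 1} \prod_{l \geq 1} \frac{1}{1-u^i/q^l} .\]
   Context: $\mathrm{GL}(n,q)$ is the group of invertible $n\times n$ matrices over $\mathbb{F}_q$, with the convention $|\mathrm{GL}(0,q)|=1$. The identity is one of power series in $u$ with real coefficients (the infinite product converging coefficientwise). -}

module Defs where

open import Algebra.Apartness using (HeytingCommutativeRing; HeytingField)
open import Algebra.Bundles using (CommutativeRing; RawSemiring)
import Algebra.Definitions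
import Algebra.Definitions.RawMonoid
import Algebra.Definitions.RawSemiring
import Algebra.Properties.CommutativeMonoid.Sum
open import Data.Bool.Base using (if_then_else_)
open import Data.Fin.Base using (Fin; zero; suc; toℕ; finToFun; funToFin)
open import Data.Fin.Properties
  using (_≟_; any?; all?; pigeonhole; finToFun-funToFin)
import Data.Integer.Base as ℤ
open import Data.List.Base using (List; length; filter; map; allFin; cartesianProduct)
open import Data.List.Membership.Propositional using (lose)
open import Data.List.Membership.Propositional.Properties
  using (∈-map⁺; ∈-allFin)
open import Data.List.Properties using (filter-some)
open import Data.Nat.Base as ℕ using (ℕ; zero; suc; NonZero; _^_; _∸_)
import Data.Nat.Properties as ℕ
open import Data.Nat.Primality using (Prime)
open import Data.Product.Base using (∃; ∃₂; _×_; _,_)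
open import Data.Rational.Base as ℚ using (ℚ; 0ℚ; 1ℚ; _/_)
import Data.Rational.Properties as ℚ
open import Data.Vec.Base using (Vec; []; _∷_; head; lookup)
open import Function.Base using (_∘_)
open import Function.Bundles using (Inverse)
open import Relation.Binary.PropositionalEquality as ≡ using (_≡_; refl; cong; cong₂; sym; trans)
open import Relation.Nullary.Decidable using (Dec; does; map′; _×-dec_)
open import Relation.Unary using (Pred; Decidable)

IsPrimePower : ℕ → Set
IsPrimePower q = ∃₂ λ p k → Prime p × 1 ℕ.≤ k × q ≡ p ^ k

-- Since `fin` makes _≈_ decidable, every x with ¬ x ≈ 0# is invertible:
-- a finite Heyting field is a finite field in the usual sense.

module FiniteField {c ℓ₁ ℓ₂} (F : HeytingField c ℓ₁ ℓ₂) {q : ℕ}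
  (fin : Inverse (HeytingField.setoid F) (≡.setoid (Fin q))) where

  open CommutativeRing (HeytingCommutativeRing.commutativeRing (HeytingField.heytingCommutativeRing F))
    using (Carrier; _≈_; _+_; _*_; 0#; 1#; +-commutativeMonoid;
           *-cong; *-identityˡ; +-cong; +-identityˡ; +-identityʳ; zeroˡ; zeroʳ)
    renaming (refl to ≈-refl; sym to ≈-sym; trans to ≈-trans)
  open Algebra.Properties.CommutativeMonoid.Sum +-commutativeMonoid
    using (sum; sum-cong-≋; sum-replicate-zero)
  open Inverse fin using (to; from; to-cong; from-cong; strictlyInverseʳ)

  Matrix : ℕ → Set c
  Matrix n = Fin n → Fin n → Carrier

  infix 4 _≋_
  _≋_ : ∀ {n} → Matrix n → Matrix n → Set ℓ₁
  A ≋ B = ∀ i j → A i j ≈ B i j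

  matrixRawSemiring : ℕ → RawSemiring c ℓ₁
  matrixRawSemiring n = record
    { Carrier = Matrix n
    ; _≈_     = _≋_
    ; _+_     = λ A B i j → A i j + B i j
    ; _*_     = λ A B i j → sum (λ k → A i k * B k j)
    ; 0#      = λ _ _ → 0#
    ; 1#      = λ i j → if does (i ≟ j) then 1# else 0#
    }

  module M {n : ℕ} where
    open RawSemiring (matrixRawSemiring n) public using (_*_; 0#; 1#)
    open Algebra.Definitions.RawSemiring (matrixRawSemiring n) public using (_^_)

  Nilpotent : ∀ {n} → Pred (Matrix n) _
  Nilpotent A = ∃ λ k → A M.^ k ≋ M.0#

  Invertible : ∀ {n} → Pred (Matrix n) _
  Invertible = Algebra.Definitions.Invertible _≋_ M.1# M._*_

  CommutingNilpotent : ∀ {n} → Pred (Matrix n × Matrix n) _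
  CommutingNilpotent (A , B) = Nilpotent A × Nilpotent B × (A M.* B ≋ B M.* A)

  -- `decode` and `encode` are mutually inverse up to _≋_, so `matrices n`
  -- lists every n × n matrix exactly once up to _≋_.

  decode : ∀ {n} → Fin ((q ^ n) ^ n) → Matrix n
  decode c i j = from (finToFun (finToFun c i) j)

  encode : ∀ {n} → Matrix n → Fin ((q ^ n) ^ n)
  encode A = funToFin (λ i → funToFin (λ j → to (A i j)))

  matrices : ∀ n → List (Matrix n)
  matrices n = map decode (allFin ((q ^ n) ^ n))

  ≋-sym : ∀ {n} {A B : Matrix n} → A ≋ B → B ≋ A
  ≋-sym p i j = ≈-sym (p i j)

  ≋-trans : ∀ {n} {A B C : Matrix n} → A ≋ B → B ≋ C → A ≋ C
  ≋-trans p r i j = ≈-trans (p i j) (r i j)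

  *ᴹ-cong : ∀ {n} {A A′ B B′ : Matrix n} → A ≋ A′ → B ≋ B′ → A M.* B ≋ A′ M.* B′
  *ᴹ-cong p r i j = sum-cong-≋ (λ k → *-cong (p i k) (r k j))

  ≋-refl : ∀ {n} {A : Matrix n} → A ≋ A
  ≋-refl i j = ≈-refl

  *ᴹ-zeroʳ : ∀ {n} (A : Matrix n) → A M.* M.0# ≋ M.0#
  *ᴹ-zeroʳ {n} A i j =
    ≈-trans (sum-cong-≋ (λ k → zeroʳ (A i k))) (sum-replicate-zero n)

  sum-δ : ∀ {n} (i : Fin n) (v : Fin n → Carrier) →
          sum (λ k → (if does (i ≟ k) then 1# else 0#) * v k) ≈ v i
  sum-δ {suc n} zero v = ≈-trans
    (+-cong (*-identityˡ (v zero))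
      (≈-trans (sum-cong-≋ (λ k → zeroˡ (v (suc k)))) (sum-replicate-zero n)))
    (+-identityʳ (v zero))
  sum-δ {suc n} (suc i) v = ≈-trans
    (+-cong (zeroˡ (v zero)) (sum-δ i (v ∘ suc))) (+-identityˡ (v (suc i)))

  _≈?_ : ∀ x y → Dec (x ≈ y)
  x ≈? y = map′
    (λ e → ≈-trans (≈-sym (strictlyInverseʳ x))
             (≈-trans (from-cong e) (strictlyInverseʳ y)))
    to-cong (to x ≟ to y)

  _≋?_ : ∀ {n} (A B : Matrix n) → Dec (A ≋ B)
  A ≋? B = all? (λ i → all? (λ j → A i j ≈? B i j))

  decode-encode : ∀ {n} (A : Matrix n) → decode (encode A) ≋ A
  decode-encode A i j = ≈-trans
    (from-cong (trans
      (cong (λ r → finToFun r j)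
        (finToFun-funToFin (λ i → funToFin (λ j → to (A i j))) i))
      (finToFun-funToFin (λ j → to (A i j)) j)))
    (strictlyInverseʳ (A i j))

  encode-injective : ∀ {n} {A B : Matrix n} → encode A ≡ encode B → A ≋ B
  encode-injective {A = A} {B} e = ≋-trans (≋-sym (decode-encode A))
    (≡.subst (λ c → decode c ≋ B) (sym e) (decode-encode B))

  ^-step : ∀ {n} (A : Matrix n) {i j} → A M.^ i ≋ A M.^ j →
           ∀ t → A M.^ (t ℕ.+ i) ≋ A M.^ (t ℕ.+ j)
  ^-step A p zero    = p
  ^-step A p (suc t) = *ᴹ-cong {A = A} ≋-refl (^-step A p t)

  ^-zero : ∀ {n} (A : Matrix n) {k} → A M.^ k ≋ M.0# → ∀ t → A M.^ (t ℕ.+ k) ≋ M.0#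
  ^-zero A p zero    = p
  ^-zero A p (suc t) =
    ≋-trans (*ᴹ-cong {A = A} ≋-refl (^-zero A p t)) (*ᴹ-zeroʳ A)

  ^-period : ∀ {n} (A : Matrix n) {i} d → A M.^ i ≋ A M.^ (d ℕ.+ i) →
             ∀ m → A M.^ i ≋ A M.^ (m ℕ.* d ℕ.+ i)
  ^-period A d p zero    = ≋-refl
  ^-period A {i} d p (suc m) = ≋-trans p (≡.subst (λ e → A M.^ (d ℕ.+ i) ≋ A M.^ e)
    (sym (ℕ.+-assoc d (m ℕ.* d) i)) (^-step A (^-period A d p m) d))

  -- The powers of A take finitely many values, hence are eventually periodic.
  bounded : ∀ {n} (A : Matrix n) → Nilpotent A →
            ∃ λ (i : Fin (suc ((q ^ n) ^ n))) → A M.^ toℕ i ≋ M.0#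
  bounded {n} A (k , p)
    with i , j , i<j , e ← pigeonhole (ℕ.n<1+n ((q ^ n) ^ n)) (λ t → encode (A M.^ toℕ t))
    with d , refl-eq ← ℕ.m≤n⇒∃[o]m+o≡n i<j
    = i , ≋-trans (^-period A (suc d) Aⁱ≋ k) (≡.subst (λ e → A M.^ e ≋ M.0#)
            (ℕ.m∸n+n≡m k≤) (^-zero A p ((k ℕ.* suc d ℕ.+ toℕ i) ∸ k)))
    where
    Aⁱ≋ : A M.^ toℕ i ≋ A M.^ (suc d ℕ.+ toℕ i)
    Aⁱ≋ = ≡.subst (λ e → A M.^ toℕ i ≋ A M.^ e)
            (trans (sym refl-eq) (cong suc (ℕ.+-comm (toℕ i) d))) (encode-injective e)
    k≤ : k ℕ.≤ k ℕ.* suc d ℕ.+ toℕ i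
    k≤ = ℕ.≤-trans (ℕ.m≤m*n k (suc d)) (ℕ.m≤m+n _ (toℕ i))

  invertible-resp : ∀ {n} {A B : Matrix n} → A ≋ B → Invertible A → Invertible B
  invertible-resp {A = A} {B} p (C , CA , AC) = C
    , ≋-trans (*ᴹ-cong {A = C} ≋-refl (≋-sym p)) CA
    , ≋-trans (*ᴹ-cong {B = C} (≋-sym p) ≋-refl) AC

  nilpotent? : ∀ {n} → Decidable (Nilpotent {n})
  nilpotent? A = map′ (λ (i , p) → toℕ i , p) (bounded A)
    (any? (λ i → (A M.^ toℕ i) ≋? M.0#))

  invertible? : ∀ {n} → Decidable (Invertible {n})
  invertible? A = map′ (λ (c , p) → decode c , p) find
    (any? (λ c → ((decode c M.* A) ≋? M.1#) ×-dec ((A M.* decode c) ≋? M.1#)))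
    where
    find : Invertible A → ∃ λ c → (decode c M.* A ≋ M.1#) × (A M.* decode c ≋ M.1#)
    find (B , BA , AB) = encode B
      , ≋-trans (*ᴹ-cong {B = A} (decode-encode B) ≋-refl) BA
      , ≋-trans (*ᴹ-cong {A = A} ≋-refl (decode-encode B)) AB

  commutingNilpotent? : ∀ {n} → Decidable (CommutingNilpotent {n})
  commutingNilpotent? (A , B) =
    nilpotent? A ×-dec nilpotent? B ×-dec ((A M.* B) ≋? (B M.* A))

  NG : ℕ → ℕ
  NG zero      = 1
  NG n@(suc _) = length (filter commutingNilpotent? (cartesianProduct (matrices n) (matrices n)))

  ∣GL∣ : ℕ → ℕ
  ∣GL∣ zero      = 1
  ∣GL∣ n@(suc _) = length (filter invertible? (matrices n))

  ∣GL∣-nonZero : ∀ n → NonZero (∣GL∣ n)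
  ∣GL∣-nonZero zero      = _
  ∣GL∣-nonZero n@(suc _) = ℕ.>-nonZero (filter-some invertible?
    (lose (∈-map⁺ decode (∈-allFin (encode 𝟙))) (invertible-resp {A = 𝟙} (≋-sym (decode-encode 𝟙))
      (𝟙 , 𝟙² , 𝟙²))))
    where
    𝟙 : Matrix n
    𝟙 = M.1#
    𝟙² : 𝟙 M.* 𝟙 ≋ 𝟙
    𝟙² i j = sum-δ i (λ k → 𝟙 k j)

PowerSeries : Set
PowerSeries = ℕ → ℚ

open Algebra.Definitions.RawMonoid ℚ.+-0-rawMonoid using () renaming (sum to ∑)

u^_ : ℕ → PowerSeries
(u^ i) n = if n ℕ.≡ᵇ i then 1ℚ else 0ℚ

𝟏 : PowerSeries
𝟏 = u^ 0

infixl 6 _⊝_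
_⊝_ : PowerSeries → PowerSeries → PowerSeries
(f ⊝ g) n = f n ℚ.- g n

infixl 7 _⊛_
_⊛_ : PowerSeries → PowerSeries → PowerSeries
(f ⊛ g) n = ∑ {suc n} (λ k → f (toℕ k) ℚ.* g (n ∸ toℕ k))

infixr 8 _•_
_•_ : ℚ → PowerSeries → PowerSeries
(a • f) n = a ℚ.* f n

-- The first n coefficients of 1/f, latest first, for f with constant term 1:
-- gₙ = δₙ₀ - ∑_{k<n} f_{k+1} g_{n-1-k}.
recipCoeffs : PowerSeries → ∀ n → Vec ℚ n
recipCoeffs f zero    = []
recipCoeffs f (suc n) =
  (𝟏 n ℚ.- ∑ (λ k → f (suc (toℕ k)) ℚ.* lookup (recipCoeffs f n) k)) ∷ recipCoeffs f n

recip : PowerSeries → PowerSeries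
recip f n = head (recipCoeffs f (suc n))

lookup-recipCoeffs : ∀ f n (k : Fin n) →
  lookup (recipCoeffs f n) k ≡ recip f (n ∸ suc (toℕ k))
lookup-recipCoeffs f (suc n) zero    = refl
lookup-recipCoeffs f (suc n) (suc k) = lookup-recipCoeffs f n k

∑-cong : ∀ {n} {v w : Fin n → ℚ} → (∀ k → v k ≡ w k) → ∑ v ≡ ∑ w
∑-cong {zero}  p = refl
∑-cong {suc n} p = cong₂ ℚ._+_ (p zero) (∑-cong (p ∘ suc))

recip-inverse : ∀ f → f 0 ≡ 1ℚ → ∀ n → (f ⊛ recip f) n ≡ 𝟏 n
recip-inverse f f₀≡1 n = begin
  f 0 ℚ.* recip f n ℚ.+ S  ≡⟨ cong (λ a → a ℚ.* recip f n ℚ.+ S) f₀≡1 ⟩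
  1ℚ ℚ.* recip f n ℚ.+ S   ≡⟨ cong (ℚ._+ S) (ℚ.*-identityˡ (recip f n)) ⟩
  (𝟏 n ℚ.- T) ℚ.+ S        ≡⟨ cong (λ t → (𝟏 n ℚ.- t) ℚ.+ S) T≡S ⟩
  (𝟏 n ℚ.- S) ℚ.+ S        ≡⟨ ℚ.+-assoc (𝟏 n) (ℚ.- S) S ⟩
  𝟏 n ℚ.+ (ℚ.- S ℚ.+ S)    ≡⟨ cong (𝟏 n ℚ.+_) (ℚ.+-inverseˡ S) ⟩
  𝟏 n ℚ.+ 0ℚ               ≡⟨ ℚ.+-identityʳ (𝟏 n) ⟩
  𝟏 n                      ∎
  where
  open ≡.≡-Reasoning
  S T : ℚ
  S = ∑ {n} (λ k → f (suc (toℕ k)) ℚ.* recip f (n ∸ suc (toℕ k)))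
  T = ∑ {n} (λ k → f (suc (toℕ k)) ℚ.* lookup (recipCoeffs f n) k)
  T≡S : T ≡ S
  T≡S = ∑-cong (λ k → cong (f (suc (toℕ k)) ℚ.*_) (lookup-recipCoeffs f n k))

∏[1…_] : ℕ → (ℕ → PowerSeries) → PowerSeries
∏[1… zero ]  f = 𝟏
∏[1… suc m ] f = ∏[1… m ] f ⊛ f (suc m)

-- g = ∏_{i ≥ 1} f i, with coefficientwise convergence of the partial products
-- in the usual absolute value; f 0 is ignored.
IsProd≥1 : (ℕ → PowerSeries) → PowerSeries → Set
IsProd≥1 f g = ∀ n (ε : ℚ) → 0ℚ ℚ.< ε →
  ∃ λ N → ∀ m → N ℕ.≤ m → ℚ.∣ ∏[1… m ] f n ℚ.- g n ∣ ℚ.< ε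

1-u^_/_^_ : ℕ → (q : ℕ) .{{_ : NonZero q}} → ℕ → PowerSeries
1-u^ i / q ^ l = 𝟏 ⊝ (_/_ (ℤ.+ 1) (q ^ l) {{ℕ.m^n≢0 q l}}) • u^ i

1/[1-u^_/_^_] : ℕ → (q : ℕ) .{{_ : NonZero q}} → ℕ → PowerSeries
1/[1-u^ i / q ^ l ] = recip (1-u^ i / q ^ l)

factor-inverse : ∀ i q .{{_ : NonZero q}} l → 1 ℕ.≤ i →
  ∀ n → ((1-u^ i / q ^ l) ⊛ 1/[1-u^ i / q ^ l ]) n ≡ 𝟏 n
factor-inverse (suc i) q l _ = recip-inverse (1-u^ suc i / q ^ l)
  (cong (λ a → 1ℚ ℚ.- a) (ℚ.*-zeroʳ (_/_ (ℤ.+ 1) (q ^ l) {{ℕ.m^n≢0 q l}})))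

commutingNilpotentSeries : ∀ {c ℓ₁ ℓ₂} (F : HeytingField c ℓ₁ ℓ₂) {q : ℕ}
  (fin : Inverse (HeytingField.setoid F) (≡.setoid (Fin q))) → PowerSeries
commutingNilpotentSeries F fin n = _/_ (ℤ.+ NG n) (∣GL∣ n) {{∣GL∣-nonZero n}}
  where open FiniteField F fin

{-# OPTIONS --safe #-}
module Submission where

-- Let A be nilpotent of corank k on V = Fⁿ, and let m = n - k, W = im A ≅ F^m.  A nilpotent B
-- commuting with A preserves W.  Conversely, fix a commuting nilpotent pair (A′ , B′) on W with A′
-- of corank j.  To extend A′ to A with image W one chooses Y with [A′ Y] surjective; then the
-- extensions of B′ have the shape [B′ C; 0 D] with B′ Y = A′ C + Y D, where D is nilpotent and lifts
-- the map induced by B′ on W / A′ W along a surjection F^k → F^j.  Counting everything shows that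
-- g(n, k) = (number of pairs with A of corank k) / |GL_n| satisfies
-- g(m + k, k) = Σ_j g(m, j) a_{k-j}, where a_l = (number of nilpotent l × l matrices) / |GL_l|.
-- This is the recursion that removes the first column of a partition, so Σ_k g(n, k) is the
-- coefficient of uⁿ in ∏_i Σ_l a_l u^{il}.
--
-- Forgetting B, the analogous quotients for all matrices and for the nilpotent ones satisfy one and
-- the same linear recursion in (n, k), which gives q^{n²} / |GL_n| = Σ_{l ≤ n} a_l, i.e. the
-- Fine–Herstein theorem, and then Euler's identity Σ_l a_l u^l = ∏_{l ≥ 1} 1 / (1 - u / q^l).

open import Algebra.Apartness using (HeytingCommutativeRing; HeytingField)
open import Algebra.Bundles using (CommutativeRing; Ring)
import Algebra.Definitions.RawMonoid
import Algebra.Properties.CommutativeMonoid.Sum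
import Algebra.Properties.Semiring.Sum
open import Algebra.Structures using (IsCommutativeRing; IsRing)
open import Data.Bool.Base using (if_then_else_)
open import Data.Fin.Base using (Fin; zero; suc; toℕ; _↑ˡ_; _↑ʳ_; splitAt; combine; finToFun; funToFin)
import Data.Fin.Properties as Fin
import Data.Integer.Base as ℤ
import Data.Integer.Properties as ℤ
open import Data.List.Base as List using (List; []; _∷_; length; filter; cartesianProduct)
open import Data.List.Membership.Propositional using (_∈_; lose; find)
open import Data.List.Relation.Unary.Any as Any using (here; there)
open import Data.Nat.Base as ℕ using (ℕ; zero; suc; NonZero; NonTrivial; _≤_; _<_; _∸_; z≤n; s≤s)
open import Data.Nat.Divisibility using (_∣?_; divides)
open import Data.Nat.Primality using (prime⇒nonTrivial; prime⇒nonZero)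
import Data.Nat.Properties as ℕ
open import Data.Nat.Solver using (module +-*-Solver)
open import Data.Product.Base using (∃; ∃₂; _×_; _,_; proj₁; proj₂)
open import Data.Product.Properties using (≡-dec)
open import Data.Rational.Base as ℚ using (ℚ; 0ℚ; 1ℚ; _/_)
import Data.Rational.Properties as ℚ
import Data.Rational.Unnormalised.Base as ℚᵘ
import Data.Rational.Unnormalised.Properties as ℚᵘ
open import Data.Sum.Base using (_⊎_; inj₁; inj₂; [_,_])
open import Data.Vec.Base using (Vec; []; _∷_; lookup; tabulate)
import Data.Vec.Properties as Vec
open import Function.Base using (_∘_; _$_; case_of_)
open import Function.Bundles using (Inverse)
open import Level using (0ℓ)
open import Relation.Binary.Definitions using (DecidableEquality; tri<; tri≈; tri>)
open import Relation.Binary.PropositionalEquality as ≡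
  using (_≡_; _≢_; refl; sym; trans; cong; cong₂; subst; subst₂; setoid; module ≡-Reasoning)
open import Relation.Nullary using (Dec; yes; no; does; ¬_; contradiction; map′; _×-dec_)
open import Defs hiding (∑-cong)

-- The recursion for g rests on a cancellation. Let r = m - j and l = k - j. A pair on W has q^{kr}
-- surj(j, k) choices of Y, where surj(j, k) counts the surjections F^k → F^j; each Y leaves q^{kj}
-- choices of C for every admissible D, and q^{jl} nil(l) choices of D, with nil(l) the number of
-- nilpotent l × l matrices. Sorting GL_k by the first j rows gives |GL_k| = surj(j, k) q^{jl}
-- |GL_l|, so the pair has q^{km} |GL_k| a_l extensions, independently of the pair. The factor
-- q^{km} |GL_m| |GL_k| is the order of the stabiliser of W, by which the count for one fixed W is
-- turned into the count for all A. In generating functions, with t marking the corank and a(t) = Σ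
-- a_l tˡ, the recursion reads G(u, t) = a(ut) G(u, ut). Iteration gives G(u, t) = ∏_{i ≥ 1} a(uⁱ
-- t), and t = 1 gives the claim, so partitions themselves never appear. The two infinite products
-- converge differently: in the one over i each coefficient is eventually constant, while in the one
-- over l the coefficients only approach their limits and need an estimate.

-- Counting: indicators and sums over finite types

module FiniteSums where

  open import Data.Nat.Base
  open import Data.Nat.Properties hiding (_≟_)

  private variable
    X Y : Set

  ⟦_⟧ : ∀ {p} {P : Set p} → Dec P → ℕ
  ⟦ yes _ ⟧ = 1
  ⟦ no _ ⟧ = 0

  ⟦⟧-yes : ∀ {p} {P : Set p} (d : Dec P) → P → ⟦ d ⟧ ≡ 1
  ⟦⟧-yes (yes _) _ = refl
  ⟦⟧-yes (no ¬p) p = contradiction p ¬p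

  ⟦⟧-no : ∀ {p} {P : Set p} (d : Dec P) → ¬ P → ⟦ d ⟧ ≡ 0
  ⟦⟧-no (yes p) ¬p = contradiction p ¬p
  ⟦⟧-no (no _) _ = refl

  ⟦⟧-cong : ∀ {p r} {P : Set p} {R : Set r} (d : Dec P) (e : Dec R) → (P → R) → (R → P) → ⟦ d ⟧ ≡ ⟦ e ⟧
  ⟦⟧-cong d (yes r) f g = ⟦⟧-yes d (g r)
  ⟦⟧-cong d (no ¬r) f g = ⟦⟧-no d (λ p → ¬r (f p))

  ⟦⟧-× : ∀ {p r} {P : Set p} {R : Set r} (d : Dec P) (e : Dec R) → ⟦ d ×-dec e ⟧ ≡ ⟦ d ⟧ * ⟦ e ⟧
  ⟦⟧-× (yes _) (yes _) = refl
  ⟦⟧-× (yes _) (no _) = refl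
  ⟦⟧-× (no _) (yes _) = refl
  ⟦⟧-× (no _) (no _) = refl

  -- A rewrite under an indicator may assume the condition. Counts that are constant only on
  -- matrices of a given corank, or only on commuting pairs, enter the sums this way.
  ⟦⟧-*-cong : ∀ {p} {P : Set p} (d : Dec P) {a b : ℕ} → (P → a ≡ b) → ⟦ d ⟧ * a ≡ ⟦ d ⟧ * b
  ⟦⟧-*-cong (yes p) f = cong (1 *_) (f p)
  ⟦⟧-*-cong (no _) f = refl

  sumOver : ∀ {a} {A : Set a} → List A → (A → ℕ) → ℕ
  sumOver [] f = 0
  sumOver (x ∷ xs) f = f x + sumOver xs f

  module _ {a} {A : Set a} where

    sumOver-cong : ∀ (xs : List A) {f g : A → ℕ} → (∀ x → f x ≡ g x) → sumOver xs f ≡ sumOver xs g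
    sumOver-cong [] p = refl
    sumOver-cong (x ∷ xs) p = cong₂ _+_ (p x) (sumOver-cong xs p)

    sumOver-+ : ∀ (xs : List A) (f g : A → ℕ) → sumOver xs (λ x → f x + g x) ≡ sumOver xs f + sumOver xs g
    sumOver-+ [] f g = refl
    sumOver-+ (x ∷ xs) f g = begin
      f x + g x + sumOver xs (λ x → f x + g x) ≡⟨ cong (f x + g x +_) (sumOver-+ xs f g) ⟩
      f x + g x + (sumOver xs f + sumOver xs g) ≡⟨ interchange (f x) (g x) _ _ ⟩
      f x + sumOver xs f + (g x + sumOver xs g) ∎
      where
      open ≡-Reasoning
      interchange : ∀ a b c d → a + b + (c + d) ≡ a + c + (b + d)
      interchange = solve 4 (λ a b c d → a :+ b :+ (c :+ d) := a :+ c :+ (b :+ d)) refl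
        where open +-*-Solver

    sumOver-* : ∀ (xs : List A) c (f : A → ℕ) → sumOver xs (λ x → c * f x) ≡ c * sumOver xs f
    sumOver-* [] c f = sym (*-zeroʳ c)
    sumOver-* (x ∷ xs) c f = trans (cong (c * f x +_) (sumOver-* xs c f)) (sym (*-distribˡ-+ c (f x) _))

    sumOver-0 : ∀ (xs : List A) → sumOver xs (λ _ → 0) ≡ 0
    sumOver-0 [] = refl
    sumOver-0 (x ∷ xs) = sumOver-0 xs

    sumOver-++ : ∀ (xs ys : List A) f → sumOver (xs List.++ ys) f ≡ sumOver xs f + sumOver ys f
    sumOver-++ [] ys f = refl
    sumOver-++ (x ∷ xs) ys f = trans (cong (f x +_) (sumOver-++ xs ys f)) (sym (+-assoc (f x) _ _))

    length-filter : ∀ {p} {P : A → Set p} (P? : ∀ x → Dec (P x)) xs →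
      length (filter P? xs) ≡ sumOver xs (λ x → ⟦ P? x ⟧)
    length-filter P? [] = refl
    length-filter P? (x ∷ xs) with P? x
    ... | yes _ = cong suc (length-filter P? xs)
    ... | no _ = length-filter P? xs

  module _ {a b} {A : Set a} {B : Set b} where

    sumOver-map : ∀ (h : A → B) xs f → sumOver (List.map h xs) f ≡ sumOver xs (f ∘ h)
    sumOver-map h [] f = refl
    sumOver-map h (x ∷ xs) f = cong (f (h x) +_) (sumOver-map h xs f)

    sumOver-swap : ∀ (xs : List A) (ys : List B) (f : A → B → ℕ) →
      sumOver xs (λ x → sumOver ys (f x)) ≡ sumOver ys (λ y → sumOver xs (λ x → f x y))
    sumOver-swap [] ys f = sym (sumOver-0 ys)
    sumOver-swap (x ∷ xs) ys f = trans (cong (sumOver ys (f x) +_) (sumOver-swap xs ys f))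
      (sym (sumOver-+ ys (f x) _))

  sumOver-cartesianProduct : ∀ {a b} {A : Set a} {B : Set b} (xs : List A) (ys : List B) (f : A × B → ℕ) →
    sumOver (cartesianProduct xs ys) f ≡ sumOver xs (λ x → sumOver ys (λ y → f (x , y)))
  sumOver-cartesianProduct [] ys f = refl
  sumOver-cartesianProduct (x ∷ xs) ys f = begin
    sumOver (List.map (x ,_) ys List.++ cartesianProduct xs ys) f
      ≡⟨ sumOver-++ (List.map (x ,_) ys) _ f ⟩
    sumOver (List.map (x ,_) ys) f + sumOver (cartesianProduct xs ys) f
      ≡⟨ cong₂ _+_ (sumOver-map (x ,_) ys f) (sumOver-cartesianProduct xs ys f) ⟩
    _ ∎
    where open ≡-Reasoning

  -- Listing without repetition or omission is expressed by `once` as a sum of indicators, because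
  -- this Kronecker delta identity is what every change of variables below rests on.
  record Finite (X : Set) : Set where
    field
      elements : List X
      _≟_ : DecidableEquality X
      once : ∀ y → sumOver elements (λ x → ⟦ x ≟ y ⟧) ≡ 1

    member : ∀ y → y ∈ elements
    member y = go elements (λ e → case trans (sym (once y)) e of λ ())
      where
      go : ∀ xs → sumOver xs (λ x → ⟦ x ≟ y ⟧) ≢ 0 → y ∈ xs
      go [] ≢0 = contradiction refl ≢0
      go (x ∷ xs) ≢0 with x ≟ y
      ... | yes refl = here refl
      ... | no _ = there (go xs ≢0)

  open Finite

  ∃-dec : Finite X → ∀ {p} {P : X → Set p} → (∀ x → Dec (P x)) → Dec (∃ P)
  ∃-dec F P? = map′ (λ a → let x , _ , p = find a in x , p) (λ (x , p) → lose (member F x) p)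
    (Any.any? P? (elements F))

  opaque
    ∑ : Finite X → (X → ℕ) → ℕ
    ∑ F = sumOver (elements F)

    ∑≡sumOver : (F : Finite X) (f : X → ℕ) → ∑ F f ≡ sumOver (elements F) f
    ∑≡sumOver F f = refl

    ∑-cong : (F : Finite X) {f g : X → ℕ} → (∀ x → f x ≡ g x) → ∑ F f ≡ ∑ F g
    ∑-cong F = sumOver-cong (elements F)

    ∑-+ : (F : Finite X) (f g : X → ℕ) → ∑ F (λ x → f x + g x) ≡ ∑ F f + ∑ F g
    ∑-+ F = sumOver-+ (elements F)

    ∑-*ˡ : (F : Finite X) (c : ℕ) (f : X → ℕ) → ∑ F (λ x → c * f x) ≡ c * ∑ F f
    ∑-*ˡ F = sumOver-* (elements F)

    ∑-0 : (F : Finite X) → ∑ F (λ _ → 0) ≡ 0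
    ∑-0 F = sumOver-0 (elements F)

    ∑-swap : (F : Finite X) (G : Finite Y) (f : X → Y → ℕ) →
      ∑ F (λ x → ∑ G (f x)) ≡ ∑ G (λ y → ∑ F (λ x → f x y))
    ∑-swap F G = sumOver-swap (elements F) (elements G)

    ∑-once : (F : Finite X) (y : X) → ∑ F (λ x → ⟦ _≟_ F x y ⟧) ≡ 1
    ∑-once F = once F

  ∑-*ʳ : (F : Finite X) (c : ℕ) (f : X → ℕ) → ∑ F (λ x → f x * c) ≡ ∑ F f * c
  ∑-*ʳ F c f = trans (∑-cong F (λ x → *-comm (f x) c)) (trans (∑-*ˡ F c f) (*-comm c _))

  ∑-zero : (F : Finite X) {f : X → ℕ} → (∀ x → f x ≡ 0) → ∑ F f ≡ 0
  ∑-zero F p = trans (∑-cong F p) (∑-0 F)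

  ∑-point : (F : Finite X) (y : X) (f : X → ℕ) → ∑ F (λ x → ⟦ _≟_ F x y ⟧ * f x) ≡ f y
  ∑-point F y f = begin
    ∑ F (λ x → ⟦ _≟_ F x y ⟧ * f x) ≡⟨ ∑-cong F (λ x → ⟦⟧-*-cong (_≟_ F x y) (cong f)) ⟩
    ∑ F (λ x → ⟦ _≟_ F x y ⟧ * f y) ≡⟨ ∑-*ʳ F (f y) _ ⟩
    ∑ F (λ x → ⟦ _≟_ F x y ⟧) * f y ≡⟨ cong (_* f y) (∑-once F y) ⟩
    1 * f y ≡⟨ *-identityˡ (f y) ⟩
    f y ∎
    where open ≡-Reasoning

  ∑-unique : (F : Finite X) {p : X → Set} (P? : ∀ x → Dec (p x)) (y : X) →
    p y → (∀ x → p x → x ≡ y) → ∑ F (λ x → ⟦ P? x ⟧) ≡ 1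
  ∑-unique F P? y py only = trans
    (∑-cong F (λ x → ⟦⟧-cong (P? x) (_≟_ F x y) (only x) (λ { refl → py })))
    (∑-once F y)

  -- Expand `f (to x)` into point masses over `Y` and exchange the sums: each y is then weighted by
  -- the number of x with `to x ≡ y`, which is one.
  ∑-bijection : (F : Finite X) (G : Finite Y) (to : X → Y) (from : Y → X) →
    (∀ y → to (from y) ≡ y) → (∀ x → from (to x) ≡ x) →
    (f : Y → ℕ) → ∑ F (f ∘ to) ≡ ∑ G f
  ∑-bijection F G to from to∘from from∘to f = begin
    ∑ F (λ x → f (to x))
      ≡⟨ ∑-cong F (λ x → sym (∑-point G (to x) f)) ⟩
    ∑ F (λ x → ∑ G (λ y → ⟦ _≟_ G y (to x) ⟧ * f y))
      ≡⟨ ∑-swap F G _ ⟩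
    ∑ G (λ y → ∑ F (λ x → ⟦ _≟_ G y (to x) ⟧ * f y))
      ≡⟨ ∑-cong G (λ y → ∑-*ʳ F (f y) _) ⟩
    ∑ G (λ y → ∑ F (λ x → ⟦ _≟_ G y (to x) ⟧) * f y)
      ≡⟨ ∑-cong G (λ y → cong (_* f y) (∑-unique F _ (from y) (sym (to∘from y))
           (λ { x refl → sym (from∘to x) }))) ⟩
    ∑ G (λ y → 1 * f y)
      ≡⟨ ∑-cong G (λ y → *-identityˡ (f y)) ⟩
    ∑ G f ∎
    where open ≡-Reasoning

  ∑-permute : (F : Finite X) (to from : X → X) →
    (∀ x → to (from x) ≡ x) → (∀ x → from (to x) ≡ x) →
    (f : X → ℕ) → ∑ F (f ∘ to) ≡ ∑ F f
  ∑-permute F = ∑-bijection F F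

  finite-Fin : ∀ n → Finite (Fin n)
  finite-Fin n .elements = List.allFin n
  finite-Fin n ._≟_ = Fin._≟_
  finite-Fin n .once = tab n
    where
    tabsum : ∀ {A : Set} n (g : Fin n → A) f → sumOver (List.tabulate g) f ≡ sumOver (List.allFin n) (f ∘ g)
    tabsum zero g f = refl
    tabsum (suc n) g f = cong (f (g zero) +_)
      (trans (tabsum n (g ∘ suc) f) (sym (tabsum n suc (f ∘ g))))
    tab : ∀ n (y : Fin n) → sumOver (List.allFin n) (λ x → ⟦ x Fin.≟ y ⟧) ≡ 1
    tab (suc n) zero = cong suc (trans (tabsum n suc _) (sumOver-0 (List.allFin n)))
    tab (suc n) (suc y) = trans (tabsum n suc _)
      (trans (sumOver-cong (List.allFin n) (λ x → ⟦⟧-cong (suc x Fin.≟ suc y) (x Fin.≟ y) Fin.suc-injective (cong suc)))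
        (tab n y))

  finite-× : Finite X → Finite Y → Finite (X × Y)
  finite-× F G .elements = cartesianProduct (elements F) (elements G)
  finite-× F G ._≟_ = ≡-dec (_≟_ F) (_≟_ G)
  finite-× F G .once (x , y) = begin
    sumOver (cartesianProduct (elements F) (elements G)) _
      ≡⟨ sumOver-cartesianProduct (elements F) (elements G) _ ⟩
    sumOver (elements F) (λ x′ → sumOver (elements G) (λ y′ → ⟦ ≡-dec (_≟_ F) (_≟_ G) (x′ , y′) (x , y) ⟧))
      ≡⟨ sumOver-cong (elements F) (λ x′ → trans (sumOver-cong (elements G) (λ y′ →
           trans (⟦⟧-cong (≡-dec (_≟_ F) (_≟_ G) (x′ , y′) (x , y)) (_≟_ F x′ x ×-dec _≟_ G y′ y)
             (λ { refl → refl , refl }) (λ { (refl , refl) → refl }))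
           (⟦⟧-× (_≟_ F x′ x) (_≟_ G y′ y))))
         (trans (sumOver-* (elements G) ⟦ _≟_ F x′ x ⟧ _)
           (trans (cong (⟦ _≟_ F x′ x ⟧ *_) (once G y)) (*-identityʳ _)))) ⟩
    sumOver (elements F) (λ x′ → ⟦ _≟_ F x′ x ⟧)
      ≡⟨ once F x ⟩
    1 ∎
    where open ≡-Reasoning

  opaque
    unfolding ∑
    ∑-× : (F : Finite X) (G : Finite Y) (f : X × Y → ℕ) →
      ∑ (finite-× F G) f ≡ ∑ F (λ x → ∑ G (λ y → f (x , y)))
    ∑-× F G = sumOver-cartesianProduct (elements F) (elements G)

  finite-Vec : Finite X → ∀ n → Finite (Vec X n)
  finite-Vec F zero .elements = [] ∷ []
  finite-Vec F zero ._≟_ [] [] = yes refl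
  finite-Vec F zero .once [] = refl
  finite-Vec F (suc n) .elements = List.map (λ (x , v) → x ∷ v) (elements (finite-× F (finite-Vec F n)))
  finite-Vec F (suc n) ._≟_ = Vec.≡-dec (_≟_ F)
  finite-Vec F (suc n) .once (x ∷ v) = begin
    sumOver (List.map _ (elements F×V)) _ ≡⟨ sumOver-map _ (elements F×V) _ ⟩
    sumOver (elements F×V) _ ≡⟨ sumOver-cong (elements F×V) (λ (x′ , v′) →
      ⟦⟧-cong (Vec.≡-dec (_≟_ F) (x′ ∷ v′) (x ∷ v)) (_≟_ F×V (x′ , v′) (x , v)) (λ { refl → refl }) (λ { refl → refl })) ⟩
    sumOver (elements F×V) (λ w → ⟦ _≟_ F×V w (x , v) ⟧) ≡⟨ once F×V (x , v) ⟩
    1 ∎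
    where
    open ≡-Reasoning
    F×V = finite-× F (finite-Vec F n)

  opaque
    unfolding ∑
    card : Finite X → ℕ
    card F = ∑ F (λ _ → 1)

    ∑-const : (F : Finite X) (c : ℕ) → ∑ F (λ _ → c) ≡ card F * c
    ∑-const F c = trans (∑-cong F (λ _ → sym (*-identityˡ c))) (∑-*ʳ F c _)

    card-× : (F : Finite X) (G : Finite Y) → card (finite-× F G) ≡ card F * card G
    card-× F G = trans (∑-× F G _) (∑-const F _)

    card-Fin : ∀ n → card (finite-Fin n) ≡ n
    card-Fin n = go (λ x → x)
      where
      go : ∀ {n} {A : Set} (g : Fin n → A) → sumOver (List.tabulate g) (λ _ → 1) ≡ n
      go {zero} g = refl
      go {suc n} g = cong suc (go (g ∘ suc))

    card-Vec : (F : Finite X) (n : ℕ) → card (finite-Vec F n) ≡ card F ^ n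
    card-Vec F zero = refl
    card-Vec F (suc n) = begin
      sumOver (List.map _ (elements (finite-× F (finite-Vec F n)))) (λ _ → 1)
        ≡⟨ sumOver-map _ (elements (finite-× F (finite-Vec F n))) _ ⟩
      card (finite-× F (finite-Vec F n)) ≡⟨ card-× F (finite-Vec F n) ⟩
      card F * card (finite-Vec F n) ≡⟨ cong (card F *_) (card-Vec F n) ⟩
      card F * card F ^ n ∎
      where open ≡-Reasoning

  ∑< : ℕ → (ℕ → ℕ) → ℕ
  ∑< zero f = 0
  ∑< (suc n) f = f 0 + ∑< n (f ∘ suc)

  ∑<-cong : ∀ n {f g : ℕ → ℕ} → (∀ j → j < n → f j ≡ g j) → ∑< n f ≡ ∑< n g
  ∑<-cong zero p = refl
  ∑<-cong (suc n) p = cong₂ _+_ (p 0 (s≤s z≤n)) (∑<-cong n (λ j j<n → p (suc j) (s≤s j<n)))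

  ∑<-zero : ∀ n {f : ℕ → ℕ} → (∀ j → f j ≡ 0) → ∑< n f ≡ 0
  ∑<-zero zero p = refl
  ∑<-zero (suc n) p = cong₂ _+_ (p 0) (∑<-zero n (p ∘ suc))

  ∑<-point : ∀ n s → s < n → ∑< n (λ j → ⟦ s ℕ.≟ j ⟧) ≡ 1
  ∑<-point (suc n) zero _ = cong suc (∑<-zero n (λ j → ⟦⟧-no (0 ℕ.≟ suc j) λ ()))
  ∑<-point (suc n) (suc s) (s≤s s<n) = trans
    (∑<-cong n (λ j _ → ⟦⟧-cong (suc s ℕ.≟ suc j) (s ℕ.≟ j) suc-injective (cong suc))) (∑<-point n s s<n)

  ∑<-*ʳ : ∀ n c f → ∑< n (λ j → f j * c) ≡ ∑< n f * c
  ∑<-*ʳ zero c f = refl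
  ∑<-*ʳ (suc n) c f = trans (cong (f 0 * c +_) (∑<-*ʳ n c (f ∘ suc))) (sym (*-distribʳ-+ c (f 0) _))

  ∑-∑< : ∀ {X : Set} (F : Finite X) n (f : X → ℕ → ℕ) → ∑ F (λ x → ∑< n (f x)) ≡ ∑< n (λ j → ∑ F (λ x → f x j))
  ∑-∑< F zero f = ∑-0 F
  ∑-∑< F (suc n) f = trans (∑-+ F (λ x → f x 0) _) (cong (_ +_) (∑-∑< F n (λ x → f x ∘ suc)))

  ≤⇒∃+ : ∀ {m n} → m ≤ n → ∃ λ k → k + m ≡ n
  ≤⇒∃+ {m} {n} m≤n = n ∸ m , m∸n+n≡m m≤n

open FiniteSums

-- Rectangular matrices over a ring and block calculus

module MatrixAlgebra {K : Set} (_+_ _*_ : K → K → K) (-_ : K → K) (0# 1# : K)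
  (isRing : IsRing _≡_ _+_ _*_ -_ 0# 1#) where

  private
    ring : Ring 0ℓ 0ℓ
    ring = record { isRing = isRing }
    module R = Ring ring
    module S = Algebra.Properties.Semiring.Sum R.semiring
    open ≡-Reasoning

    variable
      a b c d e a′ b′ c′ : ℕ

  opaque
    sum : ∀ {n} → (Fin n → K) → K
    sum = S.sum

    sum-suc : ∀ {n} (f : Fin (suc n) → K) → sum f ≡ f zero + sum (f ∘ suc)
    sum-suc f = refl

    sum-empty : (f : Fin 0 → K) → sum f ≡ 0#
    sum-empty f = refl

    sum-cong-≗ : ∀ {n} {f g : Fin n → K} → (∀ i → f i ≡ g i) → sum f ≡ sum g
    sum-cong-≗ = S.sum-cong-≗

    sum-0 : ∀ n → sum {n} (λ _ → 0#) ≡ 0#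
    sum-0 n = S.sum-replicate-zero n

    sum-comm : ∀ {m n} (f : Fin m → Fin n → K) → sum (λ i → sum (f i)) ≡ sum (λ j → sum λ i → f i j)
    sum-comm f = S.∑-comm f

    sum-+ : ∀ {n} (f g : Fin n → K) → sum (λ i → f i + g i) ≡ sum f + sum g
    sum-+ = S.∑-distrib-+

    sum-*ˡ : ∀ {n} x (f : Fin n → K) → sum (λ i → x * f i) ≡ x * sum f
    sum-*ˡ x f = sym (S.*-distribˡ-sum x f)

    sum-*ʳ : ∀ {n} x (f : Fin n → K) → sum (λ i → f i * x) ≡ sum f * x
    sum-*ʳ x f = sym (S.*-distribʳ-sum x f)

  opaque
    -- Nested vectors rather than functions, so that matrices with equal entries are propositionally
    -- equal and the matrices of a given shape form a finite type.
    Mat : ℕ → ℕ → Set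
    Mat a b = Vec (Vec K b) a

    finite-Mat : Finite K → ∀ a b → Finite (Mat a b)
    finite-Mat F a b = finite-Vec (finite-Vec F b) a

    card-Mat : ∀ (F : Finite K) a b → card (finite-Mat F a b) ≡ (card F ℕ.^ b) ℕ.^ a
    card-Mat F a b = trans (card-Vec (finite-Vec F b) a) (cong (ℕ._^ a) (card-Vec F b))

    infix 30 _⟨_,_⟩
    _⟨_,_⟩ : Mat a b → Fin a → Fin b → K
    A ⟨ i , j ⟩ = lookup (lookup A i) j

    mk : (Fin a → Fin b → K) → Mat a b
    mk f = tabulate (tabulate ∘ f)

    mk-entry : ∀ (f : Fin a → Fin b → K) i j → mk f ⟨ i , j ⟩ ≡ f i j
    mk-entry f i j = trans (cong (λ v → lookup v j) (Vec.lookup∘tabulate _ i)) (Vec.lookup∘tabulate _ j)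

    mk-η : (A : Mat a b) → mk (A ⟨_,_⟩) ≡ A
    mk-η A = trans (Vec.tabulate-cong (λ i → Vec.tabulate∘lookup (lookup A i))) (Vec.tabulate∘lookup A)

    mk-cong : {f g : Fin a → Fin b → K} → (∀ i j → f i j ≡ g i j) → mk f ≡ mk g
    mk-cong p = Vec.tabulate-cong (λ i → Vec.tabulate-cong (p i))

  ext : {A B : Mat a b} → (∀ i j → A ⟨ i , j ⟩ ≡ B ⟨ i , j ⟩) → A ≡ B
  ext {A = A} {B} p = trans (sym (mk-η A)) (trans (mk-cong p) (mk-η B))

  δ : ∀ {n} → Fin n → Fin n → K
  δ i j = if does (i Fin.≟ j) then 1# else 0#

  -- The entries of the partial identity of rank r: 1 exactly when i = j < r. The indices are plain
  -- natural numbers so that one formula serves every rectangular shape.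
  diag : ℕ → ℕ → ℕ → K
  diag zero _ _ = 0#
  diag (suc r) zero zero = 1#
  diag (suc r) zero (suc j) = 0#
  diag (suc r) (suc i) zero = 0#
  diag (suc r) (suc i) (suc j) = diag r i j

  private
    sum-δˡ : ∀ {n} (i : Fin n) (v : Fin n → K) → sum (λ k → δ i k * v k) ≡ v i
    sum-δˡ {suc n} zero v = trans (sum-suc _) $ trans
      (cong₂ _+_ (R.*-identityˡ (v zero)) (trans (sum-cong-≗ (λ k → R.zeroˡ (v (suc k)))) (sum-0 n)))
      (R.+-identityʳ (v zero))
    sum-δˡ {suc n} (suc i) v = trans (sum-suc _) $ trans
      (cong₂ _+_ (R.zeroˡ (v zero)) (sum-δˡ i (v ∘ suc))) (R.+-identityˡ _)

    δ-sym : ∀ {n} (i j : Fin n) → δ i j ≡ δ j i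
    δ-sym zero zero = refl
    δ-sym zero (suc j) = refl
    δ-sym (suc i) zero = refl
    δ-sym (suc i) (suc j) = δ-sym i j

    sum-δʳ : ∀ {n} (i : Fin n) (v : Fin n → K) → sum (λ k → v k * δ k i) ≡ v i
    sum-δʳ {suc n} zero v = trans (sum-suc _) $ trans
      (cong₂ _+_ (R.*-identityʳ (v zero)) (trans (sum-cong-≗ (λ k → R.zeroʳ (v (suc k)))) (sum-0 n)))
      (R.+-identityʳ (v zero))
    sum-δʳ {suc n} (suc i) v = trans (sum-suc _) $ trans
      (cong₂ _+_ (R.zeroʳ (v zero)) (sum-δʳ i (v ∘ suc))) (R.+-identityˡ _)

    sum-split : ∀ m {n} (f : Fin (m ℕ.+ n) → K) → sum f ≡ sum (λ i → f (i ↑ˡ n)) + sum (λ i → f (m ↑ʳ i))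
    sum-split zero f = sym (trans (cong (_+ sum f) (sum-empty _)) (R.+-identityˡ _))
    sum-split (suc m) {n} f = trans (sum-suc f) (trans (cong (f zero +_) (sum-split m (f ∘ suc)))
      (trans (sym (R.+-assoc _ _ _)) (cong (_+ sum (λ i → f (suc m ↑ʳ i))) (sym (sum-suc (λ i → f (i ↑ˡ n)))))))

    δ-↑ˡ : ∀ {m} n (i j : Fin m) → δ (i ↑ˡ n) (j ↑ˡ n) ≡ δ i j
    δ-↑ˡ n zero zero = refl
    δ-↑ˡ n zero (suc j) = refl
    δ-↑ˡ n (suc i) zero = refl
    δ-↑ˡ n (suc i) (suc j) = δ-↑ˡ n i j

    δ-↑ʳ : ∀ m {n} (i j : Fin n) → δ (m ↑ʳ i) (m ↑ʳ j) ≡ δ i j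
    δ-↑ʳ zero i j = refl
    δ-↑ʳ (suc m) i j = δ-↑ʳ m i j

    δ-↑ˡʳ : ∀ {m n} (i : Fin m) (j : Fin n) → δ (i ↑ˡ n) (m ↑ʳ j) ≡ 0#
    δ-↑ˡʳ zero j = refl
    δ-↑ˡʳ (suc i) j = δ-↑ˡʳ i j

    δ-↑ʳˡ : ∀ {m n} (i : Fin n) (j : Fin m) → δ (m ↑ʳ i) (j ↑ˡ n) ≡ 0#
    δ-↑ʳˡ i j = trans (δ-sym (_ ↑ʳ i) (j ↑ˡ _)) (δ-↑ˡʳ j i)

    diag-↑ˡ : ∀ {r} s t (i j : Fin r) → diag r (toℕ (i ↑ˡ s)) (toℕ (j ↑ˡ t)) ≡ δ i j
    diag-↑ˡ s t zero zero = refl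
    diag-↑ˡ s t zero (suc j) = refl
    diag-↑ˡ s t (suc i) zero = refl
    diag-↑ˡ s t (suc i) (suc j) = diag-↑ˡ s t i j

    diag-0ˡ : ∀ r {s} (i : Fin s) j → diag r (toℕ (r ↑ʳ i)) j ≡ 0#
    diag-0ˡ zero i j = refl
    diag-0ˡ (suc r) i zero = refl
    diag-0ˡ (suc r) i (suc j) = diag-0ˡ r i j

    diag-0ʳ : ∀ r {t} i (j : Fin t) → diag r i (toℕ (r ↑ʳ j)) ≡ 0#
    diag-0ʳ zero i j = refl
    diag-0ʳ (suc r) zero j = refl
    diag-0ʳ (suc r) (suc i) j = diag-0ʳ r i j

  infixl 6 _⊕_
  infixl 7 _⊗_
  infix 8 ⊖_

  opaque
    _⊕_ : Mat a b → Mat a b → Mat a b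
    A ⊕ B = mk λ i j → A ⟨ i , j ⟩ + B ⟨ i , j ⟩

    ⊖_ : Mat a b → Mat a b
    ⊖ A = mk λ i j → - A ⟨ i , j ⟩

    _⊗_ : Mat a b → Mat b c → Mat a c
    A ⊗ B = mk λ i j → sum λ k → A ⟨ i , k ⟩ * B ⟨ k , j ⟩

    𝟘 : Mat a b
    𝟘 = mk λ _ _ → 0#

    𝟙 : Mat a a
    𝟙 = mk δ

    E : ∀ (r : ℕ) {a b : ℕ} → Mat a b
    E r = mk λ i j → diag r (toℕ i) (toℕ j)

    ⊕-entry : (A B : Mat a b) → ∀ i j → (A ⊕ B) ⟨ i , j ⟩ ≡ A ⟨ i , j ⟩ + B ⟨ i , j ⟩
    ⊕-entry A B = mk-entry _

    ⊖-entry : (A : Mat a b) → ∀ i j → (⊖ A) ⟨ i , j ⟩ ≡ - A ⟨ i , j ⟩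
    ⊖-entry A = mk-entry _

    ⊗-entry : (A : Mat a b) (B : Mat b c) → ∀ i j → (A ⊗ B) ⟨ i , j ⟩ ≡ sum λ k → A ⟨ i , k ⟩ * B ⟨ k , j ⟩
    ⊗-entry A B = mk-entry _

    𝟘-entry : ∀ (i : Fin a) (j : Fin b) → 𝟘 ⟨ i , j ⟩ ≡ 0#
    𝟘-entry = mk-entry _

    𝟙-entry : ∀ (i j : Fin a) → 𝟙 ⟨ i , j ⟩ ≡ δ i j
    𝟙-entry = mk-entry _

    E-entry : ∀ r (i : Fin a) (j : Fin b) → E r ⟨ i , j ⟩ ≡ diag r (toℕ i) (toℕ j)
    E-entry r = mk-entry _

    left : ∀ b {c} → Mat a (b ℕ.+ c) → Mat a b
    left b {c} A = mk λ i j → A ⟨ i , j ↑ˡ c ⟩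

    right : ∀ b {c} → Mat a (b ℕ.+ c) → Mat a c
    right b A = mk λ i j → A ⟨ i , b ↑ʳ j ⟩

    top : ∀ a {b} → Mat (a ℕ.+ b) c → Mat a c
    top a {b} A = mk λ i j → A ⟨ i ↑ˡ b , j ⟩

    bottom : ∀ a {b} → Mat (a ℕ.+ b) c → Mat b c
    bottom a A = mk λ i j → A ⟨ a ↑ʳ i , j ⟩

    hcat : Mat a b → Mat a c → Mat a (b ℕ.+ c)
    hcat {b = b} A B = mk λ i j → [ A ⟨ i ,_⟩ , B ⟨ i ,_⟩ ] (splitAt b j)

    vcat : Mat a c → Mat b c → Mat (a ℕ.+ b) c
    vcat {a = a} A B = mk λ i j → [ A ⟨_, j ⟩ , B ⟨_, j ⟩ ] (splitAt a i)

    left-entry : ∀ b {c} (A : Mat a (b ℕ.+ c)) i j → left b A ⟨ i , j ⟩ ≡ A ⟨ i , j ↑ˡ c ⟩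
    left-entry b A = mk-entry _

    right-entry : ∀ b {c} (A : Mat a (b ℕ.+ c)) i j → right b A ⟨ i , j ⟩ ≡ A ⟨ i , b ↑ʳ j ⟩
    right-entry b A = mk-entry _

    top-entry : ∀ a {b} (A : Mat (a ℕ.+ b) c) i j → top a A ⟨ i , j ⟩ ≡ A ⟨ i ↑ˡ b , j ⟩
    top-entry a A = mk-entry _

    bottom-entry : ∀ a {b} (A : Mat (a ℕ.+ b) c) i j → bottom a A ⟨ i , j ⟩ ≡ A ⟨ a ↑ʳ i , j ⟩
    bottom-entry a A = mk-entry _

    hcat-↑ˡ : (A : Mat a b) (B : Mat a c) → ∀ i j → hcat A B ⟨ i , j ↑ˡ c ⟩ ≡ A ⟨ i , j ⟩
    hcat-↑ˡ {b = b} {c} A B i j = trans (mk-entry _ i _) (cong [ A ⟨ i ,_⟩ , B ⟨ i ,_⟩ ] (Fin.splitAt-↑ˡ b j c))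

    hcat-↑ʳ : (A : Mat a b) (B : Mat a c) → ∀ i j → hcat A B ⟨ i , b ↑ʳ j ⟩ ≡ B ⟨ i , j ⟩
    hcat-↑ʳ {b = b} {c} A B i j = trans (mk-entry _ i _) (cong [ A ⟨ i ,_⟩ , B ⟨ i ,_⟩ ] (Fin.splitAt-↑ʳ b c j))

    vcat-↑ˡ : (A : Mat a c) (B : Mat b c) → ∀ i j → vcat A B ⟨ i ↑ˡ b , j ⟩ ≡ A ⟨ i , j ⟩
    vcat-↑ˡ {a = a} {b = b} A B i j = trans (mk-entry _ _ j) (cong [ A ⟨_, j ⟩ , B ⟨_, j ⟩ ] (Fin.splitAt-↑ˡ a i b))

    vcat-↑ʳ : (A : Mat a c) (B : Mat b c) → ∀ i j → vcat A B ⟨ a ↑ʳ i , j ⟩ ≡ B ⟨ i , j ⟩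
    vcat-↑ʳ {a = a} {b = b} A B i j = trans (mk-entry _ _ j) (cong [ A ⟨_, j ⟩ , B ⟨_, j ⟩ ] (Fin.splitAt-↑ʳ a b i))

  private
    Fin-split : ∀ m {n} {p} (P : Fin (m ℕ.+ n) → Set p) → (∀ i → P (i ↑ˡ n)) → (∀ i → P (m ↑ʳ i)) → ∀ i → P i
    Fin-split zero P l r i = r i
    Fin-split (suc m) P l r zero = l zero
    Fin-split (suc m) P l r (suc i) = Fin-split m (P ∘ suc) (l ∘ suc) r i

  ⊕-assoc : (A B C : Mat a b) → (A ⊕ B) ⊕ C ≡ A ⊕ (B ⊕ C)
  ⊕-assoc A B C = ext λ i j → begin
    ((A ⊕ B) ⊕ C) ⟨ i , j ⟩ ≡⟨ ⊕-entry (A ⊕ B) C i j ⟩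
    (A ⊕ B) ⟨ i , j ⟩ + C ⟨ i , j ⟩ ≡⟨ cong (_+ C ⟨ i , j ⟩) (⊕-entry A B i j) ⟩
    (A ⟨ i , j ⟩ + B ⟨ i , j ⟩) + C ⟨ i , j ⟩ ≡⟨ R.+-assoc _ _ _ ⟩
    A ⟨ i , j ⟩ + (B ⟨ i , j ⟩ + C ⟨ i , j ⟩) ≡⟨ cong (A ⟨ i , j ⟩ +_) (⊕-entry B C i j) ⟨
    A ⟨ i , j ⟩ + (B ⊕ C) ⟨ i , j ⟩ ≡⟨ ⊕-entry A (B ⊕ C) i j ⟨
    (A ⊕ (B ⊕ C)) ⟨ i , j ⟩ ∎

  ⊕-comm : (A B : Mat a b) → A ⊕ B ≡ B ⊕ A
  ⊕-comm A B = ext λ i j → trans (⊕-entry A B i j) (trans (R.+-comm _ _) (sym (⊕-entry B A i j)))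

  ⊕-identityˡ : (A : Mat a b) → 𝟘 ⊕ A ≡ A
  ⊕-identityˡ A = ext λ i j → trans (⊕-entry 𝟘 A i j)
    (trans (cong (_+ A ⟨ i , j ⟩) (𝟘-entry i j)) (R.+-identityˡ _))

  ⊕-inverseˡ : (A : Mat a b) → ⊖ A ⊕ A ≡ 𝟘
  ⊕-inverseˡ A = ext λ i j → trans (⊕-entry (⊖ A) A i j)
    (trans (cong (_+ A ⟨ i , j ⟩) (⊖-entry A i j)) (trans (R.-‿inverseˡ _) (sym (𝟘-entry i j))))

  ⊗-assoc : (A : Mat a b) (B : Mat b c) (C : Mat c d) → (A ⊗ B) ⊗ C ≡ A ⊗ (B ⊗ C)
  ⊗-assoc A B C = ext λ i j → begin
    ((A ⊗ B) ⊗ C) ⟨ i , j ⟩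
      ≡⟨ ⊗-entry (A ⊗ B) C i j ⟩
    sum (λ k → (A ⊗ B) ⟨ i , k ⟩ * C ⟨ k , j ⟩)
      ≡⟨ sum-cong-≗ (λ k → trans (cong (_* C ⟨ k , j ⟩) (⊗-entry A B i k))
           (trans (sym (sum-*ʳ (C ⟨ k , j ⟩) (λ l → A ⟨ i , l ⟩ * B ⟨ l , k ⟩)))
             (sum-cong-≗ λ l → R.*-assoc (A ⟨ i , l ⟩) (B ⟨ l , k ⟩) (C ⟨ k , j ⟩)))) ⟩
    sum (λ k → sum λ l → A ⟨ i , l ⟩ * (B ⟨ l , k ⟩ * C ⟨ k , j ⟩))
      ≡⟨ sum-comm (λ k l → A ⟨ i , l ⟩ * (B ⟨ l , k ⟩ * C ⟨ k , j ⟩)) ⟩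
    sum (λ l → sum λ k → A ⟨ i , l ⟩ * (B ⟨ l , k ⟩ * C ⟨ k , j ⟩))
      ≡⟨ sum-cong-≗ (λ l → trans (sum-*ˡ (A ⟨ i , l ⟩) (λ k → B ⟨ l , k ⟩ * C ⟨ k , j ⟩))
           (cong (A ⟨ i , l ⟩ *_) (sym (⊗-entry B C l j)))) ⟩
    sum (λ l → A ⟨ i , l ⟩ * (B ⊗ C) ⟨ l , j ⟩)
      ≡⟨ ⊗-entry A (B ⊗ C) i j ⟨
    (A ⊗ (B ⊗ C)) ⟨ i , j ⟩ ∎

  ⊗-identityˡ : (A : Mat a b) → 𝟙 ⊗ A ≡ A
  ⊗-identityˡ A = ext λ i j → trans (⊗-entry 𝟙 A i j)
    (trans (sum-cong-≗ λ k → cong (_* A ⟨ k , j ⟩) (𝟙-entry i k)) (sum-δˡ i (λ k → A ⟨ k , j ⟩)))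

  ⊗-identityʳ : (A : Mat a b) → A ⊗ 𝟙 ≡ A
  ⊗-identityʳ A = ext λ i j → trans (⊗-entry A 𝟙 i j)
    (trans (sum-cong-≗ λ k → cong (A ⟨ i , k ⟩ *_) (𝟙-entry k j)) (sum-δʳ j (λ k → A ⟨ i , k ⟩)))

  ⊗-distribˡ : (A : Mat a b) (B C : Mat b c) → A ⊗ (B ⊕ C) ≡ A ⊗ B ⊕ A ⊗ C
  ⊗-distribˡ A B C = ext λ i j → begin
    (A ⊗ (B ⊕ C)) ⟨ i , j ⟩
      ≡⟨ ⊗-entry A (B ⊕ C) i j ⟩
    sum (λ k → A ⟨ i , k ⟩ * (B ⊕ C) ⟨ k , j ⟩)
      ≡⟨ sum-cong-≗ (λ k → trans (cong (A ⟨ i , k ⟩ *_) (⊕-entry B C k j)) (R.distribˡ _ _ _)) ⟩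
    sum (λ k → (A ⟨ i , k ⟩ * B ⟨ k , j ⟩) + (A ⟨ i , k ⟩ * C ⟨ k , j ⟩))
      ≡⟨ sum-+ (λ k → A ⟨ i , k ⟩ * B ⟨ k , j ⟩) (λ k → A ⟨ i , k ⟩ * C ⟨ k , j ⟩) ⟩
    sum (λ k → A ⟨ i , k ⟩ * B ⟨ k , j ⟩) + sum (λ k → A ⟨ i , k ⟩ * C ⟨ k , j ⟩)
      ≡⟨ cong₂ _+_ (⊗-entry A B i j) (⊗-entry A C i j) ⟨
    (A ⊗ B) ⟨ i , j ⟩ + (A ⊗ C) ⟨ i , j ⟩
      ≡⟨ ⊕-entry (A ⊗ B) (A ⊗ C) i j ⟨
    (A ⊗ B ⊕ A ⊗ C) ⟨ i , j ⟩ ∎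

  ⊗-distribʳ : (C : Mat b c) (A B : Mat a b) → (A ⊕ B) ⊗ C ≡ A ⊗ C ⊕ B ⊗ C
  ⊗-distribʳ C A B = ext λ i j → begin
    ((A ⊕ B) ⊗ C) ⟨ i , j ⟩
      ≡⟨ ⊗-entry (A ⊕ B) C i j ⟩
    sum (λ k → (A ⊕ B) ⟨ i , k ⟩ * C ⟨ k , j ⟩)
      ≡⟨ sum-cong-≗ (λ k → trans (cong (_* C ⟨ k , j ⟩) (⊕-entry A B i k)) (R.distribʳ _ _ _)) ⟩
    sum (λ k → (A ⟨ i , k ⟩ * C ⟨ k , j ⟩) + (B ⟨ i , k ⟩ * C ⟨ k , j ⟩))
      ≡⟨ sum-+ (λ k → A ⟨ i , k ⟩ * C ⟨ k , j ⟩) (λ k → B ⟨ i , k ⟩ * C ⟨ k , j ⟩) ⟩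
    sum (λ k → A ⟨ i , k ⟩ * C ⟨ k , j ⟩) + sum (λ k → B ⟨ i , k ⟩ * C ⟨ k , j ⟩)
      ≡⟨ cong₂ _+_ (⊗-entry A C i j) (⊗-entry B C i j) ⟨
    (A ⊗ C) ⟨ i , j ⟩ + (B ⊗ C) ⟨ i , j ⟩
      ≡⟨ ⊕-entry (A ⊗ C) (B ⊗ C) i j ⟨
    (A ⊗ C ⊕ B ⊗ C) ⟨ i , j ⟩ ∎

  ⊗-zeroˡ : (A : Mat b c) → 𝟘 {a} ⊗ A ≡ 𝟘
  ⊗-zeroˡ {b} A = ext λ i j → trans (⊗-entry 𝟘 A i j) (trans
    (sum-cong-≗ λ k → trans (cong (_* A ⟨ k , j ⟩) (𝟘-entry i k)) (R.zeroˡ _))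
    (trans (sum-0 b) (sym (𝟘-entry i j))))

  ⊗-zeroʳ : (A : Mat a b) → A ⊗ 𝟘 {b} {c} ≡ 𝟘
  ⊗-zeroʳ {b = b} A = ext λ i j → trans (⊗-entry A 𝟘 i j) (trans
    (sum-cong-≗ λ k → trans (cong (A ⟨ i , k ⟩ *_) (𝟘-entry k j)) (R.zeroʳ _))
    (trans (sum-0 b) (sym (𝟘-entry i j))))

  left-hcat : (A : Mat a b) (B : Mat a c) → left b (hcat A B) ≡ A
  left-hcat {b = b} A B = ext λ i j → trans (left-entry b (hcat A B) i j) (hcat-↑ˡ A B i j)

  right-hcat : (A : Mat a b) (B : Mat a c) → right b (hcat A B) ≡ B
  right-hcat {b = b} A B = ext λ i j → trans (right-entry b (hcat A B) i j) (hcat-↑ʳ A B i j)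

  top-vcat : (A : Mat a c) (B : Mat b c) → top a (vcat A B) ≡ A
  top-vcat {a = a} A B = ext λ i j → trans (top-entry a (vcat A B) i j) (vcat-↑ˡ A B i j)

  bottom-vcat : (A : Mat a c) (B : Mat b c) → bottom a (vcat A B) ≡ B
  bottom-vcat {a = a} A B = ext λ i j → trans (bottom-entry a (vcat A B) i j) (vcat-↑ʳ A B i j)

  hcat-ext : {M : Mat a (b ℕ.+ c)} {A : Mat a b} {B : Mat a c} →
    (∀ i j → M ⟨ i , j ↑ˡ c ⟩ ≡ A ⟨ i , j ⟩) → (∀ i j → M ⟨ i , b ↑ʳ j ⟩ ≡ B ⟨ i , j ⟩) → M ≡ hcat A B
  hcat-ext {b = b} {M = M} {A} {B} l r = ext λ i → Fin-split b (λ j → M ⟨ i , j ⟩ ≡ hcat A B ⟨ i , j ⟩)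
    (λ j → trans (l i j) (sym (hcat-↑ˡ A B i j))) (λ j → trans (r i j) (sym (hcat-↑ʳ A B i j)))

  vcat-ext : {M : Mat (a ℕ.+ b) c} {A : Mat a c} {B : Mat b c} →
    (∀ i j → M ⟨ i ↑ˡ b , j ⟩ ≡ A ⟨ i , j ⟩) → (∀ i j → M ⟨ a ↑ʳ i , j ⟩ ≡ B ⟨ i , j ⟩) → M ≡ vcat A B
  vcat-ext {a} {M = M} {A} {B} t u = ext λ i j → Fin-split a (λ i → M ⟨ i , j ⟩ ≡ vcat A B ⟨ i , j ⟩)
    (λ i → trans (t i j) (sym (vcat-↑ˡ A B i j))) (λ i → trans (u i j) (sym (vcat-↑ʳ A B i j))) i

  hcat-η : ∀ b {c} (M : Mat a (b ℕ.+ c)) → hcat (left b M) (right b M) ≡ M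
  hcat-η b M = sym (hcat-ext (λ i j → sym (left-entry b M i j)) (λ i j → sym (right-entry b M i j)))

  vcat-η : ∀ a {b} (M : Mat (a ℕ.+ b) c) → vcat (top a M) (bottom a M) ≡ M
  vcat-η a M = sym (vcat-ext (λ i j → sym (top-entry a M i j)) (λ i j → sym (bottom-entry a M i j)))

  hcat-⊗-vcat : (A : Mat a b) (B : Mat a c) (C : Mat b d) (D : Mat c d) →
    hcat A B ⊗ vcat C D ≡ A ⊗ C ⊕ B ⊗ D
  hcat-⊗-vcat {b = b} A B C D = ext λ i j → begin
    (hcat A B ⊗ vcat C D) ⟨ i , j ⟩
      ≡⟨ ⊗-entry (hcat A B) (vcat C D) i j ⟩
    sum (λ k → hcat A B ⟨ i , k ⟩ * vcat C D ⟨ k , j ⟩)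
      ≡⟨ sum-split b _ ⟩
    sum (λ k → hcat A B ⟨ i , k ↑ˡ _ ⟩ * vcat C D ⟨ k ↑ˡ _ , j ⟩) + sum (λ k → hcat A B ⟨ i , b ↑ʳ k ⟩ * vcat C D ⟨ b ↑ʳ k , j ⟩)
      ≡⟨ cong₂ _+_ (sum-cong-≗ λ k → cong₂ _*_ (hcat-↑ˡ A B i k) (vcat-↑ˡ C D k j))
           (sum-cong-≗ λ k → cong₂ _*_ (hcat-↑ʳ A B i k) (vcat-↑ʳ C D k j)) ⟩
    sum (λ k → A ⟨ i , k ⟩ * C ⟨ k , j ⟩) + sum (λ k → B ⟨ i , k ⟩ * D ⟨ k , j ⟩)
      ≡⟨ cong₂ _+_ (⊗-entry A C i j) (⊗-entry B D i j) ⟨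
    (A ⊗ C) ⟨ i , j ⟩ + (B ⊗ D) ⟨ i , j ⟩
      ≡⟨ ⊕-entry (A ⊗ C) (B ⊗ D) i j ⟨
    (A ⊗ C ⊕ B ⊗ D) ⟨ i , j ⟩ ∎

  block : Mat a c → Mat a d → Mat b c → Mat b d → Mat (a ℕ.+ b) (c ℕ.+ d)
  block A B C D = vcat (hcat A B) (hcat C D)

  block-ext : {M : Mat (a ℕ.+ b) (c ℕ.+ d)} {A : Mat a c} {B : Mat a d} {C : Mat b c} {D : Mat b d} →
    (∀ i j → M ⟨ i ↑ˡ b , j ↑ˡ d ⟩ ≡ A ⟨ i , j ⟩) → (∀ i j → M ⟨ i ↑ˡ b , c ↑ʳ j ⟩ ≡ B ⟨ i , j ⟩) →
    (∀ i j → M ⟨ a ↑ʳ i , j ↑ˡ d ⟩ ≡ C ⟨ i , j ⟩) → (∀ i j → M ⟨ a ↑ʳ i , c ↑ʳ j ⟩ ≡ D ⟨ i , j ⟩) →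
    M ≡ block A B C D
  block-ext {a} {b} {c} {M = M} {A} {B} {C} {D} p q r s = vcat-ext
    (λ i → Fin-split c (λ j → M ⟨ i ↑ˡ b , j ⟩ ≡ hcat A B ⟨ i , j ⟩)
      (λ j → trans (p i j) (sym (hcat-↑ˡ A B i j))) (λ j → trans (q i j) (sym (hcat-↑ʳ A B i j))))
    (λ i → Fin-split c (λ j → M ⟨ a ↑ʳ i , j ⟩ ≡ hcat C D ⟨ i , j ⟩)
      (λ j → trans (r i j) (sym (hcat-↑ˡ C D i j))) (λ j → trans (s i j) (sym (hcat-↑ʳ C D i j))))

  𝟙-block : 𝟙 {a ℕ.+ b} ≡ block (𝟙 {a}) 𝟘 𝟘 (𝟙 {b})
  𝟙-block {a} {b} = block-ext {a} {b} {a} {b}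
    (λ i j → trans (𝟙-entry _ _) (trans (δ-↑ˡ b i j) (sym (𝟙-entry i j))))
    (λ i j → trans (𝟙-entry _ _) (trans (δ-↑ˡʳ i j) (sym (𝟘-entry i j))))
    (λ i j → trans (𝟙-entry _ _) (trans (δ-↑ʳˡ i j) (sym (𝟘-entry i j))))
    (λ i j → trans (𝟙-entry _ _) (trans (δ-↑ʳ a i j) (sym (𝟙-entry i j))))

  E-block : ∀ (r : ℕ) {s t : ℕ} → E r {r ℕ.+ s} {r ℕ.+ t} ≡ block (𝟙 {r}) 𝟘 𝟘 (𝟘 {s} {t})
  E-block r {s} {t} = block-ext {r} {s} {r} {t}
    (λ i j → trans (E-entry r _ _) (trans (diag-↑ˡ s t i j) (sym (𝟙-entry i j))))
    (λ i j → trans (E-entry r _ _) (trans (diag-0ʳ r (toℕ (i ↑ˡ s)) j) (sym (𝟘-entry i j))))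
    (λ i j → trans (E-entry r _ _) (trans (diag-0ˡ r i (toℕ (j ↑ˡ t))) (sym (𝟘-entry i j))))
    (λ i j → trans (E-entry r _ _) (trans (diag-0ˡ r i (toℕ (r ↑ʳ j))) (sym (𝟘-entry i j))))

  E-suc : ∀ r → E (suc r) {suc a} {suc b} ≡ block {1} 𝟙 𝟘 𝟘 (E r)
  E-suc {a} {b} r = block-ext {1} {a} {1} {b}
    (λ { zero zero → trans (E-entry (suc r) _ _) (sym (𝟙-entry {1} zero zero)) })
    (λ { zero j → trans (E-entry (suc r) _ _) (sym (𝟘-entry zero j)) })
    (λ { i zero → trans (E-entry (suc r) _ _) (sym (𝟘-entry i zero)) })
    (λ i j → trans (E-entry (suc r) _ _) (sym (E-entry r i j)))

  E-full : ∀ r → E r {r} {r} ≡ 𝟙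
  E-full r = ext λ i j → trans (E-entry r i j) (trans (go i j) (sym (𝟙-entry i j)))
    where
    go : ∀ {r} (i j : Fin r) → diag r (toℕ i) (toℕ j) ≡ δ i j
    go zero zero = refl
    go zero (suc j) = refl
    go (suc i) zero = refl
    go (suc i) (suc j) = go i j

  E-wide : ∀ (r : ℕ) {t : ℕ} → E r {r} {r ℕ.+ t} ≡ hcat 𝟙 𝟘
  E-wide r {t} = hcat-ext
    (λ i j → trans (E-entry r i _) (trans (cong (λ k → diag r k (toℕ (j ↑ˡ t))) (sym (Fin.toℕ-↑ˡ i 0)))
      (trans (diag-↑ˡ 0 t i j) (sym (𝟙-entry i j)))))
    (λ i j → trans (E-entry r i _) (trans (diag-0ʳ r (toℕ i) j) (sym (𝟘-entry i j))))

  E-zero : E 0 {a} {b} ≡ 𝟘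
  E-zero = ext λ i j → trans (E-entry 0 i j) (sym (𝟘-entry i j))

  no-rows : (A B : Mat 0 b) → A ≡ B
  no-rows A B = ext λ ()

  no-columns : (A B : Mat a 0) → A ≡ B
  no-columns A B = ext λ _ ()

  ⊕-identityʳ : (A : Mat a b) → A ⊕ 𝟘 ≡ A
  ⊕-identityʳ A = trans (⊕-comm A 𝟘) (⊕-identityˡ A)

  ⊕-inverseʳ : (A : Mat a b) → A ⊕ ⊖ A ≡ 𝟘
  ⊕-inverseʳ A = trans (⊕-comm A (⊖ A)) (⊕-inverseˡ A)

  ⊖-⊕-cancel : (A B : Mat a b) → ⊖ A ⊕ (A ⊕ B) ≡ B
  ⊖-⊕-cancel A B = trans (sym (⊕-assoc (⊖ A) A B)) (trans (cong (_⊕ B) (⊕-inverseˡ A)) (⊕-identityˡ B))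

  ⊕-⊖-cancel : (A B : Mat a b) → A ⊕ (⊖ A ⊕ B) ≡ B
  ⊕-⊖-cancel A B = trans (sym (⊕-assoc A (⊖ A) B)) (trans (cong (_⊕ B) (⊕-inverseʳ A)) (⊕-identityˡ B))

  ⊕-cancelˡ : (A : Mat a b) {B C : Mat a b} → A ⊕ B ≡ A ⊕ C → B ≡ C
  ⊕-cancelˡ A {B} {C} p = trans (sym (⊖-⊕-cancel A B)) (trans (cong (⊖ A ⊕_) p) (⊖-⊕-cancel A C))

  ⊖-unique : {A B : Mat a b} → A ⊕ B ≡ 𝟘 → B ≡ ⊖ A
  ⊖-unique {A = A} p = ⊕-cancelˡ A (trans p (sym (⊕-inverseʳ A)))

  ⊖-⊗ : (A : Mat a b) (B : Mat b c) → (⊖ A) ⊗ B ≡ ⊖ (A ⊗ B)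
  ⊖-⊗ A B = ⊖-unique (trans (sym (⊗-distribʳ B A (⊖ A))) (trans (cong (_⊗ B) (⊕-inverseʳ A)) (⊗-zeroˡ B)))

  ⊗-⊖ : (A : Mat a b) (B : Mat b c) → A ⊗ (⊖ B) ≡ ⊖ (A ⊗ B)
  ⊗-⊖ A B = ⊖-unique (trans (sym (⊗-distribˡ A B (⊖ B))) (trans (cong (A ⊗_) (⊕-inverseʳ B)) (⊗-zeroʳ A)))

  hcat-injective : {A A₁ : Mat a b} {B B₁ : Mat a c} → hcat A B ≡ hcat A₁ B₁ → A ≡ A₁ × B ≡ B₁
  hcat-injective {b = b} p = trans (sym (left-hcat _ _)) (trans (cong (left b) p) (left-hcat _ _))
    , trans (sym (right-hcat _ _)) (trans (cong (right b) p) (right-hcat _ _))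

  vcat-injective : {A A₁ : Mat a c} {B B₁ : Mat b c} → vcat A B ≡ vcat A₁ B₁ → A ≡ A₁ × B ≡ B₁
  vcat-injective {a = a} p = trans (sym (top-vcat _ _)) (trans (cong (top a) p) (top-vcat _ _))
    , trans (sym (bottom-vcat _ _)) (trans (cong (bottom a) p) (bottom-vcat _ _))

  block-injective : {A A₁ : Mat a c} {B B₁ : Mat a d} {C C₁ : Mat b c} {D D₁ : Mat b d} →
    block A B C D ≡ block A₁ B₁ C₁ D₁ → (A ≡ A₁ × B ≡ B₁) × (C ≡ C₁ × D ≡ D₁)
  block-injective p = let q , r = vcat-injective p in hcat-injective q , hcat-injective r

  𝟘-hcat : 𝟘 {a} {b ℕ.+ c} ≡ hcat (𝟘 {a} {b}) 𝟘
  𝟘-hcat = hcat-ext (λ i j → trans (𝟘-entry i _) (sym (𝟘-entry i j))) (λ i j → trans (𝟘-entry i _) (sym (𝟘-entry i j)))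

  𝟘-vcat : 𝟘 {a ℕ.+ b} {c} ≡ vcat (𝟘 {a} {c}) 𝟘
  𝟘-vcat = vcat-ext (λ i j → trans (𝟘-entry _ j) (sym (𝟘-entry i j))) (λ i j → trans (𝟘-entry _ j) (sym (𝟘-entry i j)))

  𝟘-block : 𝟘 {a ℕ.+ b} {c ℕ.+ d} ≡ block (𝟘 {a} {c}) 𝟘 𝟘 (𝟘 {b} {d})
  𝟘-block {a} {b} {c} {d} = trans (𝟘-vcat {a} {b}) (cong₂ vcat (𝟘-hcat {b = c}) (𝟘-hcat {b = c}))

  ⊗-hcat : (A : Mat a b) (B : Mat b c) (C : Mat b d) → A ⊗ hcat B C ≡ hcat (A ⊗ B) (A ⊗ C)
  ⊗-hcat A B C = hcat-ext
    (λ i j → trans (⊗-entry A _ i _) (trans (sum-cong-≗ λ k → cong (A ⟨ i , k ⟩ *_) (hcat-↑ˡ B C k j)) (sym (⊗-entry A B i j))))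
    (λ i j → trans (⊗-entry A _ i _) (trans (sum-cong-≗ λ k → cong (A ⟨ i , k ⟩ *_) (hcat-↑ʳ B C k j)) (sym (⊗-entry A C i j))))

  vcat-⊗ : (A : Mat a c) (B : Mat b c) (C : Mat c d) → vcat A B ⊗ C ≡ vcat (A ⊗ C) (B ⊗ C)
  vcat-⊗ A B C = vcat-ext
    (λ i j → trans (⊗-entry _ C _ j) (trans (sum-cong-≗ λ k → cong (_* C ⟨ k , j ⟩) (vcat-↑ˡ A B i k)) (sym (⊗-entry A C i j))))
    (λ i j → trans (⊗-entry _ C _ j) (trans (sum-cong-≗ λ k → cong (_* C ⟨ k , j ⟩) (vcat-↑ʳ A B i k)) (sym (⊗-entry B C i j))))

  bottom-⊗ : ∀ a {b} (A : Mat (a ℕ.+ b) c) (B : Mat c d) → bottom a (A ⊗ B) ≡ bottom a A ⊗ B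
  bottom-⊗ a A B = trans (cong (λ X → bottom a (X ⊗ B)) (sym (vcat-η a A))) (trans (cong (bottom a) (vcat-⊗ _ _ B)) (bottom-vcat _ _))

  hcat-⊕ : (A B : Mat a b) (C D : Mat a c) → hcat A C ⊕ hcat B D ≡ hcat (A ⊕ B) (C ⊕ D)
  hcat-⊕ A B C D = hcat-ext
    (λ i j → trans (⊕-entry _ _ i _) (trans (cong₂ _+_ (hcat-↑ˡ A C i j) (hcat-↑ˡ B D i j)) (sym (⊕-entry A B i j))))
    (λ i j → trans (⊕-entry _ _ i _) (trans (cong₂ _+_ (hcat-↑ʳ A C i j) (hcat-↑ʳ B D i j)) (sym (⊕-entry C D i j))))

  vcat-⊕ : (A B : Mat a c) (C D : Mat b c) → vcat A C ⊕ vcat B D ≡ vcat (A ⊕ B) (C ⊕ D)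
  vcat-⊕ A B C D = vcat-ext
    (λ i j → trans (⊕-entry _ _ _ j) (trans (cong₂ _+_ (vcat-↑ˡ A C i j) (vcat-↑ˡ B D i j)) (sym (⊕-entry A B i j))))
    (λ i j → trans (⊕-entry _ _ _ j) (trans (cong₂ _+_ (vcat-↑ʳ A C i j) (vcat-↑ʳ B D i j)) (sym (⊕-entry C D i j))))

  hcat-⊗-block : (X : Mat e a) (Y : Mat e b) (A : Mat a c) (B : Mat a d) (C : Mat b c) (D : Mat b d) →
    hcat X Y ⊗ block A B C D ≡ hcat (X ⊗ A ⊕ Y ⊗ C) (X ⊗ B ⊕ Y ⊗ D)
  hcat-⊗-block X Y A B C D = trans (hcat-⊗-vcat X Y _ _)
    (trans (cong₂ _⊕_ (⊗-hcat X A B) (⊗-hcat Y C D)) (hcat-⊕ _ _ _ _))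

  block-⊗-vcat : (A : Mat a c) (B : Mat a d) (C : Mat b c) (D : Mat b d) (X : Mat c e) (Y : Mat d e) →
    block A B C D ⊗ vcat X Y ≡ vcat (A ⊗ X ⊕ B ⊗ Y) (C ⊗ X ⊕ D ⊗ Y)
  block-⊗-vcat A B C D X Y = trans (vcat-⊗ _ _ _) (cong₂ vcat (hcat-⊗-vcat A B X Y) (hcat-⊗-vcat C D X Y))

  block-⊗ : (A : Mat a c) (B : Mat a d) (C : Mat b c) (D : Mat b d)
    (A₁ : Mat c a′) (B₁ : Mat c b′) (C₁ : Mat d a′) (D₁ : Mat d b′) →
    block A B C D ⊗ block A₁ B₁ C₁ D₁ ≡ block (A ⊗ A₁ ⊕ B ⊗ C₁) (A ⊗ B₁ ⊕ B ⊗ D₁) (C ⊗ A₁ ⊕ D ⊗ C₁) (C ⊗ B₁ ⊕ D ⊗ D₁)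
  block-⊗ A B C D A₁ B₁ C₁ D₁ = trans (vcat-⊗ _ _ _)
    (cong₂ vcat (hcat-⊗-block A B A₁ B₁ C₁ D₁) (hcat-⊗-block C D A₁ B₁ C₁ D₁))

  unit-row : Fin a → Mat 1 a
  unit-row i = mk λ _ k → δ i k

  unit-column : Fin b → Mat b 1
  unit-column j = mk λ k _ → δ k j

  unit-row-⊗ : ∀ i (A : Mat a b) j → (unit-row i ⊗ A) ⟨ zero , j ⟩ ≡ A ⟨ i , j ⟩
  unit-row-⊗ i A j = trans (⊗-entry (unit-row i) A zero j)
    (trans (sum-cong-≗ λ k → cong (_* A ⟨ k , j ⟩) (mk-entry _ zero k)) (sum-δˡ i _))

  ⊗-unit-column : ∀ (A : Mat a b) j i → (A ⊗ unit-column j) ⟨ i , zero ⟩ ≡ A ⟨ i , j ⟩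
  ⊗-unit-column A j i = trans (⊗-entry A (unit-column j) i zero)
    (trans (sum-cong-≗ λ k → cong (A ⟨ i , k ⟩ *_) (mk-entry _ k zero)) (sum-δʳ j _))

  scalar : K → Mat 1 1
  scalar x = mk λ _ _ → x

  scalar-⊗ : (x y : K) → scalar x ⊗ scalar y ≡ scalar (x * y)
  scalar-⊗ x y = ext λ i j → begin
    (scalar x ⊗ scalar y) ⟨ i , j ⟩ ≡⟨ ⊗-entry (scalar x) (scalar y) i j ⟩
    sum _ ≡⟨ sum-suc _ ⟩
    _ + sum {0} _ ≡⟨ cong₂ _+_ (cong₂ _*_ (mk-entry _ i zero) (mk-entry _ zero j)) (sum-empty _) ⟩
    (x * y) + 0# ≡⟨ R.+-identityʳ _ ⟩
    x * y ≡⟨ mk-entry _ i j ⟨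
    scalar (x * y) ⟨ i , j ⟩ ∎

  scalar-1 : scalar 1# ≡ 𝟙
  scalar-1 = ext λ { zero zero → trans (mk-entry {1} _ zero zero) (sym (𝟙-entry {1} zero zero)) }

  scalar-η : (x : Mat 1 1) → x ≡ scalar (x ⟨ zero , zero ⟩)
  scalar-η x = ext λ { zero zero → sym (mk-entry {1} _ zero zero) }

  module _ (F : Finite K) where

    ∑-hcat : ∀ a {b c} (f : Mat a (b ℕ.+ c) → ℕ) → ∑ (finite-Mat F a (b ℕ.+ c)) f ≡
      ∑ (finite-Mat F a b) (λ A → ∑ (finite-Mat F a c) (λ B → f (hcat A B)))
    ∑-hcat a {b} {c} f = trans
      (sym (∑-bijection (finite-× (finite-Mat F a b) (finite-Mat F a c)) (finite-Mat F a (b ℕ.+ c))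
        (λ (A , B) → hcat A B) (λ M → left b M , right b M) (hcat-η b)
        (λ (A , B) → cong₂ _,_ (left-hcat A B) (right-hcat A B)) f))
      (∑-× _ _ _)

    ∑-vcat : ∀ {a b} c (f : Mat (a ℕ.+ b) c → ℕ) → ∑ (finite-Mat F (a ℕ.+ b) c) f ≡
      ∑ (finite-Mat F a c) (λ A → ∑ (finite-Mat F b c) (λ B → f (vcat A B)))
    ∑-vcat {a} {b} c f = trans
      (sym (∑-bijection (finite-× (finite-Mat F a c) (finite-Mat F b c)) (finite-Mat F (a ℕ.+ b) c)
        (λ (A , B) → vcat A B) (λ M → top a M , bottom a M) (vcat-η a)
        (λ (A , B) → cong₂ _,_ (top-vcat A B) (bottom-vcat A B)) f))
      (∑-× _ _ _)

-- Linear algebra over a finite skew field: inverses, normal forms, kernel counts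

record FiniteSkewField : Set₁ where
  field
    {K} : Set
    _+_ _*_ : K → K → K
    -_ : K → K
    0# 1# : K
    isRing : IsRing _≡_ _+_ _*_ -_ 0# 1#
    finite : Finite K
    1<card : 1 ℕ.< card finite
    inverse : ∀ x → x ≢ 0# → ∃ λ y → x * y ≡ 1# × y * x ≡ 1#

module OverField (𝔽 : FiniteSkewField) where

  open FiniteSkewField 𝔽 hiding (_+_; _*_; -_)
  open MatrixAlgebra (FiniteSkewField._+_ 𝔽) (FiniteSkewField._*_ 𝔽) (FiniteSkewField.-_ 𝔽) 0# 1# isRing public
  open ≡-Reasoning

  private variable
    a b c d k l m n r : ℕ

  q : ℕ
  q = card finite

  mats : ∀ a b → Finite (Mat a b)
  mats = finite-Mat finite

  infix 4 _≟_
  _≟_ : (A B : Mat a b) → Dec (A ≡ B)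
  _≟_ {a} {b} = Finite._≟_ (mats a b)

  opaque
    Inv : Mat a a → Set
    Inv A = ∃ λ B → A ⊗ B ≡ 𝟙 × B ⊗ A ≡ 𝟙

    Inv-intro : (A B : Mat a a) → A ⊗ B ≡ 𝟙 → B ⊗ A ≡ 𝟙 → Inv A
    Inv-intro A B p q = B , p , q

    inv : {A : Mat a a} → Inv A → Mat a a
    inv (B , _) = B

    inv-ʳ : {A : Mat a a} (i : Inv A) → A ⊗ inv i ≡ 𝟙
    inv-ʳ (_ , p , _) = p

    inv-ˡ : {A : Mat a a} (i : Inv A) → inv i ⊗ A ≡ 𝟙
    inv-ˡ (_ , _ , p) = p

    Inv? : (A : Mat a a) → Dec (Inv A)
    Inv? {a} A = ∃-dec (mats a a) λ B → A ⊗ B ≟ 𝟙 ×-dec B ⊗ A ≟ 𝟙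

  cancelˡ : {P : Mat a b} {P′ : Mat b a} (X : Mat a c) → P ⊗ P′ ≡ 𝟙 → P ⊗ (P′ ⊗ X) ≡ X
  cancelˡ X p = trans (sym (⊗-assoc _ _ X)) (trans (cong (_⊗ X) p) (⊗-identityˡ X))

  cancelʳ : {P : Mat a b} {P′ : Mat b a} (X : Mat c a) → P ⊗ P′ ≡ 𝟙 → (X ⊗ P) ⊗ P′ ≡ X
  cancelʳ X p = trans (⊗-assoc X _ _) (trans (cong (X ⊗_) p) (⊗-identityʳ X))

  Inv-inv : {A : Mat a a} (i : Inv A) → Inv (inv i)
  Inv-inv i = Inv-intro _ _ (inv-ˡ i) (inv-ʳ i)

  Inv-𝟙 : Inv (𝟙 {a})
  Inv-𝟙 = Inv-intro 𝟙 𝟙 (⊗-identityˡ 𝟙) (⊗-identityˡ 𝟙)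

  Inv-⊗ : {A B : Mat a a} → Inv A → Inv B → Inv (A ⊗ B)
  Inv-⊗ {A = A} {B} i j = Inv-intro _ (inv j ⊗ inv i)
    (trans (⊗-assoc A B _) (trans (cong (A ⊗_) (cancelˡ (inv i) (inv-ʳ j))) (inv-ʳ i)))
    (trans (⊗-assoc (inv j) (inv i) _) (trans (cong (inv j ⊗_) (cancelˡ B (inv-ˡ i))) (inv-ˡ j)))

  Inv-⊗-inj₁ : {A B : Mat a a} → Inv B → Inv (A ⊗ B) → Inv A
  Inv-⊗-inj₁ {A = A} i j = subst Inv (cancelʳ A (inv-ʳ i)) (Inv-⊗ j (Inv-inv i))

  block-cong : {A A₁ : Mat a c} {B B₁ : Mat a d} {C C₁ : Mat b c} {D D₁ : Mat b d} →
    A ≡ A₁ → B ≡ B₁ → C ≡ C₁ → D ≡ D₁ → block A B C D ≡ block A₁ B₁ C₁ D₁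
  block-cong refl refl refl refl = refl

  ⊕-𝟘-⊗ : (X : Mat a b) (Y : Mat c b) → X ⊕ 𝟘 ⊗ Y ≡ X
  ⊕-𝟘-⊗ X Y = trans (cong (X ⊕_) (⊗-zeroˡ Y)) (⊕-identityʳ X)

  ⊕-⊗-𝟘 : (X : Mat a b) (Y : Mat a c) → X ⊕ Y ⊗ 𝟘 ≡ X
  ⊕-⊗-𝟘 X Y = trans (cong (X ⊕_) (⊗-zeroʳ Y)) (⊕-identityʳ X)

  𝟘-⊗-⊕ : (X : Mat a b) (Y : Mat c b) → 𝟘 ⊗ Y ⊕ X ≡ X
  𝟘-⊗-⊕ X Y = trans (cong (_⊕ X) (⊗-zeroˡ Y)) (⊕-identityˡ X)

  ⊗-𝟘-⊕ : (X : Mat a b) (Y : Mat a c) → Y ⊗ 𝟘 ⊕ X ≡ X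
  ⊗-𝟘-⊕ X Y = trans (cong (_⊕ X) (⊗-zeroʳ Y)) (⊕-identityˡ X)

  upper-⊗ : (A : Mat a a) (B : Mat a b) (D : Mat b b) (A₁ : Mat a a) (B₁ : Mat a b) (D₁ : Mat b b) →
    block A B 𝟘 D ⊗ block A₁ B₁ 𝟘 D₁ ≡ block (A ⊗ A₁) (A ⊗ B₁ ⊕ B ⊗ D₁) 𝟘 (D ⊗ D₁)
  upper-⊗ A B D A₁ B₁ D₁ = trans (block-⊗ A B 𝟘 D A₁ B₁ 𝟘 D₁) (block-cong
    (⊕-⊗-𝟘 _ B) refl (trans (⊕-⊗-𝟘 _ D) (⊗-zeroˡ A₁)) (𝟘-⊗-⊕ _ B₁))

  lower-⊗ : (A : Mat a a) (C : Mat b a) (D : Mat b b) (A₁ : Mat a a) (C₁ : Mat b a) (D₁ : Mat b b) →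
    block A 𝟘 C D ⊗ block A₁ 𝟘 C₁ D₁ ≡ block (A ⊗ A₁) 𝟘 (C ⊗ A₁ ⊕ D ⊗ C₁) (D ⊗ D₁)
  lower-⊗ A C D A₁ C₁ D₁ = trans (block-⊗ A 𝟘 C D A₁ 𝟘 C₁ D₁) (block-cong
    (⊕-𝟘-⊗ _ C₁) (trans (⊕-𝟘-⊗ _ D₁) (⊗-zeroʳ A)) refl (⊗-𝟘-⊕ _ C))

  Inv-upper : {A : Mat a a} (B : Mat a b) {D : Mat b b} → Inv A → Inv D → Inv (block A B 𝟘 D)
  Inv-upper {a = a} {b} {A = A} B {D} i j = Inv-intro _ (block A′ (⊖ (A′ ⊗ (B ⊗ D′))) 𝟘 D′)
    (trans (upper-⊗ A B D _ _ _) (trans (block-cong (inv-ʳ i)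
      (trans (cong (_⊕ B ⊗ D′) (trans (⊗-⊖ A _) (cong ⊖_ (cancelˡ (B ⊗ D′) (inv-ʳ i))))) (⊕-inverseˡ _))
      refl (inv-ʳ j)) (sym 𝟙-block)))
    (trans (upper-⊗ _ _ _ A B D) (trans (block-cong (inv-ˡ i)
      (trans (cong (A′ ⊗ B ⊕_) (trans (⊖-⊗ _ D) (cong ⊖_ (trans (cong (_⊗ D) (sym (⊗-assoc A′ B D′)))
        (cancelʳ (A′ ⊗ B) (inv-ˡ j)))))) (⊕-inverseʳ _))
      refl (inv-ˡ j)) (sym 𝟙-block)))
    where
    A′ = inv i
    D′ = inv j

  Inv-lower : {A : Mat a a} (C : Mat b a) {D : Mat b b} → Inv A → Inv D → Inv (block A 𝟘 C D)
  Inv-lower {A = A} C {D} i j = Inv-intro _ (block A′ 𝟘 (⊖ (D′ ⊗ (C ⊗ A′))) D′)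
    (trans (lower-⊗ A C D _ _ _) (trans (block-cong (inv-ʳ i) refl
      (trans (cong (C ⊗ A′ ⊕_) (trans (⊗-⊖ D _) (cong ⊖_ (cancelˡ (C ⊗ A′) (inv-ʳ j))))) (⊕-inverseʳ _))
      (inv-ʳ j)) (sym 𝟙-block)))
    (trans (lower-⊗ _ _ _ A C D) (trans (block-cong (inv-ˡ i) refl
      (trans (cong (_⊕ D′ ⊗ C) (trans (⊖-⊗ _ A) (cong ⊖_ (trans (cong (_⊗ A) (sym (⊗-assoc D′ C A′)))
        (cancelʳ (D′ ⊗ C) (inv-ˡ i)))))) (⊕-inverseˡ _))
      (inv-ˡ j)) (sym 𝟙-block)))
    where
    A′ = inv i
    D′ = inv j

  infix 4 _~_
  _~_ : Mat a b → Mat a b → Set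
  A ~ B = ∃₂ λ P Q → Inv P × Inv Q × A ≡ P ⊗ (B ⊗ Q)

  ~-refl : {A : Mat a b} → A ~ A
  ~-refl {A = A} = 𝟙 , 𝟙 , Inv-𝟙 , Inv-𝟙 , sym (trans (⊗-identityˡ _) (⊗-identityʳ A))

  ~-trans : {A B C : Mat a b} → A ~ B → B ~ C → A ~ C
  ~-trans {A = A} {B} {C} (P , Q , i , j , p) (P₁ , Q₁ , i₁ , j₁ , p₁) =
    P ⊗ P₁ , Q₁ ⊗ Q , Inv-⊗ i i₁ , Inv-⊗ j₁ j , (begin
      A ≡⟨ p ⟩
      P ⊗ (B ⊗ Q) ≡⟨ cong (λ X → P ⊗ (X ⊗ Q)) p₁ ⟩
      P ⊗ (P₁ ⊗ (C ⊗ Q₁) ⊗ Q) ≡⟨ cong (P ⊗_) (⊗-assoc P₁ _ Q) ⟩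
      P ⊗ (P₁ ⊗ (C ⊗ Q₁ ⊗ Q)) ≡⟨ ⊗-assoc P P₁ _ ⟨
      P ⊗ P₁ ⊗ (C ⊗ Q₁ ⊗ Q) ≡⟨ cong (P ⊗ P₁ ⊗_) (⊗-assoc C Q₁ Q) ⟩
      P ⊗ P₁ ⊗ (C ⊗ (Q₁ ⊗ Q)) ∎)

  ~-left : {P : Mat a a} (A : Mat a b) → Inv P → A ~ P ⊗ A
  ~-left {P = P} A i = inv i , 𝟙 , Inv-inv i , Inv-𝟙 ,
    sym (trans (cong (inv i ⊗_) (⊗-identityʳ _)) (cancelˡ A (inv-ˡ i)))

  ~-right : {Q : Mat b b} (A : Mat a b) → Inv Q → A ~ A ⊗ Q
  ~-right {Q = Q} A i = 𝟙 , inv i , Inv-𝟙 , Inv-inv i ,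
    sym (trans (⊗-identityˡ _) (cancelʳ A (inv-ʳ i)))

  ~-block : {D D₁ : Mat a b} → D ~ D₁ → block (𝟙 {c}) 𝟘 𝟘 D ~ block 𝟙 𝟘 𝟘 D₁
  ~-block {D = D} {D₁} (P , Q , i , j , p) = block 𝟙 𝟘 𝟘 P , block 𝟙 𝟘 𝟘 Q , Inv-upper 𝟘 Inv-𝟙 i , Inv-upper 𝟘 Inv-𝟙 j ,
    sym (trans (cong (block 𝟙 𝟘 𝟘 P ⊗_) (diag-⊗ D₁ Q)) (trans (diag-⊗ P (D₁ ⊗ Q)) (cong (block 𝟙 𝟘 𝟘) (sym p))))
    where
    diag-⊗ : (X : Mat a b) (Y : Mat b d) → block (𝟙 {c}) 𝟘 𝟘 X ⊗ block 𝟙 𝟘 𝟘 Y ≡ block 𝟙 𝟘 𝟘 (X ⊗ Y)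
    diag-⊗ X Y = trans (block-⊗ 𝟙 𝟘 𝟘 X 𝟙 𝟘 𝟘 Y) (block-cong
      (trans (⊕-𝟘-⊗ _ 𝟘) (⊗-identityˡ 𝟙)) (trans (⊕-𝟘-⊗ _ Y) (⊗-zeroʳ 𝟙))
      (trans (⊕-⊗-𝟘 _ X) (⊗-zeroˡ 𝟙)) (𝟘-⊗-⊕ _ 𝟘))

  nonzero-entry : (A : Mat a b) → A ≢ 𝟘 → ∃₂ λ i j → A ⟨ i , j ⟩ ≢ 0#
  nonzero-entry A A≢𝟘 with Fin.all? (λ i → Fin.all? (λ j → Finite._≟_ finite (A ⟨ i , j ⟩) 0#))
  ... | yes z = contradiction (ext λ i j → trans (z i j) (sym (𝟘-entry i j))) A≢𝟘
  ... | no ¬z with Fin.¬∀⟶∃¬ _ _ (λ i → Fin.all? (λ j → Finite._≟_ finite (A ⟨ i , j ⟩) 0#)) ¬z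
  ... | i , ¬zᵢ with Fin.¬∀⟶∃¬ _ _ (λ j → Finite._≟_ finite (A ⟨ i , j ⟩) 0#) ¬zᵢ
  ... | j , ¬zᵢⱼ = i , j , ¬zᵢⱼ

  nonzero-row : (A : Mat a b) → A ≢ 𝟘 → ∃ λ (w : Mat 1 a) → w ⊗ A ≢ 𝟘
  nonzero-row A A≢𝟘 = let i , j , ≢0 = nonzero-entry A A≢𝟘 in unit-row i , λ z →
    ≢0 (trans (sym (unit-row-⊗ i A j)) (trans (cong (_⟨ zero , j ⟩) z) (𝟘-entry zero j)))

  nonzero-column : (A : Mat a b) → A ≢ 𝟘 → ∃ λ (v : Mat b 1) → A ⊗ v ≢ 𝟘
  nonzero-column A A≢𝟘 = let i , j , ≢0 = nonzero-entry A A≢𝟘 in unit-column j , λ z →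
    ≢0 (trans (sym (⊗-unit-column A j i)) (trans (cong (_⟨ i , zero ⟩) z) (𝟘-entry i zero)))

  Inv-1×1 : (x : Mat 1 1) → x ≢ 𝟘 → Inv x
  Inv-1×1 x x≢𝟘 =
    let y , xy , yx = inverse (x ⟨ zero , zero ⟩) (λ z → x≢𝟘 (ext λ { zero zero → trans z (sym (𝟘-entry zero zero)) }))
    in subst Inv (sym (scalar-η x)) (Inv-intro _ (scalar y)
         (trans (scalar-⊗ _ y) (trans (cong scalar xy) scalar-1))
         (trans (scalar-⊗ y _) (trans (cong scalar yx) scalar-1)))

  -- Only existence of a suitable r is recorded. That r is determined by the matrix follows later
  -- from `ν`, which is invariant under `_~_`.
  NormalForm : Mat a b → Set
  NormalForm {a} {b} A = ∃ λ r → r ≤ a × r ≤ b × A ~ E r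

  private
    nf-resp : {A B : Mat a b} → A ~ B → NormalForm B → NormalForm A
    nf-resp p (r , r≤a , r≤b , s) = r , r≤a , r≤b , ~-trans p s

  module _ (ih : (D : Mat a b) → NormalForm D) where

    -- Clearing the first row and column with the Schur complement.
    nf-pivot : ∀ (x : Mat 1 1) (ρ : Mat 1 b) (γ : Mat a 1) (D : Mat a b) → Inv x → NormalForm (block x ρ γ D)
    nf-pivot x ρ γ D i = nf-resp (P , Q , Inv-lower γ i Inv-𝟙 , Inv-upper (y ⊗ ρ) Inv-𝟙 Inv-𝟙 , sym PBQ)
      (let r , r≤a , r≤b , s = ih S in suc r , s≤s r≤a , s≤s r≤b , subst (block 𝟙 𝟘 𝟘 S ~_) (sym (E-suc r)) (~-block s))
      where
      y = inv i
      S = ⊖ (γ ⊗ (y ⊗ ρ)) ⊕ D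
      P = block x 𝟘 γ 𝟙
      Q = block 𝟙 (y ⊗ ρ) 𝟘 𝟙
      PBQ : P ⊗ (block 𝟙 𝟘 𝟘 S ⊗ Q) ≡ block x ρ γ D
      PBQ = begin
        P ⊗ (block 𝟙 𝟘 𝟘 S ⊗ Q)
          ≡⟨ cong (P ⊗_) (trans (block-⊗ 𝟙 𝟘 𝟘 S 𝟙 (y ⊗ ρ) 𝟘 𝟙) (block-cong
               (trans (⊕-𝟘-⊗ _ 𝟘) (⊗-identityˡ 𝟙)) (trans (⊕-𝟘-⊗ _ 𝟙) (⊗-identityˡ (y ⊗ ρ)))
               (trans (⊕-⊗-𝟘 _ S) (⊗-zeroˡ 𝟙)) (trans (𝟘-⊗-⊕ _ (y ⊗ ρ)) (⊗-identityʳ S)))) ⟩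
        P ⊗ block 𝟙 (y ⊗ ρ) 𝟘 S
          ≡⟨ trans (block-⊗ x 𝟘 γ 𝟙 𝟙 (y ⊗ ρ) 𝟘 S) (block-cong
               (trans (⊕-𝟘-⊗ _ 𝟘) (⊗-identityʳ x)) (trans (⊕-𝟘-⊗ _ S) (cancelˡ ρ (inv-ʳ i)))
               (trans (⊕-⊗-𝟘 _ 𝟙) (⊗-identityʳ γ))
               (trans (cong (γ ⊗ (y ⊗ ρ) ⊕_) (⊗-identityˡ S)) (⊕-⊖-cancel _ D))) ⟩
        block x ρ γ D ∎

    -- If the corner x is 0, some column v has ρ v ≠ 0, and the column operation given by v puts ρ v
    -- into the corner as a pivot.
    nf-row : ∀ (x : Mat 1 1) (ρ : Mat 1 b) (γ : Mat a 1) (D : Mat a b) → ρ ≢ 𝟘 → NormalForm (block x ρ γ D)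
    nf-row x ρ γ D ρ≢𝟘 with x ≟ 𝟘
    ... | no x≢𝟘 = nf-pivot x ρ γ D (Inv-1×1 x x≢𝟘)
    ... | yes refl = let v , ρv≢𝟘 = nonzero-column ρ ρ≢𝟘 in
      nf-resp (~-right _ (Inv-lower v Inv-𝟙 Inv-𝟙)) (subst NormalForm
        (sym (block-⊗ 𝟘 ρ γ D 𝟙 𝟘 v 𝟙))
        (nf-pivot _ _ _ _ (Inv-1×1 _ (λ z → ρv≢𝟘 (trans (sym (𝟘-⊗-⊕ _ 𝟙)) z)))))

    nf-column : ∀ (x : Mat 1 1) (ρ : Mat 1 b) (γ : Mat a 1) (D : Mat a b) → γ ≢ 𝟘 → NormalForm (block x ρ γ D)
    nf-column x ρ γ D γ≢𝟘 with x ≟ 𝟘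
    ... | no x≢𝟘 = nf-pivot x ρ γ D (Inv-1×1 x x≢𝟘)
    ... | yes refl = let w , wγ≢𝟘 = nonzero-row γ γ≢𝟘 in
      nf-resp (~-left _ (Inv-upper w Inv-𝟙 Inv-𝟙)) (subst NormalForm
        (sym (block-⊗ 𝟙 w 𝟘 𝟙 𝟘 ρ γ D))
        (nf-pivot _ _ _ _ (Inv-1×1 _ (λ z → wγ≢𝟘 (trans (sym (⊗-𝟘-⊕ _ 𝟙)) z)))))

    nf-step : (A : Mat (1 ℕ.+ a) (1 ℕ.+ b)) → NormalForm A
    nf-step A = subst NormalForm (vcat-η 1 A) (subst NormalForm
      (cong₂ vcat (hcat-η 1 (top 1 A)) (hcat-η 1 (bottom 1 A))) (cases _ _ _ _))
      where
      cases : ∀ (x : Mat 1 1) (ρ : Mat 1 b) (γ : Mat a 1) (D : Mat a b) → NormalForm (block x ρ γ D)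
      cases x ρ γ D with x ≟ 𝟘 | ρ ≟ 𝟘 | γ ≟ 𝟘 | D ≟ 𝟘
      ... | no x≢𝟘 | _ | _ | _ = nf-pivot x ρ γ D (Inv-1×1 x x≢𝟘)
      ... | yes _ | no ρ≢𝟘 | _ | _ = nf-row x ρ γ D ρ≢𝟘
      ... | yes _ | yes _ | no γ≢𝟘 | _ = nf-column x ρ γ D γ≢𝟘
      ... | yes refl | yes refl | yes refl | yes refl = 0 , z≤n , z≤n ,
        subst (_~ E 0) (trans E-zero (𝟘-block {1} {_} {1})) ~-refl
      -- A row operation given by w brings the nonzero row w D into the first row, which reduces
      -- this case to `nf-row`.
      ... | yes _ | yes refl | yes _ | no D≢𝟘 = let w , wD≢𝟘 = nonzero-row D D≢𝟘 in
        nf-resp (~-left _ (Inv-upper w Inv-𝟙 Inv-𝟙)) (subst NormalForm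
          (sym (block-⊗ 𝟙 w 𝟘 𝟙 x 𝟘 γ D))
          (nf-row _ _ _ _ (λ z → wD≢𝟘 (trans (sym (⊗-𝟘-⊕ _ 𝟙)) z))))

  normalForm : (A : Mat a b) → NormalForm A
  normalForm {zero} A = 0 , z≤n , z≤n , subst (_~ E 0) (no-rows _ A) ~-refl
  normalForm {suc a} {zero} A = 0 , z≤n , z≤n , subst (_~ E 0) (no-columns _ A) ~-refl
  normalForm {suc a} {suc b} A = nf-step normalForm A

  -- ν A is q to the corank of A, so ranks are handled by counting kernel vectors.
  opaque
    ν : Mat a b → ℕ
    ν {a} A = ∑ (mats 1 a) λ z → ⟦ z ⊗ A ≟ 𝟘 ⟧

    ν-def : (A : Mat a b) → ν A ≡ ∑ (mats 1 a) λ z → ⟦ z ⊗ A ≟ 𝟘 ⟧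
    ν-def A = refl

  ν-unique : (A : Mat a b) → (∀ (z : Mat 1 a) → z ⊗ A ≡ 𝟘 → z ≡ 𝟘) → ν A ≡ 1
  ν-unique {a} A only = trans (ν-def A) (∑-unique (mats 1 a) (λ z → z ⊗ A ≟ 𝟘) 𝟘 (⊗-zeroˡ A) only)

  ν-rinv : {A : Mat a b} {R : Mat b a} → A ⊗ R ≡ 𝟙 → ν A ≡ 1
  ν-rinv {A = A} {R} p = ν-unique A λ z zA → trans (sym (cancelʳ z p)) (trans (cong (_⊗ R) zA) (⊗-zeroˡ R))

  ν-⊗ʳ : (A : Mat a b) {Q : Mat b c} {Q′ : Mat c b} → Q ⊗ Q′ ≡ 𝟙 → ν (A ⊗ Q) ≡ ν A
  ν-⊗ʳ {a} A {Q} {Q′} p = trans (ν-def (A ⊗ Q)) (trans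
    (∑-cong (mats 1 a) λ z → ⟦⟧-cong (z ⊗ (A ⊗ Q) ≟ 𝟘) (z ⊗ A ≟ 𝟘)
      (λ e → trans (sym (cancelʳ (z ⊗ A) p)) (trans (cong (_⊗ Q′) (trans (⊗-assoc z A Q) e)) (⊗-zeroˡ Q′)))
      (λ e → trans (sym (⊗-assoc z A Q)) (trans (cong (_⊗ Q) e) (⊗-zeroˡ Q))))
    (sym (ν-def A)))

  ν-⊗ˡ : (A : Mat a b) {P : Mat a a} → Inv P → ν (P ⊗ A) ≡ ν A
  ν-⊗ˡ {a} A {P} i = begin
    ν (P ⊗ A) ≡⟨ ν-def (P ⊗ A) ⟩
    ∑ (mats 1 a) (λ z → ⟦ z ⊗ (P ⊗ A) ≟ 𝟘 ⟧) ≡⟨ ∑-cong (mats 1 a) (λ z → cong (λ X → ⟦ X ≟ 𝟘 ⟧) (sym (⊗-assoc z P A))) ⟩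
    ∑ (mats 1 a) (λ z → ⟦ z ⊗ P ⊗ A ≟ 𝟘 ⟧) ≡⟨ ∑-permute (mats 1 a) (_⊗ P) (_⊗ inv i)
                                                    (λ z → cancelʳ z (inv-ˡ i)) (λ z → cancelʳ z (inv-ʳ i)) (λ z → ⟦ z ⊗ A ≟ 𝟘 ⟧) ⟩
    ∑ (mats 1 a) (λ z → ⟦ z ⊗ A ≟ 𝟘 ⟧) ≡⟨ ν-def A ⟨
    ν A ∎

  ν-~ : {A B : Mat a b} → A ~ B → ν A ≡ ν B
  ν-~ {B = B} (P , Q , i , j , refl) = trans (ν-⊗ˡ (B ⊗ Q) i) (ν-⊗ʳ B (inv-ʳ j))

  card-mats : ∀ a b → card (mats a b) ≡ q ℕ.^ (b ℕ.* a)
  card-mats a b = trans (card-Mat finite a b) (ℕ.^-*-assoc q b a)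

  ∑-≟𝟘 : ∀ a b → ∑ (mats a b) (λ z → ⟦ z ≟ 𝟘 ⟧) ≡ 1
  ∑-≟𝟘 a b = ∑-once (mats a b) 𝟘

  -- The coordinates of a kernel vector that meet the zero rows are unconstrained.
  ν-vcat-𝟘 : (A : Mat a b) → ν (vcat A (𝟘 {c})) ≡ ν A ℕ.* q ℕ.^ c
  ν-vcat-𝟘 {a} {c = c} A = begin
    ν (vcat A 𝟘)
      ≡⟨ ν-def _ ⟩
    ∑ (mats 1 (a ℕ.+ c)) (λ z → ⟦ z ⊗ vcat A 𝟘 ≟ 𝟘 ⟧)
      ≡⟨ ∑-hcat finite 1 _ ⟩
    ∑ (mats 1 a) (λ x → ∑ (mats 1 c) λ y → ⟦ hcat x y ⊗ vcat A 𝟘 ≟ 𝟘 ⟧)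
      ≡⟨ ∑-cong (mats 1 a) (λ x → trans (∑-cong (mats 1 c) λ y →
           cong (λ X → ⟦ X ≟ 𝟘 ⟧) (trans (hcat-⊗-vcat x y A 𝟘) (⊕-⊗-𝟘 _ y)))
           (trans (∑-const (mats 1 c) _) (ℕ.*-comm (card (mats 1 c)) _))) ⟩
    ∑ (mats 1 a) (λ x → ⟦ x ⊗ A ≟ 𝟘 ⟧ ℕ.* card (mats 1 c))
      ≡⟨ ∑-*ʳ (mats 1 a) _ _ ⟩
    ∑ (mats 1 a) (λ x → ⟦ x ⊗ A ≟ 𝟘 ⟧) ℕ.* card (mats 1 c)
      ≡⟨ cong₂ ℕ._*_ (sym (ν-def A)) (trans (card-mats 1 c) (cong (q ℕ.^_) (ℕ.*-identityʳ c))) ⟩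
    ν A ℕ.* q ℕ.^ c ∎

  ν-E : r ≤ a → r ≤ b → ν (E r {a} {b}) ≡ q ℕ.^ (a ∸ r)
  ν-E {r} r≤a r≤b with s , refl ← ℕ.m≤n⇒∃[o]m+o≡n r≤a | t , refl ← ℕ.m≤n⇒∃[o]m+o≡n r≤b = begin
    ν (E r {r ℕ.+ s} {r ℕ.+ t}) ≡⟨ cong ν (trans (E-block r) (cong (vcat _) (sym (𝟘-hcat {b = r})))) ⟩
    ν (vcat (hcat (𝟙 {r}) 𝟘) 𝟘) ≡⟨ ν-vcat-𝟘 _ ⟩
    ν (hcat (𝟙 {r}) (𝟘 {r} {t})) ℕ.* q ℕ.^ s
      ≡⟨ cong (ℕ._* q ℕ.^ s) (ν-rinv {R = vcat 𝟙 𝟘} (trans (hcat-⊗-vcat 𝟙 𝟘 𝟙 𝟘) (trans (⊕-𝟘-⊗ _ 𝟘) (⊗-identityˡ 𝟙)))) ⟩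
    1 ℕ.* q ℕ.^ s ≡⟨ ℕ.*-identityˡ _ ⟩
    q ℕ.^ s ≡⟨ cong (q ℕ.^_) (ℕ.m+n∸m≡n r s) ⟨
    q ℕ.^ (r ℕ.+ s ∸ r) ∎

-- Rank, orders of linear groups, and counting matrices by their image

module Rank (𝔽 : FiniteSkewField) where

  open OverField 𝔽 public
  open FiniteSkewField 𝔽 using (finite; 1<card)
  open import Data.Nat.Base using (_*_; _^_)
  open ≡-Reasoning

  private variable
    a b c d j k l m n r : ℕ

  1<q : 1 < q
  1<q = 1<card

  q^-injective : ∀ {s t} → q ^ s ≡ q ^ t → s ≡ t
  q^-injective {s} {t} p with ℕ.<-cmp s t
  ... | tri< s<t _ _ = contradiction p (ℕ.<⇒≢ (ℕ.^-monoʳ-< q 1<q s<t))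
  ... | tri≈ _ s≡t _ = s≡t
  ... | tri> _ _ t<s = contradiction (sym p) (ℕ.<⇒≢ (ℕ.^-monoʳ-< q 1<q t<s))

  ν≡q^ : (A : Mat a b) → ∃ λ r → r ≤ a × r ≤ b × A ~ E r × ν A ≡ q ^ (a ∸ r)
  ν≡q^ A = let r , r≤a , r≤b , s = normalForm A in r , r≤a , r≤b , s , trans (ν-~ s) (ν-E r≤a r≤b)

  ν≡q^s⇒s≤ : ∀ {s} (A : Mat a b) → ν A ≡ q ^ s → s ≤ a
  ν≡q^s⇒s≤ {a} {s = s} A p = let r , _ , _ , _ , p′ = ν≡q^ A in
    subst (_≤ a) (q^-injective {a ∸ r} {s} (trans (sym p′) p)) (ℕ.m∸n≤m a r)

  -- `ν A ≡ 1` says that the rows of A are independent, equivalently that A maps columns onto K^a.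
  -- Surjectivity is always expressed in this form.
  full-rank : (A : Mat a b) → ν A ≡ 1 → a ≤ b × A ~ E a
  full-rank {a} A p with r , r≤a , r≤b , s , p′ ← ν≡q^ A
    with refl ← ℕ.≤-antisym r≤a (ℕ.m∸n≡0⇒m≤n {a} {r} (q^-injective {a ∸ r} {0} (trans (sym p′) p))) = r≤b , s

  corner : ∀ m k → Mat (m ℕ.+ k) (m ℕ.+ k)
  corner m k = block (𝟙 {m}) 𝟘 𝟘 (𝟘 {k} {k})

  corank : (A : Mat (m ℕ.+ k) (m ℕ.+ k)) → ν A ≡ q ^ k → A ~ corner m k
  corank {m} {k} A p with r , r≤ , _ , s , p′ ← ν≡q^ A
    with refl ← ℕ.∸-cancelˡ-≡ {r} {m ℕ.+ k} {m} r≤ (ℕ.m≤m+n m k)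
           (trans (q^-injective {m ℕ.+ k ∸ r} {k} (trans (sym p′) p)) (sym (ℕ.m+n∸m≡n m k)))
    = subst (A ~_) (E-block m) s

  Inv-square : (A : Mat a a) → ν A ≡ 1 → Inv A
  Inv-square {a} A p with _ , P , Q , i , j , refl ← full-rank A p =
    Inv-⊗ i (subst Inv (trans (sym (⊗-identityˡ Q)) (cong (_⊗ Q) (sym (E-full a)))) j)

  Inv⇒ν : {A : Mat a a} → Inv A → ν A ≡ 1
  Inv⇒ν i = ν-rinv (inv-ʳ i)

  -- A change of basis of the source alone suffices: the row operation P crosses over by P [1 0] =
  -- [1 0] diag(P, 1).
  surjective-normal : (A : Mat a (a ℕ.+ l)) → ν A ≡ 1 → ∃ λ Q → Inv Q × A ≡ hcat 𝟙 𝟘 ⊗ Q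
  surjective-normal {a} {l} A p with _ , P , Q , i , j , refl ← full-rank A p =
    block P 𝟘 𝟘 𝟙 ⊗ Q , Inv-⊗ (Inv-upper 𝟘 i Inv-𝟙) j , (begin
      P ⊗ (E a ⊗ Q) ≡⟨ ⊗-assoc P (E a) Q ⟨
      P ⊗ E a ⊗ Q ≡⟨ cong (_⊗ Q) (begin
        P ⊗ E a ≡⟨ cong (P ⊗_) (E-wide a) ⟩
        P ⊗ hcat 𝟙 𝟘 ≡⟨ ⊗-hcat P 𝟙 𝟘 ⟩
        hcat (P ⊗ 𝟙) (P ⊗ 𝟘) ≡⟨ cong₂ hcat (trans (⊗-identityʳ P) (sym (⊗-identityˡ P))) (trans (⊗-zeroʳ P) (sym (⊗-zeroʳ 𝟙))) ⟩
        hcat (𝟙 ⊗ P) (𝟙 ⊗ 𝟘) ≡⟨ cong₂ hcat (sym (⊕-𝟘-⊗ _ 𝟘)) (sym (⊕-𝟘-⊗ _ 𝟙)) ⟩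
        hcat (𝟙 ⊗ P ⊕ 𝟘 ⊗ 𝟘) (𝟙 ⊗ 𝟘 ⊕ 𝟘 ⊗ 𝟙) ≡⟨ hcat-⊗-block 𝟙 𝟘 P 𝟘 𝟘 𝟙 ⟨
        hcat 𝟙 𝟘 ⊗ block P 𝟘 𝟘 𝟙 ∎) ⟩
      hcat 𝟙 𝟘 ⊗ block P 𝟘 𝟘 𝟙 ⊗ Q ≡⟨ ⊗-assoc _ _ Q ⟩
      hcat 𝟙 𝟘 ⊗ (block P 𝟘 𝟘 𝟙 ⊗ Q) ∎)

  right-inverse : (A : Mat a b) → ν A ≡ 1 → ∃ λ (R : Mat b a) → A ⊗ R ≡ 𝟙
  right-inverse {a} A p with l , refl ← ℕ.m≤n⇒∃[o]m+o≡n (proj₁ (full-rank A p))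
    with Q , i , refl ← surjective-normal A p = inv i ⊗ vcat 𝟙 𝟘 , (begin
      hcat 𝟙 𝟘 ⊗ Q ⊗ (inv i ⊗ vcat 𝟙 𝟘) ≡⟨ ⊗-assoc _ Q _ ⟩
      hcat 𝟙 𝟘 ⊗ (Q ⊗ (inv i ⊗ vcat 𝟙 𝟘)) ≡⟨ cong (hcat 𝟙 𝟘 ⊗_) (cancelˡ _ (inv-ʳ i)) ⟩
      hcat 𝟙 𝟘 ⊗ vcat 𝟙 𝟘 ≡⟨ hcat-⊗-vcat 𝟙 𝟘 𝟙 𝟘 ⟩
      𝟙 ⊗ 𝟙 ⊕ 𝟘 ⊗ 𝟘 ≡⟨ trans (⊕-𝟘-⊗ _ 𝟘) (⊗-identityˡ 𝟙) ⟩
      𝟙 ∎)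

  block-η : ∀ a {b} c {d} (M : Mat (a ℕ.+ b) (c ℕ.+ d)) →
    M ≡ block (left c (top a M)) (right c (top a M)) (left c (bottom a M)) (right c (bottom a M))
  block-η a c M = sym (trans (cong₂ vcat (hcat-η c (top a M)) (hcat-η c (bottom a M))) (vcat-η a M))

  -- In a right inverse [X Y; Z W] the lower right block gives H W = 1, so the square matrix H is
  -- invertible. Then H Z = 0 forces Z = 0, and G X = 1 remains.
  Inv-upper⁻ : {G : Mat a a} {S : Mat a b} {H : Mat b b} → Inv (block G S 𝟘 H) → Inv G × Inv H
  Inv-upper⁻ {a} {b} {G} {S} {H} i = Inv-square G (ν-rinv GX) , H-inv
    where
    X = left a (top a (inv i))
    Y = right a (top a (inv i))
    Z = left a (bottom a (inv i))
    W = right a (bottom a (inv i))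
    eqs = block-injective (trans (sym (block-⊗ G S 𝟘 H X Y Z W))
      (trans (cong (block G S 𝟘 H ⊗_) (sym (block-η a a (inv i)))) (trans (inv-ʳ i) 𝟙-block)))
    H-inv : Inv H
    H-inv = Inv-square H (ν-rinv (trans (sym (𝟘-⊗-⊕ _ Y)) (proj₂ (proj₂ eqs))))
    Z≡𝟘 : Z ≡ 𝟘
    Z≡𝟘 = trans (sym (cancelˡ Z (inv-ˡ H-inv)))
      (trans (cong (inv H-inv ⊗_) (trans (sym (𝟘-⊗-⊕ _ X)) (proj₁ (proj₂ eqs)))) (⊗-zeroʳ _))
    GX : G ⊗ X ≡ 𝟙
    GX = trans (sym (⊕-⊗-𝟘 _ S)) (trans (cong (λ z → G ⊗ X ⊕ S ⊗ z) (sym Z≡𝟘)) (proj₁ (proj₁ eqs)))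

  -- The upper right block of the equation for a right inverse forces Y = 0, and then the lower
  -- right block reads H W = 1.
  Inv-lower⁻ : {S : Mat b a} {H : Mat b b} → Inv (block 𝟙 𝟘 S H) → Inv H
  Inv-lower⁻ {b} {a} {S} {H} i = Inv-square H (ν-rinv (trans (sym (⊗-𝟘-⊕ _ S))
      (trans (cong (λ y → S ⊗ y ⊕ H ⊗ W) (sym Y≡𝟘)) (proj₂ (proj₂ eqs)))))
    where
    X = left a (top a (inv i))
    Y = right a (top a (inv i))
    Z = left a (bottom a (inv i))
    W = right a (bottom a (inv i))
    eqs = block-injective (trans (sym (block-⊗ 𝟙 𝟘 S H X Y Z W))
      (trans (cong (block 𝟙 𝟘 S H ⊗_) (sym (block-η a a (inv i)))) (trans (inv-ʳ i) 𝟙-block)))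
    Y≡𝟘 : Y ≡ 𝟘
    Y≡𝟘 = trans (sym (trans (⊕-𝟘-⊗ _ W) (⊗-identityˡ Y))) (proj₂ (proj₁ eqs))

  gl : ℕ → ℕ
  gl n = ∑ (mats n n) λ A → ⟦ Inv? A ⟧

  -- The number of surjections from K^k onto K^j.
  surj : ℕ → ℕ → ℕ
  surj j k = ∑ (mats j k) λ U → ⟦ ν U ℕ.≟ 1 ⟧

  -- No completion exists unless U is surjective. If it is, a change of basis makes U = [1 0]; in
  -- the completing rows [S H] the block S is then free and H has to be invertible.
  ∑-extensions : ∀ j l (U : Mat j (j ℕ.+ l)) →
    ∑ (mats l (j ℕ.+ l)) (λ V → ⟦ Inv? (vcat U V) ⟧) ≡ ⟦ ν U ℕ.≟ 1 ⟧ * (q ^ (j * l) * gl l)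
  ∑-extensions j l U with ν U ℕ.≟ 1
  ... | no ν≢1 = ∑-zero (mats l (j ℕ.+ l)) λ V → ⟦⟧-no (Inv? (vcat U V)) λ i → ν≢1 (ν-rinv {R = inv i ⊗ vcat 𝟙 𝟘} (begin
    U ⊗ (inv i ⊗ vcat 𝟙 𝟘) ≡⟨ ⊗-assoc U (inv i) _ ⟨
    U ⊗ inv i ⊗ vcat 𝟙 𝟘 ≡⟨ cong (_⊗ vcat 𝟙 𝟘) (proj₁ (vcat-injective (begin
      vcat (U ⊗ inv i) (V ⊗ inv i) ≡⟨ vcat-⊗ U V (inv i) ⟨
      vcat U V ⊗ inv i ≡⟨ trans (inv-ʳ i) 𝟙-block ⟩
      vcat (hcat 𝟙 𝟘) (hcat 𝟘 𝟙) ∎))) ⟩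
    hcat 𝟙 𝟘 ⊗ vcat 𝟙 𝟘 ≡⟨ hcat-⊗-vcat 𝟙 𝟘 𝟙 𝟘 ⟩
    𝟙 ⊗ 𝟙 ⊕ 𝟘 ⊗ 𝟘 ≡⟨ trans (⊕-𝟘-⊗ _ 𝟘) (⊗-identityˡ 𝟙) ⟩
    𝟙 ∎))
  ... | yes ν≡1 with Q , i , refl ← surjective-normal U ν≡1 = begin
    ∑ (mats l (j ℕ.+ l)) (λ V → ⟦ Inv? (vcat (hcat 𝟙 𝟘 ⊗ Q) V) ⟧)
      ≡⟨ ∑-permute (mats l (j ℕ.+ l)) (_⊗ Q) (_⊗ inv i) (λ V → cancelʳ V (inv-ˡ i)) (λ V → cancelʳ V (inv-ʳ i)) _ ⟨
    ∑ (mats l (j ℕ.+ l)) (λ V → ⟦ Inv? (vcat (hcat 𝟙 𝟘 ⊗ Q) (V ⊗ Q)) ⟧)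
      ≡⟨ ∑-cong (mats l (j ℕ.+ l)) (λ V → trans (cong (λ M → ⟦ Inv? M ⟧) (sym (vcat-⊗ _ V Q)))
           (⟦⟧-cong (Inv? (vcat (hcat 𝟙 𝟘) V ⊗ Q)) (Inv? (vcat (hcat 𝟙 𝟘) V)) (Inv-⊗-inj₁ i) (λ i′ → Inv-⊗ i′ i))) ⟩
    ∑ (mats l (j ℕ.+ l)) (λ V → ⟦ Inv? (vcat (hcat 𝟙 𝟘) V) ⟧)
      ≡⟨ ∑-hcat finite l _ ⟩
    ∑ (mats l j) (λ S → ∑ (mats l l) λ H → ⟦ Inv? (block 𝟙 𝟘 S H) ⟧)
      ≡⟨ ∑-cong (mats l j) (λ S → ∑-cong (mats l l) λ H →
           ⟦⟧-cong (Inv? (block 𝟙 𝟘 S H)) (Inv? H) Inv-lower⁻ (Inv-lower S Inv-𝟙)) ⟩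
    ∑ (mats l j) (λ S → gl l)
      ≡⟨ ∑-const (mats l j) (gl l) ⟩
    card (mats l j) * gl l
      ≡⟨ cong (_* gl l) (card-mats l j) ⟩
    q ^ (j * l) * gl l
      ≡⟨ ℕ.*-identityˡ _ ⟨
    1 * (q ^ (j * l) * gl l) ∎

  -- Invertible matrices are sorted by their first j rows. The case j = 1 yields the order of the
  -- group in `gl-suc`; the general case trades `surj j k` for a quotient of group orders in
  -- `pairExtensions-≤`.
  gl-+ : ∀ j l → gl (j ℕ.+ l) ≡ surj j (j ℕ.+ l) * (q ^ (j * l) * gl l)
  gl-+ j l = begin
    ∑ (mats (j ℕ.+ l) (j ℕ.+ l)) (λ M → ⟦ Inv? M ⟧)
      ≡⟨ ∑-vcat finite {j} {l} (j ℕ.+ l) _ ⟩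
    ∑ (mats j (j ℕ.+ l)) (λ U → ∑ (mats l (j ℕ.+ l)) λ V → ⟦ Inv? (vcat U V) ⟧)
      ≡⟨ ∑-cong (mats j (j ℕ.+ l)) (∑-extensions j l) ⟩
    ∑ (mats j (j ℕ.+ l)) (λ U → ⟦ ν U ℕ.≟ 1 ⟧ * (q ^ (j * l) * gl l))
      ≡⟨ ∑-*ʳ (mats j (j ℕ.+ l)) _ _ ⟩
    surj j (j ℕ.+ l) * (q ^ (j * l) * gl l) ∎

  ∑-block : ∀ a b c d (f : Mat (a ℕ.+ b) (c ℕ.+ d) → ℕ) → ∑ (mats (a ℕ.+ b) (c ℕ.+ d)) f ≡
    ∑ (mats a c) λ A → ∑ (mats a d) λ B → ∑ (mats b c) λ C → ∑ (mats b d) λ D → f (block A B C D)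
  ∑-block a b c d f = trans (∑-vcat finite {a} {b} (c ℕ.+ d) f)
    (trans (∑-hcat finite a _) (∑-cong (mats a c) λ A → ∑-cong (mats a d) λ B → ∑-hcat finite b _))

  -- The stabiliser of an m-dimensional subspace of K^(m+k).
  parabolic : ∀ m k → ∑ (mats (m ℕ.+ k) (m ℕ.+ k)) (λ X → ⟦ Inv? X ⟧ * ⟦ bottom m (X ⊗ corner m k) ≟ 𝟘 ⟧)
    ≡ q ^ (k * m) * gl m * gl k
  parabolic m k = begin
    _ ≡⟨ ∑-block m k m k _ ⟩
    ∑ (mats m m) (λ G → ∑ (mats m k) λ S → ∑ (mats k m) λ T → ∑ (mats k k) λ H →
      ⟦ Inv? (block G S T H) ⟧ * ⟦ bottom m (block G S T H ⊗ corner m k) ≟ 𝟘 ⟧)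
      ≡⟨ ∑-cong (mats m m) (λ G → ∑-cong (mats m k) λ S → trans (∑-cong (mats k m) λ T → trans (∑-cong (mats k k) λ H →
           trans (ℕ.*-comm ⟦ Inv? (block G S T H) ⟧ _) (cong (_* ⟦ Inv? (block G S T H) ⟧) (vanish G S T H)))
           (∑-*ˡ (mats k k) ⟦ T ≟ 𝟘 ⟧ _)) (∑-point (mats k m) 𝟘 (λ T → ∑ (mats k k) λ H → ⟦ Inv? (block G S T H) ⟧))) ⟩
    ∑ (mats m m) (λ G → ∑ (mats m k) λ S → ∑ (mats k k) λ H → ⟦ Inv? (block G S 𝟘 H) ⟧)
      ≡⟨ ∑-cong (mats m m) (λ G → trans (∑-cong (mats m k) λ S → trans
           (∑-cong (mats k k) λ H → trans (⟦⟧-cong (Inv? (block G S 𝟘 H)) (Inv? G ×-dec Inv? H) Inv-upper⁻ (λ (i , j) → Inv-upper S i j))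
             (⟦⟧-× (Inv? G) (Inv? H)))
           (∑-*ˡ (mats k k) ⟦ Inv? G ⟧ _)) (trans (∑-const (mats m k) _) (ℕ.*-comm (card (mats m k)) _))) ⟩
    ∑ (mats m m) (λ G → ⟦ Inv? G ⟧ * gl k * card (mats m k))
      ≡⟨ trans (∑-*ʳ (mats m m) _ _) (cong (_* card (mats m k)) (∑-*ʳ (mats m m) _ _)) ⟩
    gl m * gl k * card (mats m k)
      ≡⟨ trans (cong (gl m * gl k *_) (card-mats m k)) (trans (ℕ.*-comm (gl m * gl k) _) (sym (ℕ.*-assoc (q ^ (k * m)) (gl m) (gl k)))) ⟩
    q ^ (k * m) * gl m * gl k ∎
    where
    vanish : ∀ (G : Mat m m) (S : Mat m k) (T : Mat k m) (H : Mat k k) →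
      ⟦ bottom m (block G S T H ⊗ corner m k) ≟ 𝟘 ⟧ ≡ ⟦ T ≟ 𝟘 ⟧
    vanish G S T H = ⟦⟧-cong (bottom m (block G S T H ⊗ corner m k) ≟ 𝟘) (T ≟ 𝟘)
      (λ e → proj₁ (hcat-injective {B = 𝟘} {B₁ = 𝟘} (trans (sym bot) (trans e (𝟘-hcat {b = m})))))
      (λ { refl → trans bot (sym (𝟘-hcat {b = m})) })
      where
      bot : bottom m (block G S T H ⊗ corner m k) ≡ hcat T 𝟘
      bot = trans (bottom-⊗ m (block G S T H) (corner m k)) (trans (cong (_⊗ corner m k) (bottom-vcat (hcat G S) (hcat T H)))
        (trans (hcat-⊗-block T H 𝟙 𝟘 𝟘 𝟘) (cong₂ hcat (trans (⊕-⊗-𝟘 _ H) (⊗-identityʳ T)) (trans (⊕-⊗-𝟘 _ H) (⊗-zeroʳ T)))))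

  -- The condition says that P carries the image of A into the span of the first m basis vectors.
  -- With A = R D S and D = `corner m k`, the substitution X = P R turns it into the same condition
  -- for D, so the admissible P form a coset of the group counted in `parabolic`.
  stabilisers : (A : Mat (m ℕ.+ k) (m ℕ.+ k)) → ν A ≡ q ^ k →
    ∑ (mats (m ℕ.+ k) (m ℕ.+ k)) (λ P → ⟦ Inv? P ⟧ * ⟦ bottom m (P ⊗ A) ≟ 𝟘 ⟧) ≡ q ^ (k * m) * gl m * gl k
  stabilisers {m} {k} A p with R , S , i , j , refl ← corank {m} {k} A p = trans
    (∑-cong (mats _ _) λ P → cong₂ _*_
      (⟦⟧-cong (Inv? P) (Inv? (P ⊗ R)) (λ i′ → Inv-⊗ i′ i) (Inv-⊗-inj₁ i))
      (⟦⟧-cong (bottom m (P ⊗ (R ⊗ (D ⊗ S))) ≟ 𝟘) (bottom m (P ⊗ R ⊗ D) ≟ 𝟘)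
        (λ e → trans (sym (cancelʳ _ (inv-ʳ j))) (trans (cong (_⊗ inv j) (trans (sym (shift P)) e)) (⊗-zeroˡ (inv j))))
        (λ e → trans (shift P) (trans (cong (_⊗ S) e) (⊗-zeroˡ S)))))
    (trans (∑-permute (mats _ _) (_⊗ R) (_⊗ inv i) (λ V → cancelʳ V (inv-ˡ i)) (λ V → cancelʳ V (inv-ʳ i))
      (λ X → ⟦ Inv? X ⟧ * ⟦ bottom m (X ⊗ D) ≟ 𝟘 ⟧)) (parabolic m k))
    where
    D = corner m k
    shift : ∀ P → bottom m (P ⊗ (R ⊗ (D ⊗ S))) ≡ bottom m (P ⊗ R ⊗ D) ⊗ S
    shift P = trans (cong (bottom m) (trans (sym (⊗-assoc P R (D ⊗ S))) (sym (⊗-assoc (P ⊗ R) D S)))) (bottom-⊗ m _ S)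

  ∑-conj : {P : Mat n n} (i : Inv P) (f : Mat n n → ℕ) → ∑ (mats n n) (λ B → f (P ⊗ (B ⊗ inv i))) ≡ ∑ (mats n n) f
  ∑-conj {n} {P} i = ∑-permute (mats n n) (λ A → P ⊗ (A ⊗ inv i)) (λ A → inv i ⊗ (A ⊗ P))
    (λ A → trans (cong (P ⊗_) (trans (⊗-assoc (inv i) _ _) (cong (inv i ⊗_) (cancelʳ A (inv-ʳ i))))) (cancelˡ A (inv-ʳ i)))
    (λ A → trans (cong (inv i ⊗_) (trans (⊗-assoc P _ _) (cong (P ⊗_) (cancelʳ A (inv-ˡ i))))) (cancelˡ A (inv-ˡ i)))

  ConjugationInvariant : (Mat n n → ℕ) → Set
  ConjugationInvariant {n} f = ∀ {P} (i : Inv P) A → f (P ⊗ (A ⊗ inv i)) ≡ f A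

  -- Double counting of the pairs (P , A) with P invertible, ν A = q ^ k and the
  -- last k rows of P A P⁻¹ equal to zero.
  conjugation-count : ∀ m k (f : Mat (m ℕ.+ k) (m ℕ.+ k) → ℕ) → ConjugationInvariant f →
    ∑ (mats (m ℕ.+ k) (m ℕ.+ k)) (λ A → ⟦ ν A ℕ.≟ q ^ k ⟧ * f A) * (q ^ (k * m) * gl m * gl k) ≡
    gl (m ℕ.+ k) * ∑ (mats m m) (λ A → ∑ (mats m k) λ Y → ⟦ ν (hcat A Y) ℕ.≟ 1 ⟧ * f (block A Y 𝟘 𝟘))
  conjugation-count m k f f-inv = begin
    ∑ Ms (λ A → ⟦ ν A ℕ.≟ q ^ k ⟧ * f A) * (q ^ (k * m) * gl m * gl k)
      ≡⟨ ∑-*ʳ Ms _ _ ⟨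
    ∑ Ms (λ A → ⟦ ν A ℕ.≟ q ^ k ⟧ * f A * (q ^ (k * m) * gl m * gl k))
      ≡⟨ ∑-cong Ms (λ A → trans (trans (ℕ.*-assoc ⟦ ν A ℕ.≟ q ^ k ⟧ (f A) _)
           (trans (⟦⟧-*-cong (ν A ℕ.≟ q ^ k) (λ p → cong (f A *_) (sym (stabilisers {m} {k} A p)))) (sym (ℕ.*-assoc ⟦ ν A ℕ.≟ q ^ k ⟧ (f A) _))))
           (sym (∑-*ˡ Ms (⟦ ν A ℕ.≟ q ^ k ⟧ * f A) _))) ⟩
    ∑ Ms (λ A → ∑ Ms λ P → ⟦ ν A ℕ.≟ q ^ k ⟧ * f A * (⟦ Inv? P ⟧ * ⟦ bottom m (P ⊗ A) ≟ 𝟘 ⟧))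
      ≡⟨ ∑-swap Ms Ms _ ⟩
    ∑ Ms (λ P → ∑ Ms λ A → ⟦ ν A ℕ.≟ q ^ k ⟧ * f A * (⟦ Inv? P ⟧ * ⟦ bottom m (P ⊗ A) ≟ 𝟘 ⟧))
      -- For a fixed invertible P the substitution of P A P⁻¹ for A removes P from the inner sum:
      -- the corank and `f` are invariant, and multiplying by P⁻¹ on the right does not affect
      -- whether the last rows vanish.
      ≡⟨ ∑-cong Ms (λ P → trans (trans (∑-cong Ms λ A → rotate (⟦ ν A ℕ.≟ q ^ k ⟧ * f A) ⟦ Inv? P ⟧ _) (∑-*ˡ Ms ⟦ Inv? P ⟧ _))
           (⟦⟧-*-cong (Inv? P) (conjugate P))) ⟩
    ∑ Ms (λ P → ⟦ Inv? P ⟧ * R)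
      ≡⟨ ∑-*ʳ Ms R _ ⟩
    gl (m ℕ.+ k) * R
      ≡⟨ cong (gl (m ℕ.+ k) *_) R≡ ⟩
    gl (m ℕ.+ k) * ∑ (mats m m) (λ A → ∑ (mats m k) λ Y → ⟦ ν (hcat A Y) ℕ.≟ 1 ⟧ * f (block A Y 𝟘 𝟘)) ∎
    where
    Ms = mats (m ℕ.+ k) (m ℕ.+ k)
    term : Mat (m ℕ.+ k) (m ℕ.+ k) → ℕ
    term A = ⟦ ν A ℕ.≟ q ^ k ⟧ * f A * ⟦ bottom m A ≟ 𝟘 ⟧
    R = ∑ Ms term
    rotate : ∀ x y z → x * (y * z) ≡ y * (x * z)
    rotate = solve 3 (λ x y z → x :* (y :* z) := y :* (x :* z)) refl where open +-*-Solver
    conjugate : ∀ P → Inv P → ∑ Ms (λ A → ⟦ ν A ℕ.≟ q ^ k ⟧ * f A * ⟦ bottom m (P ⊗ A) ≟ 𝟘 ⟧) ≡ R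
    conjugate P i = trans
      (∑-cong Ms λ A → cong₂ _*_
        (cong₂ _*_ (cong (λ x → ⟦ x ℕ.≟ q ^ k ⟧) (sym (trans (ν-⊗ˡ _ i) (ν-⊗ʳ A (inv-ˡ i))))) (sym (f-inv i A)))
        (⟦⟧-cong (bottom m (P ⊗ A) ≟ 𝟘) (bottom m (P ⊗ (A ⊗ inv i)) ≟ 𝟘)
          (λ e → trans (shift A) (trans (cong (_⊗ inv i) e) (⊗-zeroˡ _)))
          (λ e → trans (sym (cancelʳ _ (inv-ˡ i))) (trans (cong (_⊗ P) (trans (sym (shift A)) e)) (⊗-zeroˡ P)))))
      (∑-conj i term)
      where
      shift : ∀ A → bottom m (P ⊗ (A ⊗ inv i)) ≡ bottom m (P ⊗ A) ⊗ inv i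
      shift A = trans (cong (bottom m) (sym (⊗-assoc P A _))) (bottom-⊗ m _ _)
    R≡ : R ≡ ∑ (mats m m) (λ A → ∑ (mats m k) λ Y → ⟦ ν (hcat A Y) ℕ.≟ 1 ⟧ * f (block A Y 𝟘 𝟘))
    R≡ = begin
      ∑ Ms term
        ≡⟨ ∑-vcat finite {m} {k} (m ℕ.+ k) term ⟩
      ∑ (mats m (m ℕ.+ k)) (λ M → ∑ (mats k (m ℕ.+ k)) λ N → term (vcat M N))
        ≡⟨ ∑-cong (mats m (m ℕ.+ k)) (λ M → trans (∑-cong (mats k (m ℕ.+ k)) λ N →
             trans (ℕ.*-comm (⟦ ν (vcat M N) ℕ.≟ q ^ k ⟧ * f (vcat M N)) _) (cong (λ X → ⟦ X ≟ 𝟘 ⟧ * (⟦ ν (vcat M N) ℕ.≟ q ^ k ⟧ * f (vcat M N))) (bottom-vcat M N)))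
             (∑-point (mats k (m ℕ.+ k)) 𝟘 (λ N → ⟦ ν (vcat M N) ℕ.≟ q ^ k ⟧ * f (vcat M N)))) ⟩
      ∑ (mats m (m ℕ.+ k)) (λ M → ⟦ ν (vcat M (𝟘 {k})) ℕ.≟ q ^ k ⟧ * f (vcat M 𝟘))
        -- The k zero rows alone contribute the factor q^k to `ν`, so corank k means precisely that
        -- the remaining rows are independent.
        ≡⟨ ∑-cong (mats m (m ℕ.+ k)) (λ M → cong (_* f (vcat M 𝟘)) (⟦⟧-cong (ν (vcat M (𝟘 {k})) ℕ.≟ q ^ k) (ν M ℕ.≟ 1)
             (λ e → ℕ.*-cancelʳ-≡ (ν M) 1 (q ^ k) {{ℕ.m^n≢0 q k {{ℕ.>-nonZero (ℕ.<-trans (s≤s z≤n) 1<q)}}}}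
                      (trans (sym (ν-vcat-𝟘 M)) (trans e (sym (ℕ.*-identityˡ _)))))
             (λ e → trans (ν-vcat-𝟘 M) (trans (cong (_* q ^ k) e) (ℕ.*-identityˡ _))))) ⟩
      ∑ (mats m (m ℕ.+ k)) (λ M → ⟦ ν M ℕ.≟ 1 ⟧ * f (vcat M 𝟘))
        ≡⟨ ∑-hcat finite m _ ⟩
      ∑ (mats m m) (λ A → ∑ (mats m k) λ Y → ⟦ ν (hcat A Y) ℕ.≟ 1 ⟧ * f (vcat (hcat A Y) 𝟘))
        ≡⟨ ∑-cong (mats m m) (λ A → ∑-cong (mats m k) λ Y → cong (λ Z → ⟦ ν (hcat A Y) ℕ.≟ 1 ⟧ * f (vcat (hcat A Y) Z)) (𝟘-hcat {b = m})) ⟩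
      ∑ (mats m m) (λ A → ∑ (mats m k) λ Y → ⟦ ν (hcat A Y) ℕ.≟ 1 ⟧ * f (block A Y 𝟘 𝟘)) ∎

  -- The identity block forces the first r coordinates of a kernel vector to vanish. V then has
  -- nothing left to act on, and only the condition imposed by U survives.
  ν-block : (V : Mat r k) (U : Mat j k) → ν (hcat (corner r j) (vcat V U)) ≡ ν U
  ν-block {r} {k} {j} V U = begin
    ν M
      ≡⟨ ν-def M ⟩
    ∑ (mats 1 (r ℕ.+ j)) (λ z → ⟦ z ⊗ M ≟ 𝟘 ⟧)
      ≡⟨ ∑-hcat finite 1 {r} {j} (λ z → ⟦ z ⊗ M ≟ 𝟘 ⟧) ⟩
    ∑ (mats 1 r) (λ x → ∑ (mats 1 j) λ y → ⟦ hcat x y ⊗ M ≟ 𝟘 ⟧)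
      ≡⟨ ∑-cong (mats 1 r) (λ x → trans (∑-cong (mats 1 j) λ y → trans
           (⟦⟧-cong (hcat x y ⊗ M ≟ 𝟘) (x ≟ 𝟘 ×-dec (x ⊗ V ⊕ y ⊗ U) ≟ 𝟘)
             (λ e → let e₁ , e₂ = hcat-injective (trans (sym (eval x y)) (trans e (𝟘-hcat {b = r ℕ.+ j}))) in
                    proj₁ (hcat-injective {B = 𝟘} {B₁ = 𝟘} (trans e₁ (𝟘-hcat {b = r}))) , e₂)
             (λ { (refl , e) → trans (eval 𝟘 y) (trans (cong₂ hcat (sym (𝟘-hcat {b = r})) e) (sym (𝟘-hcat {b = r ℕ.+ j}))) }))
           (⟦⟧-× (x ≟ 𝟘) ((x ⊗ V ⊕ y ⊗ U) ≟ 𝟘)))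
           (∑-*ˡ (mats 1 j) ⟦ x ≟ 𝟘 ⟧ _)) ⟩
    ∑ (mats 1 r) (λ x → ⟦ x ≟ 𝟘 ⟧ * ∑ (mats 1 j) λ y → ⟦ (x ⊗ V ⊕ y ⊗ U) ≟ 𝟘 ⟧)
      ≡⟨ ∑-point (mats 1 r) 𝟘 _ ⟩
    ∑ (mats 1 j) (λ y → ⟦ (𝟘 ⊗ V ⊕ y ⊗ U) ≟ 𝟘 ⟧)
      ≡⟨ ∑-cong (mats 1 j) (λ y → cong (λ X → ⟦ X ≟ 𝟘 ⟧) (𝟘-⊗-⊕ _ V)) ⟩
    ∑ (mats 1 j) (λ y → ⟦ y ⊗ U ≟ 𝟘 ⟧)
      ≡⟨ ν-def U ⟨
    ν U ∎
    where
    M = hcat (corner r j) (vcat V U)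
    eval : ∀ (x : Mat 1 r) (y : Mat 1 j) → hcat x y ⊗ M ≡ hcat (hcat x 𝟘) (x ⊗ V ⊕ y ⊗ U)
    eval x y = trans (⊗-hcat _ _ _) (cong₂ hcat (trans (hcat-⊗-block x y 𝟙 𝟘 𝟘 𝟘)
      (cong₂ hcat (trans (⊕-⊗-𝟘 _ y) (⊗-identityʳ x)) (trans (⊕-⊗-𝟘 _ y) (⊗-zeroʳ x)))) (hcat-⊗-vcat x y V U))

  ν-hcat-normal : {P Q : Mat (r ℕ.+ j) (r ℕ.+ j)} (i : Inv P) → Inv Q → (V : Mat r k) (U : Mat j k) →
    ν (hcat (P ⊗ (corner r j ⊗ Q)) (P ⊗ vcat V U)) ≡ ν U
  ν-hcat-normal {r} {j} {k} {P} {Q} i i′ V U = begin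
    ν (hcat (P ⊗ (D ⊗ Q)) (P ⊗ Y)) ≡⟨ cong ν (⊗-hcat P (D ⊗ Q) Y) ⟨
    ν (P ⊗ hcat (D ⊗ Q) Y) ≡⟨ ν-⊗ˡ _ i ⟩
    ν (hcat (D ⊗ Q) Y) ≡⟨ cong ν (cong₂ hcat (⊕-⊗-𝟘 _ Y) (trans (⊗-𝟘-⊕ _ D) (⊗-identityʳ Y))) ⟨
    ν (hcat (D ⊗ Q ⊕ Y ⊗ 𝟘) (D ⊗ 𝟘 ⊕ Y ⊗ 𝟙)) ≡⟨ cong ν (hcat-⊗-block D Y Q 𝟘 𝟘 𝟙) ⟨
    ν (hcat D Y ⊗ block Q 𝟘 𝟘 𝟙) ≡⟨ ν-⊗ʳ _ (inv-ʳ (Inv-upper 𝟘 i′ Inv-𝟙)) ⟩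
    ν (hcat D Y) ≡⟨ ν-block V U ⟩
    ν U ∎
    where
    D = corner r j
    Y = vcat V U

  -- [A Y] is surjective exactly when Y composed with the projection to the cokernel K^j of A is. In
  -- coordinates adapted to A this composite is U, while V, the component along the image, is free.
  surjective-extensions : ∀ r j k (A : Mat (r ℕ.+ j) (r ℕ.+ j)) → ν A ≡ q ^ j →
    ∑ (mats (r ℕ.+ j) k) (λ Y → ⟦ ν (hcat A Y) ℕ.≟ 1 ⟧) ≡ q ^ (k * r) * surj j k
  surjective-extensions r j k A p with P , Q , i , i′ , refl ← corank {r} {j} A p = begin
    ∑ (mats (r ℕ.+ j) k) (λ Y → ⟦ ν (hcat A′ Y) ℕ.≟ 1 ⟧)
      ≡⟨ ∑-permute (mats (r ℕ.+ j) k) (P ⊗_) (inv i ⊗_) (λ Y → cancelˡ Y (inv-ʳ i)) (λ Y → cancelˡ Y (inv-ˡ i)) _ ⟨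
    ∑ (mats (r ℕ.+ j) k) (λ Y → ⟦ ν (hcat A′ (P ⊗ Y)) ℕ.≟ 1 ⟧)
      ≡⟨ ∑-vcat finite {r} {j} k _ ⟩
    ∑ (mats r k) (λ V → ∑ (mats j k) λ U → ⟦ ν (hcat A′ (P ⊗ vcat V U)) ℕ.≟ 1 ⟧)
      ≡⟨ ∑-cong (mats r k) (λ V → ∑-cong (mats j k) λ U → cong (λ x → ⟦ x ℕ.≟ 1 ⟧) (ν-hcat-normal i i′ V U)) ⟩
    ∑ (mats r k) (λ V → surj j k)
      ≡⟨ ∑-const (mats r k) _ ⟩
    card (mats r k) * surj j k
      ≡⟨ cong (_* surj j k) (card-mats r k) ⟩
    q ^ (k * r) * surj j k ∎
    where
    A′ = P ⊗ (corner r j ⊗ Q)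

-- Powers and nilpotency of block matrices

module Powers (𝔽 : FiniteSkewField) where

  open Rank 𝔽 public
  open FiniteSkewField 𝔽 using (finite)
  open import Data.Nat.Base using (_*_; _^_)
  open ≡-Reasoning

  private variable
    a b d n : ℕ

  pow : Mat n n → ℕ → Mat n n
  pow A zero = 𝟙
  pow A (suc k) = A ⊗ pow A k

  Nil : Mat n n → Set
  Nil A = ∃ λ k → pow A k ≡ 𝟘

  pow-+ : (A : Mat n n) → ∀ i j → pow A (i ℕ.+ j) ≡ pow A i ⊗ pow A j
  pow-+ A zero j = sym (⊗-identityˡ _)
  pow-+ A (suc i) j = trans (cong (A ⊗_) (pow-+ A i j)) (sym (⊗-assoc A _ _))

  module _ {P P′ : Mat n n} (P′P : P′ ⊗ P ≡ 𝟙) where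

    conj-⊗ : ∀ A B → (P ⊗ (A ⊗ P′)) ⊗ (P ⊗ (B ⊗ P′)) ≡ P ⊗ ((A ⊗ B) ⊗ P′)
    conj-⊗ A B = trans (⊗-assoc P _ _) (cong (P ⊗_) (trans (⊗-assoc A P′ _)
      (trans (cong (A ⊗_) (cancelˡ (B ⊗ P′) P′P)) (sym (⊗-assoc A B P′)))))

    conj-injective : ∀ {A B} → P ⊗ (A ⊗ P′) ≡ P ⊗ (B ⊗ P′) → A ≡ B
    conj-injective {A} {B} e = trans (sym (back A)) (trans (cong (λ X → P′ ⊗ X ⊗ P) e) (back B))
      where
      back : ∀ A → P′ ⊗ (P ⊗ (A ⊗ P′)) ⊗ P ≡ A
      back A = trans (cong (_⊗ P) (cancelˡ (A ⊗ P′) P′P)) (cancelʳ A P′P)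

    module _ (PP′ : P ⊗ P′ ≡ 𝟙) where

      conj-pow : ∀ A k → pow (P ⊗ (A ⊗ P′)) k ≡ P ⊗ (pow A k ⊗ P′)
      conj-pow A zero = sym (trans (cong (P ⊗_) (⊗-identityˡ P′)) PP′)
      conj-pow A (suc k) = trans (cong (_ ⊗_) (conj-pow A k)) (conj-⊗ A (pow A k))

      conj-𝟘 : P ⊗ (𝟘 ⊗ P′) ≡ 𝟘
      conj-𝟘 = trans (cong (P ⊗_) (⊗-zeroˡ P′)) (⊗-zeroʳ P)

      Nil-conj : ∀ A → Nil A → Nil (P ⊗ (A ⊗ P′))
      Nil-conj A (k , e) = k , trans (conj-pow A k) (trans (cong (λ X → P ⊗ (X ⊗ P′)) e) conj-𝟘)

      Nil-conj⁻ : ∀ A → Nil (P ⊗ (A ⊗ P′)) → Nil A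
      Nil-conj⁻ A (k , e) = k , conj-injective (trans (sym (conj-pow A k)) (trans e (sym conj-𝟘)))

  -- The off-diagonal block stays unspecified: in `Nil-upper` it only ever meets a zero factor, and
  -- in `Nil-upper⁻` only the diagonal blocks are read off.
  pow-upper : (A : Mat a a) (B : Mat a b) (D : Mat b b) → ∀ k → ∃ λ B′ → pow (block A B 𝟘 D) k ≡ block (pow A k) B′ 𝟘 (pow D k)
  pow-upper A B D zero = 𝟘 , 𝟙-block
  pow-upper A B D (suc k) = let B′ , e = pow-upper A B D k in
    _ , trans (cong (block A B 𝟘 D ⊗_) e) (upper-⊗ A B D _ B′ _)

  pow-lower : (A : Mat a a) (C : Mat b a) (D : Mat b b) → ∀ k → ∃ λ C′ → pow (block A 𝟘 C D) k ≡ block (pow A k) 𝟘 C′ (pow D k)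
  pow-lower A C D zero = 𝟘 , 𝟙-block
  pow-lower A C D (suc k) = let C′ , e = pow-lower A C D k in
    _ , trans (cong (block A 𝟘 C D ⊗_) e) (lower-⊗ A C D _ C′ _)

  Nil-upper⁻ : {A : Mat a a} {B : Mat a b} {D : Mat b b} → Nil (block A B 𝟘 D) → Nil A × Nil D
  Nil-upper⁻ {a} {A = A} {B} {D} (k , e) with B′ , e′ ← pow-upper A B D k =
    let (A≡ , _) , (_ , D≡) = block-injective {B = B′} {B₁ = 𝟘} {C = 𝟘} {C₁ = 𝟘} (trans (sym e′) (trans e (𝟘-block {a} {_} {a}))) in
    (k , A≡) , (k , D≡)

  Nil-lower⁻ : {A : Mat a a} {C : Mat b a} {D : Mat b b} → Nil (block A 𝟘 C D) → Nil A × Nil D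
  Nil-lower⁻ {a} {A = A} {C} {D} (k , e) with C′ , e′ ← pow-lower A C D k =
    let (A≡ , _) , (_ , D≡) = block-injective {B = 𝟘} {B₁ = 𝟘} {C = C′} {C₁ = 𝟘} (trans (sym e′) (trans e (𝟘-block {a} {_} {a}))) in
    (k , A≡) , (k , D≡)

  -- In the i-th power the upper left block vanishes and in the j-th power the lower right one.
  -- Multiplied in this order, every block of the product has a zero factor.
  Nil-upper : {A : Mat a a} (B : Mat a b) {D : Mat b b} → Nil A → Nil D → Nil (block A B 𝟘 D)
  Nil-upper {a} {A = A} B {D} (i , Aⁱ) (j , Dʲ) = i ℕ.+ j , (begin
    pow M (i ℕ.+ j) ≡⟨ pow-+ M i j ⟩
    pow M i ⊗ pow M j ≡⟨ cong₂ _⊗_ (proj₂ (pow-upper A B D i)) (proj₂ (pow-upper A B D j)) ⟩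
    block (pow A i) X 𝟘 (pow D i) ⊗ block (pow A j) Y 𝟘 (pow D j)
      ≡⟨ cong₂ (λ α δ → block α X 𝟘 (pow D i) ⊗ block (pow A j) Y 𝟘 δ) Aⁱ Dʲ ⟩
    block 𝟘 X 𝟘 (pow D i) ⊗ block (pow A j) Y 𝟘 𝟘 ≡⟨ upper-⊗ 𝟘 X _ _ Y 𝟘 ⟩
    _ ≡⟨ block-cong (⊗-zeroˡ _) (trans (𝟘-⊗-⊕ _ Y) (⊗-zeroʳ X)) refl (⊗-zeroʳ _) ⟩
    block 𝟘 𝟘 𝟘 𝟘 ≡⟨ 𝟘-block ⟨
    𝟘 ∎)
    where
    M = block A B 𝟘 D
    X = proj₁ (pow-upper A B D i)
    Y = proj₁ (pow-upper A B D j)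

  -- For lower triangular blocks the two powers must be multiplied in the opposite order, so that
  -- the unknown blocks X and Y meet the zeros.
  Nil-lower : {A : Mat a a} (C : Mat b a) {D : Mat b b} → Nil A → Nil D → Nil (block A 𝟘 C D)
  Nil-lower {a} {A = A} C {D} (i , Aⁱ) (j , Dʲ) = j ℕ.+ i , (begin
    pow M (j ℕ.+ i) ≡⟨ pow-+ M j i ⟩
    pow M j ⊗ pow M i ≡⟨ cong₂ _⊗_ (proj₂ (pow-lower A C D j)) (proj₂ (pow-lower A C D i)) ⟩
    block (pow A j) 𝟘 X (pow D j) ⊗ block (pow A i) 𝟘 Y (pow D i)
      ≡⟨ cong₂ (λ α δ → block (pow A j) 𝟘 X δ ⊗ block α 𝟘 Y (pow D i)) Aⁱ Dʲ ⟩
    block (pow A j) 𝟘 X 𝟘 ⊗ block 𝟘 𝟘 Y (pow D i) ≡⟨ lower-⊗ _ X 𝟘 𝟘 Y _ ⟩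
    _ ≡⟨ block-cong (⊗-zeroʳ _) refl (trans (⊗-𝟘-⊕ _ X) (⊗-zeroˡ Y)) (⊗-zeroˡ _) ⟩
    block 𝟘 𝟘 𝟘 𝟘 ≡⟨ 𝟘-block ⟨
    𝟘 ∎)
    where
    M = block A 𝟘 C D
    X = proj₁ (pow-lower A C D j)
    Y = proj₁ (pow-lower A C D i)

  Nil-𝟘 : Nil (𝟘 {n} {n})
  Nil-𝟘 = 1 , ⊗-zeroˡ 𝟙

  -- Full rank would make A invertible, so that `ν` would be 1 on all its powers, whereas the zero
  -- matrix of positive size is annihilated by every row vector.
  Nil⇒¬full-rank : (A : Mat (suc n) (suc n)) → Nil A → ν A ≢ 1
  Nil⇒¬full-rank {n} A (k , e) p =
    ℕ.1+n≢0 (q^-injective {suc n} {0} (trans (sym ν-𝟘) (trans (cong ν (sym e)) (νpow k))))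
    where
    A-inv = Inv-square A p
    νpow : ∀ k → ν (pow A k) ≡ 1
    νpow zero = Inv⇒ν Inv-𝟙
    νpow (suc k) = trans (ν-⊗ˡ (pow A k) A-inv) (νpow k)
    ν-𝟘 : ν (𝟘 {suc n} {suc n}) ≡ q ^ suc n
    ν-𝟘 = trans (cong ν (sym E-zero)) (ν-E z≤n z≤n)

-- Nilpotent matrices commuting with a given one

module NilpotentCounts (𝔽 : FiniteSkewField) (Nil? : ∀ {n} (A : Powers.Mat 𝔽 n n) → Dec (Powers.Nil 𝔽 A)) where

  open Powers 𝔽 public
  open FiniteSkewField 𝔽 using (finite)
  open import Data.Nat.Base using (_*_; _^_)
  open ≡-Reasoning

  private variable
    a b d j l m n r : ℕ

  nil : ℕ → ℕ
  nil n = ∑ (mats n n) λ A → ⟦ Nil? A ⟧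

  centraliser : Mat n n → ℕ
  centraliser {n} A = ∑ (mats n n) λ B → ⟦ Nil? B ⟧ * ⟦ A ⊗ B ≟ B ⊗ A ⟧

  Nil?-conj : {P : Mat n n} (i : Inv P) → ∀ A → ⟦ Nil? (P ⊗ (A ⊗ inv i)) ⟧ ≡ ⟦ Nil? A ⟧
  Nil?-conj i A = ⟦⟧-cong (Nil? (_ ⊗ (A ⊗ inv i))) (Nil? A) (Nil-conj⁻ (inv-ˡ i) (inv-ʳ i) A) (Nil-conj (inv-ˡ i) (inv-ʳ i) A)

  centraliser-conj : ConjugationInvariant {n} centraliser
  centraliser-conj {n} {P} i A = trans (sym (∑-conj i _)) (∑-cong (mats n n) λ B → cong₂ _*_ (Nil?-conj i B)
    (⟦⟧-cong (P ⊗ (A ⊗ inv i) ⊗ (P ⊗ (B ⊗ inv i)) ≟ P ⊗ (B ⊗ inv i) ⊗ (P ⊗ (A ⊗ inv i))) (A ⊗ B ≟ B ⊗ A)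
      (λ e → conj-injective (inv-ˡ i) (trans (sym (conj-⊗ (inv-ˡ i) A B)) (trans e (conj-⊗ (inv-ˡ i) B A))))
      (λ e → trans (conj-⊗ (inv-ˡ i) A B) (trans (cong (λ X → P ⊗ (X ⊗ inv i)) e) (sym (conj-⊗ (inv-ˡ i) B A))))))

  -- Nilpotent endomorphisms of K^(j+l) lifting a given one along a surjection onto K^j.
  lifts : (β : Mat j j) (U : Mat j (j ℕ.+ l)) → Nil β → ν U ≡ 1 →
    ∑ (mats (j ℕ.+ l) (j ℕ.+ l)) (λ D → ⟦ Nil? D ⟧ * ⟦ β ⊗ U ≟ U ⊗ D ⟧) ≡ q ^ (j * l) * nil l
  lifts {j} {l} β U β-nil p with Q , i , refl ← surjective-normal U p = begin
    ∑ Ms (λ D → ⟦ Nil? D ⟧ * ⟦ β ⊗ (π ⊗ Q) ≟ π ⊗ Q ⊗ D ⟧)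
      ≡⟨ ∑-cong Ms (λ D → cong₂ _*_ (sym (Nil?-conj i D)) (⟦⟧-cong (β ⊗ (π ⊗ Q) ≟ π ⊗ Q ⊗ D) (β ⊗ π ≟ π ⊗ (Q ⊗ (D ⊗ inv i)))
           (λ e → trans (sym (cancelʳ _ (inv-ʳ i))) (trans (cong (_⊗ inv i) (trans (⊗-assoc β π Q) e)) (regroup D)))
           (λ e → trans (sym (⊗-assoc β π Q)) (trans (cong (_⊗ Q) (trans e (sym (regroup D)))) (cancelʳ _ (inv-ˡ i)))))) ⟩
    ∑ Ms (λ D → ⟦ Nil? (Q ⊗ (D ⊗ inv i)) ⟧ * ⟦ β ⊗ π ≟ π ⊗ (Q ⊗ (D ⊗ inv i)) ⟧)
      ≡⟨ ∑-conj i (λ D → ⟦ Nil? D ⟧ * ⟦ β ⊗ π ≟ π ⊗ D ⟧) ⟩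
    ∑ Ms (λ D → ⟦ Nil? D ⟧ * ⟦ β ⊗ π ≟ π ⊗ D ⟧)
      ≡⟨ ∑-block j l j l _ ⟩
    ∑ (mats j j) (λ W → ∑ (mats j l) λ X → ∑ (mats l j) λ Y → ∑ (mats l l) λ Z →
      ⟦ Nil? (block W X Y Z) ⟧ * ⟦ β ⊗ π ≟ π ⊗ block W X Y Z ⟧)
      -- Once U is the projection π = [1 0], the equation β π = π D prescribes the first rows [W X]
      -- of D to be [β 0]. D is then lower triangular, with Y free and Z nilpotent.
      ≡⟨ ∑-cong (mats j j) (λ W → ∑-cong (mats j l) λ X → trans (∑-cong (mats l j) λ Y → trans (∑-cong (mats l l) λ Z →
           trans (cong (⟦ Nil? (block W X Y Z) ⟧ *_) (match W X Y Z)) (ℕ.*-comm ⟦ Nil? (block W X Y Z) ⟧ (⟦ W ≟ β ⟧ * ⟦ X ≟ 𝟘 ⟧)))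
           (∑-*ˡ (mats l l) (⟦ W ≟ β ⟧ * ⟦ X ≟ 𝟘 ⟧) _)) (trans (∑-*ˡ (mats l j) (⟦ W ≟ β ⟧ * ⟦ X ≟ 𝟘 ⟧) _) (ℕ.*-assoc ⟦ W ≟ β ⟧ ⟦ X ≟ 𝟘 ⟧ (G W X)))) ⟩
    ∑ (mats j j) (λ W → ∑ (mats j l) λ X → ⟦ W ≟ β ⟧ * (⟦ X ≟ 𝟘 ⟧ * G W X))
      ≡⟨ ∑-cong (mats j j) (λ W → trans (∑-*ˡ (mats j l) ⟦ W ≟ β ⟧ _) (cong (⟦ W ≟ β ⟧ *_) (∑-point (mats j l) 𝟘 (G W)))) ⟩
    ∑ (mats j j) (λ W → ⟦ W ≟ β ⟧ * G W 𝟘)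
      ≡⟨ ∑-point (mats j j) β (λ W → G W 𝟘) ⟩
    G β 𝟘
      ≡⟨ ∑-cong (mats l j) (λ Y → ∑-cong (mats l l) λ Z → ⟦⟧-cong (Nil? (block β 𝟘 Y Z)) (Nil? Z)
           (λ p → proj₂ (Nil-lower⁻ p)) (Nil-lower Y β-nil)) ⟩
    ∑ (mats l j) (λ Y → nil l)
      ≡⟨ trans (∑-const (mats l j) _) (cong (_* nil l) (card-mats l j)) ⟩
    q ^ (j * l) * nil l ∎
    where
    Ms = mats (j ℕ.+ l) (j ℕ.+ l)
    π : Mat j (j ℕ.+ l)
    π = hcat 𝟙 𝟘
    G : Mat j j → Mat j l → ℕ
    G W X = ∑ (mats l j) λ Y → ∑ (mats l l) λ Z → ⟦ Nil? (block W X Y Z) ⟧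
    regroup : ∀ D → π ⊗ Q ⊗ D ⊗ inv i ≡ π ⊗ (Q ⊗ (D ⊗ inv i))
    regroup D = trans (⊗-assoc (π ⊗ Q) D (inv i)) (⊗-assoc π Q _)
    match : ∀ W X (Y : Mat l j) Z → ⟦ β ⊗ π ≟ π ⊗ block W X Y Z ⟧ ≡ ⟦ W ≟ β ⟧ * ⟦ X ≟ 𝟘 ⟧
    match W X Y Z = trans (⟦⟧-cong (β ⊗ π ≟ π ⊗ block W X Y Z) (W ≟ β ×-dec X ≟ 𝟘)
      (λ e → let e₁ , e₂ = hcat-injective (trans (sym rhs) (trans (sym e) lhs)) in e₁ , e₂)
      (λ (e₁ , e₂) → trans lhs (trans (cong₂ hcat (sym e₁) (sym e₂)) (sym rhs))))
      (⟦⟧-× (W ≟ β) (X ≟ 𝟘))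
      where
      lhs : β ⊗ π ≡ hcat β 𝟘
      lhs = trans (⊗-hcat β 𝟙 𝟘) (cong₂ hcat (⊗-identityʳ β) (⊗-zeroʳ β))
      rhs : π ⊗ block W X Y Z ≡ hcat W X
      rhs = trans (hcat-⊗-block 𝟙 𝟘 W X Y Z) (cong₂ hcat (trans (⊕-𝟘-⊗ _ Y) (⊗-identityˡ W)) (trans (⊕-𝟘-⊗ _ Z) (⊗-identityˡ X)))

  -- Coordinates adapted to A = P · corner · Q: the first r columns of P span the image of A, and
  -- the last j coordinates describe its cokernel. Y splits into V along the image and U onto the
  -- cokernel, and B splits into the four blocks of β.
  module _ {r j l : ℕ} {P Q : Mat (r ℕ.+ j) (r ℕ.+ j)} (i : Inv P) (i′ : Inv Q)
    (V : Mat r (j ℕ.+ l)) (U : Mat j (j ℕ.+ l)) (U-full : ν U ≡ 1)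
    (b₁ : Mat r r) (b₂ : Mat r j) (b₃ : Mat j r) (b₄ : Mat j j) where

    private
      k : ℕ
      k = j ℕ.+ l
      A β B : Mat (r ℕ.+ j) (r ℕ.+ j)
      A = P ⊗ (corner r j ⊗ Q)
      β = block b₁ b₂ b₃ b₄
      B = P ⊗ (β ⊗ inv i)
      Y : Mat (r ℕ.+ j) k
      Y = P ⊗ vcat V U

      P-cancel : ∀ {c} {X X′ : Mat (r ℕ.+ j) c} → P ⊗ X ≡ P ⊗ X′ → X ≡ X′
      P-cancel e = trans (sym (cancelˡ _ (inv-ˡ i))) (trans (cong (inv i ⊗_) e) (cancelˡ _ (inv-ˡ i)))

      bottom-corner : (X : Mat (r ℕ.+ j) (r ℕ.+ j)) → bottom r (corner r j ⊗ X) ≡ 𝟘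
      bottom-corner X = trans (bottom-⊗ r (corner r j) X) (trans (cong (_⊗ X)
        (trans (bottom-vcat (hcat 𝟙 𝟘) (hcat (𝟘 {j} {r}) 𝟘)) (sym (𝟘-hcat {b = r})))) (⊗-zeroˡ X))

      -- Since B commutes with A it preserves the image of A, which in these coordinates is spanned
      -- by the first r basis vectors.
      b₃≡𝟘 : A ⊗ B ≡ B ⊗ A → b₃ ≡ 𝟘
      b₃≡𝟘 e = proj₁ (hcat-injective {B = 𝟘} {B₁ = 𝟘} (begin
        hcat b₃ 𝟘 ≡⟨ cong₂ hcat (trans (⊕-⊗-𝟘 _ b₄) (⊗-identityʳ b₃)) (trans (⊕-⊗-𝟘 _ b₄) (⊗-zeroʳ b₃)) ⟨
        hcat (b₃ ⊗ 𝟙 ⊕ b₄ ⊗ 𝟘) (b₃ ⊗ 𝟘 ⊕ b₄ ⊗ 𝟘) ≡⟨ hcat-⊗-block b₃ b₄ 𝟙 𝟘 𝟘 𝟘 ⟨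
        hcat b₃ b₄ ⊗ corner r j ≡⟨ cong (_⊗ corner r j) (bottom-vcat (hcat b₁ b₂) (hcat b₃ b₄)) ⟨
        bottom r β ⊗ corner r j ≡⟨ bottom-⊗ r β (corner r j) ⟨
        bottom r (β ⊗ corner r j) ≡⟨ cong (bottom r) β-corner ⟩
        bottom r (corner r j ⊗ (Q ⊗ B ⊗ inv i′)) ≡⟨ bottom-corner _ ⟩
        𝟘 ≡⟨ 𝟘-hcat {b = r} ⟩
        hcat 𝟘 𝟘 ∎))
        where
        β-corner : β ⊗ corner r j ≡ corner r j ⊗ (Q ⊗ B ⊗ inv i′)
        β-corner = begin
          β ⊗ corner r j ≡⟨ cancelʳ _ (inv-ʳ i′) ⟨
          β ⊗ corner r j ⊗ Q ⊗ inv i′ ≡⟨ cong (_⊗ inv i′) (P-cancel (begin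
            P ⊗ (β ⊗ corner r j ⊗ Q) ≡⟨ cong (P ⊗_) (⊗-assoc β _ Q) ⟩
            P ⊗ (β ⊗ (corner r j ⊗ Q)) ≡⟨ cong (P ⊗_) (cong (β ⊗_) (cancelˡ _ (inv-ˡ i))) ⟨
            P ⊗ (β ⊗ (inv i ⊗ A)) ≡⟨ cong (P ⊗_) (⊗-assoc β (inv i) A) ⟨
            P ⊗ (β ⊗ inv i ⊗ A) ≡⟨ ⊗-assoc P _ A ⟨
            B ⊗ A ≡⟨ e ⟨
            A ⊗ B ≡⟨ ⊗-assoc P _ B ⟩
            P ⊗ (corner r j ⊗ Q ⊗ B) ∎)) ⟩
          corner r j ⊗ Q ⊗ B ⊗ inv i′ ≡⟨ cong (_⊗ inv i′) (⊗-assoc _ Q B) ⟩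
          corner r j ⊗ (Q ⊗ B) ⊗ inv i′ ≡⟨ ⊗-assoc _ _ (inv i′) ⟩
          corner r j ⊗ (Q ⊗ B ⊗ inv i′) ∎

      -- The corner annihilates C₂, which is therefore unconstrained. The upper half of the equation
      -- can be solved for C₁; the lower half says that D lifts b₄, the map induced by B on the
      -- cokernel of A, along U.
      split-equation : b₃ ≡ 𝟘 → (C₁ : Mat r k) (C₂ : Mat j k) (D : Mat k k) →
        ⟦ B ⊗ Y ≟ A ⊗ (inv i′ ⊗ vcat C₁ C₂) ⊕ Y ⊗ D ⟧ ≡ ⟦ V ⊗ D ⊕ C₁ ≟ b₁ ⊗ V ⊕ b₂ ⊗ U ⟧ * ⟦ b₄ ⊗ U ≟ U ⊗ D ⟧
      split-equation refl C₁ C₂ D = trans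
        (⟦⟧-cong (B ⊗ Y ≟ A ⊗ (inv i′ ⊗ vcat C₁ C₂) ⊕ Y ⊗ D) (V ⊗ D ⊕ C₁ ≟ b₁ ⊗ V ⊕ b₂ ⊗ U ×-dec b₄ ⊗ U ≟ U ⊗ D)
          (λ e → let e₁ , e₂ = vcat-injective (P-cancel (trans (sym lhs) (trans e rhs))) in sym e₁ , e₂)
          (λ (e₁ , e₂) → trans lhs (trans (cong (P ⊗_) (cong₂ vcat (sym e₁) e₂)) (sym rhs))))
        (⟦⟧-× (V ⊗ D ⊕ C₁ ≟ b₁ ⊗ V ⊕ b₂ ⊗ U) (b₄ ⊗ U ≟ U ⊗ D))
        where
        lhs : B ⊗ Y ≡ P ⊗ vcat (b₁ ⊗ V ⊕ b₂ ⊗ U) (b₄ ⊗ U)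
        lhs = trans (⊗-assoc P _ Y) (cong (P ⊗_) (trans (⊗-assoc β (inv i) Y) (trans (cong (β ⊗_) (cancelˡ _ (inv-ˡ i)))
          (trans (block-⊗-vcat b₁ b₂ 𝟘 b₄ V U) (cong (vcat _) (𝟘-⊗-⊕ _ V))))))
        rhs : A ⊗ (inv i′ ⊗ vcat C₁ C₂) ⊕ Y ⊗ D ≡ P ⊗ vcat (V ⊗ D ⊕ C₁) (U ⊗ D)
        rhs = begin
          A ⊗ (inv i′ ⊗ vcat C₁ C₂) ⊕ Y ⊗ D
            ≡⟨ cong₂ _⊕_ (trans (⊗-assoc P _ _) (cong (P ⊗_) (trans (⊗-assoc (corner r j) Q _) (cong (corner r j ⊗_) (cancelˡ _ (inv-ʳ i′))))))
                 (⊗-assoc P _ D) ⟩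
          P ⊗ (corner r j ⊗ vcat C₁ C₂) ⊕ P ⊗ (vcat V U ⊗ D)
            ≡⟨ ⊗-distribˡ P _ _ ⟨
          P ⊗ (corner r j ⊗ vcat C₁ C₂ ⊕ vcat V U ⊗ D)
            ≡⟨ cong (P ⊗_) (begin
              corner r j ⊗ vcat C₁ C₂ ⊕ vcat V U ⊗ D
                ≡⟨ cong₂ _⊕_ (trans (block-⊗-vcat 𝟙 𝟘 𝟘 𝟘 C₁ C₂) (cong₂ vcat (trans (⊕-𝟘-⊗ _ C₂) (⊗-identityˡ C₁)) (trans (⊕-𝟘-⊗ _ C₂) (⊗-zeroˡ C₁))))
                     (vcat-⊗ V U D) ⟩
              vcat C₁ 𝟘 ⊕ vcat (V ⊗ D) (U ⊗ D)
                ≡⟨ vcat-⊕ C₁ (V ⊗ D) 𝟘 (U ⊗ D) ⟩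
              vcat (C₁ ⊕ V ⊗ D) (𝟘 ⊕ U ⊗ D)
                ≡⟨ cong₂ vcat (⊕-comm C₁ _) (⊕-identityˡ _) ⟩
              vcat (V ⊗ D ⊕ C₁) (U ⊗ D) ∎) ⟩
          P ⊗ vcat (V ⊗ D ⊕ C₁) (U ⊗ D) ∎

    -- C₂ is free and accounts for q^{kj}; C₁ is determined by D; and D runs over the matrices
    -- counted by `lifts`, which applies because b₄ is a diagonal block of a triangular nilpotent
    -- matrix.
    completions-normal : Nil B → A ⊗ B ≡ B ⊗ A →
      ∑ (mats (r ℕ.+ j) k) (λ C → ∑ (mats k k) λ D → ⟦ Nil? D ⟧ * ⟦ B ⊗ Y ≟ A ⊗ C ⊕ Y ⊗ D ⟧) ≡ q ^ (k * j) * (q ^ (j * l) * nil l)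
    completions-normal B-nil AB≡BA = begin
      ∑ (mats (r ℕ.+ j) k) (λ C → ∑ (mats k k) λ D → ⟦ Nil? D ⟧ * ⟦ B ⊗ Y ≟ A ⊗ C ⊕ Y ⊗ D ⟧)
        ≡⟨ ∑-permute (mats (r ℕ.+ j) k) (inv i′ ⊗_) (Q ⊗_) (λ C → cancelˡ C (inv-ˡ i′)) (λ C → cancelˡ C (inv-ʳ i′)) _ ⟨
      ∑ (mats (r ℕ.+ j) k) (λ C → ∑ (mats k k) λ D → ⟦ Nil? D ⟧ * ⟦ B ⊗ Y ≟ A ⊗ (inv i′ ⊗ C) ⊕ Y ⊗ D ⟧)
        ≡⟨ ∑-swap (mats (r ℕ.+ j) k) (mats k k) _ ⟩
      ∑ (mats k k) (λ D → ∑ (mats (r ℕ.+ j) k) λ C → ⟦ Nil? D ⟧ * ⟦ B ⊗ Y ≟ A ⊗ (inv i′ ⊗ C) ⊕ Y ⊗ D ⟧)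
        ≡⟨ ∑-cong (mats k k) (λ D → begin
          ∑ (mats (r ℕ.+ j) k) (λ C → ⟦ Nil? D ⟧ * ⟦ B ⊗ Y ≟ A ⊗ (inv i′ ⊗ C) ⊕ Y ⊗ D ⟧)
            ≡⟨ ∑-vcat finite {r} {j} k _ ⟩
          ∑ (mats r k) (λ C₁ → ∑ (mats j k) λ C₂ → ⟦ Nil? D ⟧ * ⟦ B ⊗ Y ≟ A ⊗ (inv i′ ⊗ vcat C₁ C₂) ⊕ Y ⊗ D ⟧)
            ≡⟨ ∑-cong (mats r k) (λ C₁ → trans (∑-cong (mats j k) λ C₂ → trans (cong (⟦ Nil? D ⟧ *_) (split-equation (b₃≡𝟘 AB≡BA) C₁ C₂ D))
                 (shuffle ⟦ Nil? D ⟧ ⟦ V ⊗ D ⊕ C₁ ≟ b₁ ⊗ V ⊕ b₂ ⊗ U ⟧ _)) (∑-const (mats j k) _)) ⟩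
          ∑ (mats r k) (λ C₁ → card (mats j k) * (⟦ V ⊗ D ⊕ C₁ ≟ b₁ ⊗ V ⊕ b₂ ⊗ U ⟧ * (⟦ Nil? D ⟧ * ⟦ b₄ ⊗ U ≟ U ⊗ D ⟧)))
            ≡⟨ trans (∑-*ˡ (mats r k) (card (mats j k)) _) (cong (card (mats j k) *_) (∑-*ʳ (mats r k) (⟦ Nil? D ⟧ * ⟦ b₄ ⊗ U ≟ U ⊗ D ⟧) _)) ⟩
          card (mats j k) * (∑ (mats r k) (λ C₁ → ⟦ V ⊗ D ⊕ C₁ ≟ b₁ ⊗ V ⊕ b₂ ⊗ U ⟧) * (⟦ Nil? D ⟧ * ⟦ b₄ ⊗ U ≟ U ⊗ D ⟧))
            ≡⟨ cong₂ (λ x y → x * (y * (⟦ Nil? D ⟧ * ⟦ b₄ ⊗ U ≟ U ⊗ D ⟧))) (card-mats j k)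
                 (∑-unique (mats r k) (λ C₁ → V ⊗ D ⊕ C₁ ≟ b₁ ⊗ V ⊕ b₂ ⊗ U) (⊖ (V ⊗ D) ⊕ (b₁ ⊗ V ⊕ b₂ ⊗ U)) (⊕-⊖-cancel _ _)
                   (λ C₁ e → trans (sym (⊖-⊕-cancel (V ⊗ D) C₁)) (cong (⊖ (V ⊗ D) ⊕_) e))) ⟩
          q ^ (k * j) * (1 * (⟦ Nil? D ⟧ * ⟦ b₄ ⊗ U ≟ U ⊗ D ⟧))
            ≡⟨ cong (q ^ (k * j) *_) (ℕ.*-identityˡ _) ⟩
          q ^ (k * j) * (⟦ Nil? D ⟧ * ⟦ b₄ ⊗ U ≟ U ⊗ D ⟧) ∎) ⟩
      ∑ (mats k k) (λ D → q ^ (k * j) * (⟦ Nil? D ⟧ * ⟦ b₄ ⊗ U ≟ U ⊗ D ⟧))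
        ≡⟨ ∑-*ˡ (mats k k) (q ^ (k * j)) _ ⟩
      q ^ (k * j) * ∑ (mats k k) (λ D → ⟦ Nil? D ⟧ * ⟦ b₄ ⊗ U ≟ U ⊗ D ⟧)
        ≡⟨ cong (q ^ (k * j) *_) (lifts b₄ U b₄-nil U-full) ⟩
      q ^ (k * j) * (q ^ (j * l) * nil l) ∎
      where
      shuffle : ∀ x y z → x * (y * z) ≡ y * (x * z)
      shuffle = solve 3 (λ x y z → x :* (y :* z) := y :* (x :* z)) refl where open +-*-Solver
      b₄-nil : Nil b₄
      b₄-nil = proj₂ (Nil-upper⁻ (subst (λ z → Nil (block b₁ b₂ z b₄)) (b₃≡𝟘 AB≡BA) (Nil-conj⁻ (inv-ˡ i) (inv-ʳ i) β B-nil)))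

  -- The value depends on the sizes only and not on A, B or Y. This is why every commuting pair on
  -- the image contributes equally many extensions.
  completions : ∀ r j l (A B : Mat (r ℕ.+ j) (r ℕ.+ j)) (Y : Mat (r ℕ.+ j) (j ℕ.+ l)) → ν A ≡ q ^ j → ν (hcat A Y) ≡ 1 →
    Nil B → A ⊗ B ≡ B ⊗ A →
    ∑ (mats (r ℕ.+ j) (j ℕ.+ l)) (λ C → ∑ (mats (j ℕ.+ l) (j ℕ.+ l)) λ D → ⟦ Nil? D ⟧ * ⟦ B ⊗ Y ≟ A ⊗ C ⊕ Y ⊗ D ⟧)
      ≡ q ^ ((j ℕ.+ l) * j) * (q ^ (j * l) * nil l)
  completions r j l A B Y νA νAY B-nil AB≡BA with P , Q , i , i′ , refl ← corank {r} {j} A νA =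
    go B Y B≡ Y≡ νAY B-nil AB≡BA
    where
    A′ : Mat (r ℕ.+ j) (r ℕ.+ j)
    A′ = P ⊗ (corner r j ⊗ Q)
    V = top r (inv i ⊗ Y)
    U = bottom r (inv i ⊗ Y)
    β = inv i ⊗ (B ⊗ P)
    Y≡ : Y ≡ P ⊗ vcat V U
    Y≡ = sym (trans (cong (P ⊗_) (vcat-η r (inv i ⊗ Y))) (cancelˡ Y (inv-ʳ i)))
    B≡ : B ≡ P ⊗ (block (left r (top r β)) (right r (top r β)) (left r (bottom r β)) (right r (bottom r β)) ⊗ inv i)
    B≡ = sym (trans (cong (λ X → P ⊗ (X ⊗ inv i)) (sym (block-η r r β)))
      (trans (cong (P ⊗_) (trans (⊗-assoc (inv i) (B ⊗ P) (inv i)) (cong (inv i ⊗_) (cancelʳ B (inv-ʳ i))))) (cancelˡ B (inv-ʳ i))))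
    go : ∀ {V : Mat r (j ℕ.+ l)} {U : Mat j (j ℕ.+ l)} {b₁ : Mat r r} {b₂ : Mat r j} {b₃ : Mat j r} {b₄ : Mat j j}
      (B : Mat (r ℕ.+ j) (r ℕ.+ j)) (Y : Mat (r ℕ.+ j) (j ℕ.+ l)) →
      B ≡ P ⊗ (block b₁ b₂ b₃ b₄ ⊗ inv i) → Y ≡ P ⊗ vcat V U →
      ν (hcat A′ Y) ≡ 1 → Nil B → A′ ⊗ B ≡ B ⊗ A′ →
      ∑ (mats (r ℕ.+ j) (j ℕ.+ l)) (λ C → ∑ (mats (j ℕ.+ l) (j ℕ.+ l)) λ D → ⟦ Nil? D ⟧ * ⟦ B ⊗ Y ≟ A′ ⊗ C ⊕ Y ⊗ D ⟧)
        ≡ q ^ ((j ℕ.+ l) * j) * (q ^ (j * l) * nil l)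
    go {V} {U} {b₁} {b₂} {b₃} {b₄} _ _ refl refl νAY B-nil AB≡BA =
      completions-normal i i′ V U (trans (sym (ν-hcat-normal i i′ V U)) νAY) b₁ b₂ b₃ b₄ B-nil AB≡BA

-- Division-free recursions in the corank

module RankRecursions (𝔽 : FiniteSkewField) (Nil? : ∀ {n} (A : Powers.Mat 𝔽 n n) → Dec (Powers.Nil 𝔽 A)) where

  open NilpotentCounts 𝔽 Nil? public
  open import Data.Nat.Base using (_+_; _*_; _^_)
  open ≡-Reasoning

  corankSum : ∀ n → (Mat n n → ℕ) → ℕ → ℕ
  corankSum n f k = ∑ (mats n n) λ A → ⟦ ν A ℕ.≟ q ^ k ⟧ * f A

  corankSum-> : ∀ n f k → n < k → corankSum n f k ≡ 0
  corankSum-> n f k n<k = ∑-zero (mats n n) λ A → cong (_* f A)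
    (⟦⟧-no (ν A ℕ.≟ q ^ k) λ p → ℕ.<⇒≱ n<k (ν≡q^s⇒s≤ {s = k} A p))

  ∑-by-corank : ∀ n (f : Mat n n → ℕ) → ∑ (mats n n) f ≡ ∑< (suc n) (corankSum n f)
  ∑-by-corank n f = trans (∑-cong (mats n n) λ A → sym (begin
      ∑< (suc n) (λ j → ⟦ ν A ℕ.≟ q ^ j ⟧ * f A) ≡⟨ ∑<-*ʳ (suc n) (f A) (λ j → ⟦ ν A ℕ.≟ q ^ j ⟧) ⟩
      ∑< (suc n) (λ j → ⟦ ν A ℕ.≟ q ^ j ⟧) * f A ≡⟨ cong (_* f A) (unique A) ⟩
      1 * f A ≡⟨ ℕ.*-identityˡ (f A) ⟩
      f A ∎))
    (∑-∑< (mats n n) (suc n) (λ A j → ⟦ ν A ℕ.≟ q ^ j ⟧ * f A))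
    where
    unique : ∀ A → ∑< (suc n) (λ j → ⟦ ν A ℕ.≟ q ^ j ⟧) ≡ 1
    unique A = let r , _ , _ , _ , p = ν≡q^ A in trans
      (∑<-cong (suc n) λ j _ → ⟦⟧-cong (ν A ℕ.≟ q ^ j) (n ∸ r ℕ.≟ j)
        (λ e → q^-injective {n ∸ r} {j} (trans (sym p) e)) (λ { refl → p }))
      (∑<-point (suc n) (n ∸ r) (s≤s (ℕ.m∸n≤m n r)))

  corankSum-0 : ∀ n → corankSum n (λ _ → 1) 0 ≡ gl n
  corankSum-0 n = ∑-cong (mats n n) λ A → trans (ℕ.*-identityʳ _)
    (⟦⟧-cong (ν A ℕ.≟ 1) (Inv? A) (Inv-square A) Inv⇒ν)

  -- Initial value of the recursions: a nilpotent matrix of positive size is never invertible. The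
  -- extra weight `f` covers both the count of nilpotents and the count of pairs.
  corankSum-nil-0 : ∀ n (f : Mat (suc n) (suc n) → ℕ) → corankSum (suc n) (λ A → ⟦ Nil? A ⟧ * f A) 0 ≡ 0
  corankSum-nil-0 n f = ∑-zero (mats (suc n) (suc n)) λ A → trans (sym (ℕ.*-assoc ⟦ ν A ℕ.≟ 1 ⟧ ⟦ Nil? A ⟧ (f A))) (cong (_* f A)
    (trans (sym (⟦⟧-× (ν A ℕ.≟ 1) (Nil? A))) (⟦⟧-no (ν A ℕ.≟ 1 ×-dec Nil? A) λ (p , nilA) → Nil⇒¬full-rank A nilA p)))

  ∑-0×0 : (f : Mat 0 0 → ℕ) → ∑ (mats 0 0) f ≡ f 𝟘
  ∑-0×0 f = trans (∑-cong (mats 0 0) λ A → cong f (no-rows A 𝟘))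
    (trans (∑-const (mats 0 0) (f 𝟘)) (trans (cong (_* f 𝟘) (card-mats 0 0)) (ℕ.*-identityˡ (f 𝟘))))

  Nil?-𝟘 : ∀ n → ⟦ Nil? (𝟘 {n} {n}) ⟧ ≡ 1
  Nil?-𝟘 n = ⟦⟧-yes (Nil? 𝟘) Nil-𝟘

  nil-0 : nil 0 ≡ 1
  nil-0 = trans (∑-0×0 _) (Nil?-𝟘 0)

  gl-0 : gl 0 ≡ 1
  gl-0 = trans (∑-0×0 _) (⟦⟧-yes (Inv? 𝟘) (subst Inv (no-rows 𝟙 𝟘) Inv-𝟙))

  corankSum-0×0 : (f : Mat 0 0 → ℕ) → corankSum 0 f 0 ≡ f 𝟘
  corankSum-0×0 f = trans (∑-0×0 _) (trans (cong (_* f 𝟘) (⟦⟧-yes (ν 𝟘 ℕ.≟ 1) (Inv⇒ν (subst Inv (no-rows 𝟙 𝟘) Inv-𝟙)))) (ℕ.*-identityˡ _))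

  centraliser-0×0 : centraliser (𝟘 {0} {0}) ≡ 1
  centraliser-0×0 = trans (∑-0×0 _) (cong₂ _*_ (Nil?-𝟘 0) (⟦⟧-yes (𝟘 ⊗ 𝟘 ≟ 𝟘 ⊗ 𝟘) refl))

  -- A surjection onto a line is a nonzero row, so only the zero row is missing from the full count.
  surj-1 : ∀ k → surj 1 k + 1 ≡ q ^ k
  surj-1 k = begin
    surj 1 k + 1
      ≡⟨ cong (surj 1 k +_) (∑-≟𝟘 1 k) ⟨
    surj 1 k + ∑ (mats 1 k) (λ U → ⟦ U ≟ 𝟘 ⟧)
      ≡⟨ ∑-+ (mats 1 k) _ _ ⟨
    ∑ (mats 1 k) (λ U → ⟦ ν U ℕ.≟ 1 ⟧ + ⟦ U ≟ 𝟘 ⟧)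
      ≡⟨ ∑-cong (mats 1 k) (λ U → dichotomy U) ⟩
    ∑ (mats 1 k) (λ U → 1)
      ≡⟨ trans (∑-const (mats 1 k) 1) (ℕ.*-identityʳ _) ⟩
    card (mats 1 k)
      ≡⟨ trans (card-mats 1 k) (cong (q ^_) (ℕ.*-identityʳ k)) ⟩
    q ^ k ∎
    where
    ν-𝟘 : ν (𝟘 {1} {k}) ≡ q ^ 1
    ν-𝟘 = trans (cong ν (sym E-zero)) (ν-E z≤n z≤n)
    dichotomy : ∀ U → ⟦ ν U ℕ.≟ 1 ⟧ + ⟦ U ≟ 𝟘 ⟧ ≡ 1
    dichotomy U with ν≡q^ U
    ... | zero , _ , _ , (P , Q , _ , _ , e) , p = cong₂ _+_
        (⟦⟧-no (ν U ℕ.≟ 1) λ p′ → ℕ.1+n≢0 (q^-injective {1} {0} (trans (sym p) p′)))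
        (⟦⟧-yes (U ≟ 𝟘) (trans e (trans (cong (λ X → P ⊗ (X ⊗ Q)) E-zero) (trans (cong (P ⊗_) (⊗-zeroˡ Q)) (⊗-zeroʳ P)))))
    ... | suc zero , _ , _ , _ , p = cong₂ _+_ (⟦⟧-yes (ν U ℕ.≟ 1) p)
        (⟦⟧-no (U ≟ 𝟘) λ { refl → ℕ.1+n≢0 (q^-injective {1} {0} (trans (sym ν-𝟘) p)) })
    ... | suc (suc _) , s≤s () , _

  -- The familiar |GL_{n+1}| = (q^{n+1} - 1) q^n |GL_n| with the subtraction moved to the other
  -- side.
  gl-suc : ∀ n → gl (suc n) + q ^ n * gl n ≡ q ^ suc n * (q ^ n * gl n)
  gl-suc n = begin
    gl (suc n) + q ^ n * gl n
      ≡⟨ cong₂ _+_ (trans (gl-+ 1 n) (cong (λ e → surj 1 (suc n) * (q ^ e * gl n)) (ℕ.*-identityˡ n))) (sym (ℕ.*-identityˡ _)) ⟩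
    surj 1 (suc n) * (q ^ n * gl n) + 1 * (q ^ n * gl n)
      ≡⟨ ℕ.*-distribʳ-+ (q ^ n * gl n) (surj 1 (suc n)) 1 ⟨
    (surj 1 (suc n) + 1) * (q ^ n * gl n)
      ≡⟨ cong (_* (q ^ n * gl n)) (surj-1 (suc n)) ⟩
    q ^ suc n * (q ^ n * gl n) ∎

  -- For f depending on A only through its restriction to its image.
  module _ (f : ∀ {n} → Mat n n → ℕ) (f-conj : ∀ {n} → ConjugationInvariant {n} f)
    (f-block : ∀ {m k} (A : Mat m m) (Y : Mat m k) → f (block A Y 𝟘 𝟘) ≡ f A) where

    -- By `f-block` the weight passes unchanged from the matrix to its restriction to the image, and
    -- the number of admissible Y depends only on the corank of that restriction. The coefficients
    -- are hence the same for every such `f`.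
    corankSum-recursion : ∀ m k → corankSum (m + k) f k * (q ^ (k * m) * gl m * gl k) ≡
      gl (m + k) * ∑< (suc m) λ j → corankSum m f j * (q ^ (k * (m ∸ j)) * surj j k)
    corankSum-recursion m k = trans (conjugation-count m k f f-conj) (cong (gl (m + k) *_) (begin
      ∑ (mats m m) (λ A → ∑ (mats m k) λ Y → ⟦ ν (hcat A Y) ℕ.≟ 1 ⟧ * f (block A Y 𝟘 𝟘))
        ≡⟨ ∑-cong (mats m m) (λ A → trans (∑-cong (mats m k) λ Y → cong (⟦ ν (hcat A Y) ℕ.≟ 1 ⟧ *_) (f-block A Y))
             (trans (∑-*ʳ (mats m k) (f A) _) (ℕ.*-comm _ (f A)))) ⟩
      ∑ (mats m m) (λ A → f A * ∑ (mats m k) λ Y → ⟦ ν (hcat A Y) ℕ.≟ 1 ⟧)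
        ≡⟨ ∑-by-corank m _ ⟩
      ∑< (suc m) (corankSum m λ A → f A * ∑ (mats m k) λ Y → ⟦ ν (hcat A Y) ℕ.≟ 1 ⟧)
        ≡⟨ ∑<-cong (suc m) (λ { j (s≤s j≤m) → trans (∑-cong (mats m m) λ A →
             trans (⟦⟧-*-cong (ν A ℕ.≟ q ^ j) (λ p → cong (f A *_) (extensions j≤m A p))) (sym (ℕ.*-assoc ⟦ ν A ℕ.≟ q ^ j ⟧ (f A) _)))
             (∑-*ʳ (mats m m) (q ^ (k * (m ∸ j)) * surj j k) (λ A → ⟦ ν A ℕ.≟ q ^ j ⟧ * f A)) }) ⟩
      ∑< (suc m) (λ j → corankSum m f j * (q ^ (k * (m ∸ j)) * surj j k)) ∎))
      where
      extensions : ∀ {m j} → j ≤ m → (A : Mat m m) → ν A ≡ q ^ j →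
        ∑ (mats m k) (λ Y → ⟦ ν (hcat A Y) ℕ.≟ 1 ⟧) ≡ q ^ (k * (m ∸ j)) * surj j k
      extensions {m} {j} j≤m A p with m ∸ j | ℕ.m∸n+n≡m j≤m
      ... | r | refl = surjective-extensions r j k A p

  -- Comparing blocks of the two products, the lower rows give T [A Y] = 0, hence T = 0 because
  -- [A Y] has a right inverse. What is left is triangular: its nilpotency is that of B and D, and
  -- the upper rows give A B = B A and B Y = A C + Y D.
  centraliser-block : ∀ {m k} (A : Mat m m) (Y : Mat m k) → ν (hcat A Y) ≡ 1 → centraliser (block A Y 𝟘 𝟘) ≡
    ∑ (mats m m) λ B → (⟦ Nil? B ⟧ * ⟦ A ⊗ B ≟ B ⊗ A ⟧) * ∑ (mats m k) λ C → ∑ (mats k k) λ D → ⟦ Nil? D ⟧ * ⟦ B ⊗ Y ≟ A ⊗ C ⊕ Y ⊗ D ⟧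
  centraliser-block {m} {k} A Y AY-full = begin
    centraliser M
      ≡⟨ ∑-block m k m k _ ⟩
    ∑ (mats m m) (λ B → ∑ (mats m k) λ C → ∑ (mats k m) λ T → ∑ (mats k k) λ D →
      ⟦ Nil? (block B C T D) ⟧ * ⟦ M ⊗ block B C T D ≟ block B C T D ⊗ M ⟧)
      ≡⟨ ∑-cong (mats m m) (λ B → ∑-cong (mats m k) λ C → trans (∑-cong (mats k m) λ T → trans (∑-cong (mats k k) λ D → match B C T D)
           (∑-*ˡ (mats k k) ⟦ T ≟ 𝟘 ⟧ _)) (∑-point (mats k m) 𝟘 _)) ⟩
    ∑ (mats m m) (λ B → ∑ (mats m k) λ C → ∑ (mats k k) λ D →
      (⟦ Nil? B ⟧ * ⟦ A ⊗ B ≟ B ⊗ A ⟧) * (⟦ Nil? D ⟧ * ⟦ B ⊗ Y ≟ A ⊗ C ⊕ Y ⊗ D ⟧))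
      ≡⟨ ∑-cong (mats m m) (λ B → trans (∑-cong (mats m k) λ C → ∑-*ˡ (mats k k) (⟦ Nil? B ⟧ * ⟦ A ⊗ B ≟ B ⊗ A ⟧) _)
           (∑-*ˡ (mats m k) (⟦ Nil? B ⟧ * ⟦ A ⊗ B ≟ B ⊗ A ⟧) _)) ⟩
    ∑ (mats m m) (λ B → (⟦ Nil? B ⟧ * ⟦ A ⊗ B ≟ B ⊗ A ⟧) * ∑ (mats m k) λ C → ∑ (mats k k) λ D → ⟦ Nil? D ⟧ * ⟦ B ⊗ Y ≟ A ⊗ C ⊕ Y ⊗ D ⟧) ∎
    where
    M = block A Y (𝟘 {k} {m}) (𝟘 {k} {k})
    MX : ∀ B C T D → M ⊗ block B C T D ≡ block (A ⊗ B ⊕ Y ⊗ T) (A ⊗ C ⊕ Y ⊗ D) 𝟘 𝟘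
    MX B C T D = trans (block-⊗ A Y 𝟘 𝟘 B C T D) (block-cong refl refl
      (trans (⊕-𝟘-⊗ _ T) (⊗-zeroˡ B)) (trans (⊕-𝟘-⊗ _ D) (⊗-zeroˡ C)))
    XM : ∀ B C T D → block B C T D ⊗ M ≡ block (B ⊗ A) (B ⊗ Y) (T ⊗ A) (T ⊗ Y)
    XM B C T D = trans (block-⊗ B C T D A Y 𝟘 𝟘) (block-cong (⊕-⊗-𝟘 _ C) (⊕-⊗-𝟘 _ C) (⊕-⊗-𝟘 _ D) (⊕-⊗-𝟘 _ D))
    match : ∀ B C T D → ⟦ Nil? (block B C T D) ⟧ * ⟦ M ⊗ block B C T D ≟ block B C T D ⊗ M ⟧ ≡
      ⟦ T ≟ 𝟘 ⟧ * ((⟦ Nil? B ⟧ * ⟦ A ⊗ B ≟ B ⊗ A ⟧) * (⟦ Nil? D ⟧ * ⟦ B ⊗ Y ≟ A ⊗ C ⊕ Y ⊗ D ⟧))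
    match B C T D = begin
      ⟦ Nil? X ⟧ * ⟦ M ⊗ X ≟ X ⊗ M ⟧
        ≡⟨ ⟦⟧-× (Nil? X) (M ⊗ X ≟ X ⊗ M) ⟨
      ⟦ Nil? X ×-dec M ⊗ X ≟ X ⊗ M ⟧
        ≡⟨ ⟦⟧-cong (Nil? X ×-dec M ⊗ X ≟ X ⊗ M) (T ≟ 𝟘 ×-dec ((Nil? B ×-dec A ⊗ B ≟ B ⊗ A) ×-dec (Nil? D ×-dec B ⊗ Y ≟ A ⊗ C ⊕ Y ⊗ D))) fwd bwd ⟩
      ⟦ T ≟ 𝟘 ×-dec ((Nil? B ×-dec A ⊗ B ≟ B ⊗ A) ×-dec (Nil? D ×-dec B ⊗ Y ≟ A ⊗ C ⊕ Y ⊗ D)) ⟧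
        ≡⟨ trans (⟦⟧-× (T ≟ 𝟘) _) (cong (⟦ T ≟ 𝟘 ⟧ *_) (trans (⟦⟧-× (Nil? B ×-dec A ⊗ B ≟ B ⊗ A) _)
             (cong₂ _*_ (⟦⟧-× (Nil? B) (A ⊗ B ≟ B ⊗ A)) (⟦⟧-× (Nil? D) (B ⊗ Y ≟ A ⊗ C ⊕ Y ⊗ D))))) ⟩
      ⟦ T ≟ 𝟘 ⟧ * ((⟦ Nil? B ⟧ * ⟦ A ⊗ B ≟ B ⊗ A ⟧) * (⟦ Nil? D ⟧ * ⟦ B ⊗ Y ≟ A ⊗ C ⊕ Y ⊗ D ⟧)) ∎
      where
      X = block B C T D
      fwd : Nil X × M ⊗ X ≡ X ⊗ M → T ≡ 𝟘 × (Nil B × A ⊗ B ≡ B ⊗ A) × (Nil D × B ⊗ Y ≡ A ⊗ C ⊕ Y ⊗ D)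
      fwd (X-nil , e) = T≡𝟘 , (proj₁ B,D-nil , AB) , proj₂ B,D-nil , sym (proj₂ (proj₁ eqs))
        where
        eqs = block-injective (trans (sym (MX B C T D)) (trans e (XM B C T D)))
        T≡𝟘 : T ≡ 𝟘
        T≡𝟘 = let R , AYR = right-inverse (hcat A Y) AY-full in trans (sym (cancelʳ T AYR)) (trans (cong (_⊗ R)
          (trans (⊗-hcat T A Y) (trans (cong₂ hcat (sym (proj₁ (proj₂ eqs))) (sym (proj₂ (proj₂ eqs)))) (sym (𝟘-hcat {b = m}))))) (⊗-zeroˡ R))
        B,D-nil : Nil B × Nil D
        B,D-nil = Nil-upper⁻ (subst (λ t → Nil (block B C t D)) T≡𝟘 X-nil)
        AB : A ⊗ B ≡ B ⊗ A
        AB = trans (sym (⊕-⊗-𝟘 _ Y)) (trans (cong (λ t → A ⊗ B ⊕ Y ⊗ t) (sym T≡𝟘)) (proj₁ (proj₁ eqs)))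
      bwd : T ≡ 𝟘 × (Nil B × A ⊗ B ≡ B ⊗ A) × (Nil D × B ⊗ Y ≡ A ⊗ C ⊕ Y ⊗ D) → Nil X × M ⊗ X ≡ X ⊗ M
      bwd (refl , (B-nil , AB) , (D-nil , BY)) = Nil-upper C B-nil D-nil ,
        trans (MX B C 𝟘 D) (trans (block-cong (trans (⊕-⊗-𝟘 _ Y) AB) (sym BY) (sym (⊗-zeroˡ A)) (sym (⊗-zeroˡ Y))) (sym (XM B C 𝟘 D)))

  centraliser-extension : ∀ r j l (A : Mat (r + j) (r + j)) (Y : Mat (r + j) (j + l)) → ν A ≡ q ^ j → ν (hcat A Y) ≡ 1 →
    centraliser (block A Y 𝟘 𝟘) ≡ centraliser A * (q ^ ((j + l) * j) * (q ^ (j * l) * nil l))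
  centraliser-extension r j l A Y νA νAY = begin
    centraliser (block A Y 𝟘 𝟘)
      ≡⟨ centraliser-block A Y νAY ⟩
    ∑ Ms (λ B → (⟦ Nil? B ⟧ * ⟦ A ⊗ B ≟ B ⊗ A ⟧) * S B)
      ≡⟨ ∑-cong Ms (λ B → trans (cong (_* S B) (sym (⟦⟧-× (Nil? B) (A ⊗ B ≟ B ⊗ A))))
           (trans (⟦⟧-*-cong (Nil? B ×-dec A ⊗ B ≟ B ⊗ A) (λ (B-nil , AB) → completions r j l A B Y νA νAY B-nil AB))
             (cong (_* c) (⟦⟧-× (Nil? B) (A ⊗ B ≟ B ⊗ A))))) ⟩
    ∑ Ms (λ B → (⟦ Nil? B ⟧ * ⟦ A ⊗ B ≟ B ⊗ A ⟧) * c)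
      ≡⟨ ∑-*ʳ Ms c _ ⟩
    centraliser A * c ∎
    where
    Ms = mats (r + j) (r + j)
    c = q ^ ((j + l) * j) * (q ^ (j * l) * nil l)
    S : Mat (r + j) (r + j) → ℕ
    S B = ∑ (mats (r + j) (j + l)) λ C → ∑ (mats (j + l) (j + l)) λ D → ⟦ Nil? D ⟧ * ⟦ B ⊗ Y ≟ A ⊗ C ⊕ Y ⊗ D ⟧

  nilWeight pairWeight : ∀ {n} → Mat n n → ℕ
  nilWeight A = ⟦ Nil? A ⟧
  pairWeight A = ⟦ Nil? A ⟧ * centraliser A

  nilWeight-block : ∀ {m k} (A : Mat m m) (Y : Mat m k) → nilWeight (block A Y 𝟘 𝟘) ≡ nilWeight A
  nilWeight-block A Y = ⟦⟧-cong (Nil? (block A Y 𝟘 𝟘)) (Nil? A) (λ p → proj₁ (Nil-upper⁻ p)) (λ p → Nil-upper Y p Nil-𝟘)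

  pairWeight-conj : ∀ {n} → ConjugationInvariant {n} pairWeight
  pairWeight-conj i A = cong₂ _*_ (Nil?-conj i A) (centraliser-conj i A)

  pairExtensions : ∀ m k → Mat m m → ℕ
  pairExtensions m k A = ∑ (mats m k) λ Y → ⟦ ν (hcat A Y) ℕ.≟ 1 ⟧ * pairWeight (block A Y 𝟘 𝟘)

  pair-recursion : ∀ m k → corankSum (m + k) pairWeight k * (q ^ (k * m) * gl m * gl k) ≡
    gl (m + k) * ∑< (suc m) (corankSum m (pairExtensions m k))
  pair-recursion m k = trans (conjugation-count m k pairWeight pairWeight-conj)
    (cong (gl (m + k) *_) (∑-by-corank m (pairExtensions m k)))

  -- A surjective [A Y] would induce a surjection U from K^k onto the cokernel K^j of A, which is
  -- impossible for j > k.
  pairExtensions-> : ∀ m k j → k < j → j ≤ m → corankSum m (pairExtensions m k) j ≡ 0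
  pairExtensions-> m k j k<j j≤m with r , refl ← ≤⇒∃+ j≤m = ∑-zero (mats m m) λ A →
    trans (⟦⟧-*-cong (ν A ℕ.≟ q ^ j) (λ p → ∑-zero (mats m k) λ Y → cong (_* pairWeight (block A Y 𝟘 𝟘))
      (⟦⟧-no (ν (hcat A Y) ℕ.≟ 1) (no-extension A Y p)))) (ℕ.*-zeroʳ ⟦ ν A ℕ.≟ q ^ j ⟧)
    where
    no-extension : ∀ (A : Mat (r + j) (r + j)) (Y : Mat (r + j) k) → ν A ≡ q ^ j → ν (hcat A Y) ≢ 1
    no-extension A Y νA p with P , Q , i , i′ , refl ← corank {r} {j} A νA =
      ℕ.<⇒≱ k<j (proj₁ (full-rank U (trans (sym (ν-hcat-normal i i′ V U)) (trans (cong (λ Y → ν (hcat (P ⊗ (corner r j ⊗ Q)) Y)) Y≡) p))))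
      where
      V = top r (inv i ⊗ Y)
      U = bottom r (inv i ⊗ Y)
      Y≡ : P ⊗ vcat V U ≡ Y
      Y≡ = trans (cong (P ⊗_) (vcat-η r (inv i ⊗ Y))) (cancelˡ Y (inv-ʳ i))

  -- With m = r + j and k = j + l there are q^{kr} `surj j k` choices of Y, each with q^{kj} q^{jl}
  -- `nil l` completions per commuting B. By `gl-+` the product, multiplied by `gl l`, is q^{km}
  -- `gl k` `nil l`, and q^{km} `gl k` is what cancels in `pair-recursion`. The factor `gl l` on the
  -- left replaces a division.
  pairExtensions-≤ : ∀ m j l → j ≤ m →
    gl l * corankSum m (pairExtensions m (j + l)) j ≡ q ^ ((j + l) * m) * gl (j + l) * nil l * corankSum m pairWeight j
  pairExtensions-≤ m j l j≤m with r , refl ← ≤⇒∃+ j≤m = begin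
    gl l * corankSum m (pairExtensions m k) j
      ≡⟨ ∑-*ˡ (mats m m) (gl l) _ ⟨
    ∑ (mats m m) (λ A → gl l * (⟦ ν A ℕ.≟ q ^ j ⟧ * pairExtensions m k A))
      ≡⟨ ∑-cong (mats m m) (λ A → trans (shuffle (gl l) ⟦ ν A ℕ.≟ q ^ j ⟧ _)
           (trans (⟦⟧-*-cong (ν A ℕ.≟ q ^ j) (step A)) (shuffle ⟦ ν A ℕ.≟ q ^ j ⟧ (q ^ (k * m) * gl k * nil l) (pairWeight A)))) ⟩
    ∑ (mats m m) (λ A → q ^ (k * m) * gl k * nil l * (⟦ ν A ℕ.≟ q ^ j ⟧ * pairWeight A))
      ≡⟨ ∑-*ˡ (mats m m) (q ^ (k * m) * gl k * nil l) _ ⟩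
    q ^ (k * m) * gl k * nil l * corankSum m pairWeight j ∎
    where
    k = j + l
    shuffle : ∀ x y z → x * (y * z) ≡ y * (x * z)
    shuffle = solve 3 (λ x y z → x :* (y :* z) := y :* (x :* z)) refl where open +-*-Solver
    step : ∀ A → ν A ≡ q ^ j → gl l * pairExtensions m k A ≡ q ^ (k * m) * gl k * nil l * pairWeight A
    step A νA = begin
      gl l * pairExtensions m k A
        ≡⟨ cong (gl l *_) (∑-cong (mats m k) λ Y → ⟦⟧-*-cong (ν (hcat A Y) ℕ.≟ 1) (λ νAY →
             cong₂ _*_ (nilWeight-block A Y) (centraliser-extension r j l A Y νA νAY))) ⟩
      gl l * ∑ (mats m k) (λ Y → ⟦ ν (hcat A Y) ℕ.≟ 1 ⟧ * (nilWeight A * (centraliser A * c)))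
        ≡⟨ cong (gl l *_) (trans (∑-*ʳ (mats m k) (nilWeight A * (centraliser A * c)) _)
             (cong (_* (nilWeight A * (centraliser A * c))) (surjective-extensions r j k A νA))) ⟩
      gl l * (q ^ (k * r) * surj j k * (nilWeight A * (centraliser A * c)))
        ≡⟨ rearrange (gl l) (q ^ (k * r)) (surj j k) (nilWeight A) (centraliser A) (q ^ (k * j)) (q ^ (j * l)) (nil l) ⟩
      q ^ (k * r) * q ^ (k * j) * (surj j k * (q ^ (j * l) * gl l)) * nil l * pairWeight A
        ≡⟨ cong₂ (λ x y → x * y * nil l * pairWeight A) (trans (sym (ℕ.^-distribˡ-+-* q (k * r) (k * j))) (cong (q ^_) (sym (ℕ.*-distribˡ-+ k r j)))) (sym (gl-+ j l)) ⟩
      q ^ (k * m) * gl k * nil l * pairWeight A ∎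
      where
      c = q ^ (k * j) * (q ^ (j * l) * nil l)
      rearrange : ∀ g x s n z y w t → g * (x * s * (n * (z * (y * (w * t))))) ≡ x * y * (s * (w * g)) * t * (n * z)
      rearrange = solve 8 (λ g x s n z y w t → g :* (x :* s :* (n :* (z :* (y :* (w :* t))))) := x :* y :* (s :* (w :* g)) :* t :* (n :* z)) refl
        where open +-*-Solver

-- Formal power series in one and two variables

module PowerSeriesAlgebra {R : Set} (_+_ _*_ : R → R → R) (-_ : R → R) (0# 1# : R)
  (isRing : IsCommutativeRing _≡_ _+_ _*_ -_ 0# 1#) where

  private
    commutativeRing : CommutativeRing 0ℓ 0ℓ
    commutativeRing = record { isCommutativeRing = isRing }
  open CommutativeRing commutativeRing public
    using (commutativeSemiring; +-assoc; +-comm; +-identityˡ; +-identityʳ; *-assoc; *-comm; *-identityˡ; *-identityʳ;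
           zeroˡ; zeroʳ; distribˡ; distribʳ; -‿inverseˡ; -‿inverseʳ)
  open import Algebra.Solver.Ring.NaturalCoefficients.Default commutativeSemiring public
    using (solve; _:+_; _:*_; _:=_)
  open ≡-Reasoning

  +-cancelʳ : ∀ z {y w} → y + z ≡ w + z → y ≡ w
  +-cancelʳ z {y} {w} p = trans (sym (undo y)) (trans (cong (_+ (- z)) p) (undo w))
    where
    undo : ∀ y → (y + z) + (- z) ≡ y
    undo y = trans (+-assoc y z (- z)) (trans (cong (y +_) (-‿inverseʳ z)) (+-identityʳ y))

  Seq : Set
  Seq = ℕ → R

  Σ< : ℕ → Seq → R
  Σ< zero f = 0#
  Σ< (suc n) f = f 0 + Σ< n (f ∘ suc)

  Σ<-cong : ∀ n {f g : Seq} → (∀ k → k < n → f k ≡ g k) → Σ< n f ≡ Σ< n g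
  Σ<-cong zero p = refl
  Σ<-cong (suc n) p = cong₂ _+_ (p 0 (s≤s z≤n)) (Σ<-cong n λ k k<n → p (suc k) (s≤s k<n))

  Σ<-zero : ∀ n {f : Seq} → (∀ k → k < n → f k ≡ 0#) → Σ< n f ≡ 0#
  Σ<-zero zero p = refl
  Σ<-zero (suc n) p = trans (cong₂ _+_ (p 0 (s≤s z≤n)) (Σ<-zero n λ k k<n → p (suc k) (s≤s k<n))) (+-identityˡ 0#)

  Σ<-+ : ∀ n (f g : Seq) → Σ< n (λ k → f k + g k) ≡ Σ< n f + Σ< n g
  Σ<-+ zero f g = sym (+-identityˡ 0#)
  Σ<-+ (suc n) f g = trans (cong ((f 0 + g 0) +_) (Σ<-+ n (f ∘ suc) (g ∘ suc)))
    (solve 4 (λ a b c d → (a :+ b) :+ (c :+ d) := (a :+ c) :+ (b :+ d)) refl (f 0) (g 0) _ _)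

  Σ<-* : ∀ n c (f : Seq) → Σ< n (λ k → c * f k) ≡ c * Σ< n f
  Σ<-* zero c f = sym (zeroʳ c)
  Σ<-* (suc n) c f = trans (cong ((c * f 0) +_) (Σ<-* n c (f ∘ suc))) (sym (distribˡ c (f 0) _))

  Σ<-*ʳ : ∀ n c (f : Seq) → Σ< n (λ k → f k * c) ≡ Σ< n f * c
  Σ<-*ʳ n c f = trans (Σ<-cong n (λ k _ → *-comm (f k) c)) (trans (Σ<-* n c f) (*-comm c _))

  Σ<-swap : ∀ m n (f : ℕ → Seq) → Σ< m (λ i → Σ< n (f i)) ≡ Σ< n (λ j → Σ< m (λ i → f i j))
  Σ<-swap zero n f = sym (Σ<-zero n λ _ _ → refl)
  Σ<-swap (suc m) n f = trans (cong (Σ< n (f 0) +_) (Σ<-swap m n (f ∘ suc)))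
    (sym (Σ<-+ n (f 0) (λ j → Σ< m (λ i → f (suc i) j))))

  Σ<-extend : ∀ m n {f : Seq} → (∀ k → m ≤ k → f k ≡ 0#) → Σ< (m ℕ.+ n) f ≡ Σ< m f
  Σ<-extend zero n p = Σ<-zero n λ k _ → p k z≤n
  Σ<-extend (suc m) n p = cong (_ +_) (Σ<-extend m n λ k m≤k → p (suc k) (s≤s m≤k))

  Σ<-extend-≤ : ∀ {m n} {f : Seq} → m ≤ n → (∀ k → m ≤ k → f k ≡ 0#) → Σ< n f ≡ Σ< m f
  Σ<-extend-≤ {m} m≤n p with d , refl ← ℕ.m≤n⇒∃[o]m+o≡n m≤n = Σ<-extend m d p

  Σ<-last : ∀ n (f : Seq) → Σ< (suc n) f ≡ Σ< n f + f n
  Σ<-last zero f = trans (+-identityʳ (f 0)) (sym (+-identityˡ (f 0)))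
  Σ<-last (suc n) f = trans (cong (f 0 +_) (Σ<-last n (f ∘ suc))) (sym (+-assoc (f 0) _ _))

  Σ<-reverse : ∀ n (f : Seq) → Σ< (suc n) f ≡ Σ< (suc n) (λ k → f (n ∸ k))
  Σ<-reverse zero f = refl
  Σ<-reverse (suc n) f = begin
    Σ< (suc (suc n)) f ≡⟨ Σ<-last (suc n) f ⟩
    Σ< (suc n) f + f (suc n) ≡⟨ +-comm _ _ ⟩
    f (suc n) + Σ< (suc n) f ≡⟨ cong (f (suc n) +_) (Σ<-reverse n f) ⟩
    f (suc n) + Σ< (suc n) (λ k → f (n ∸ k)) ∎

  one : Seq
  one zero = 1#
  one (suc n) = 0#

  -- Multiplication by u ^ c.
  shift : ℕ → Seq → Seq
  shift zero f n = f n
  shift (suc c) f zero = 0#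
  shift (suc c) f (suc n) = shift c f n

  shift-cong : ∀ c {f g : Seq} n → (∀ m → c ℕ.+ m ≡ n → f m ≡ g m) → shift c f n ≡ shift c g n
  shift-cong zero n p = p n refl
  shift-cong (suc c) zero p = refl
  shift-cong (suc c) (suc n) p = shift-cong c n λ m e → p m (cong suc e)

  shift-+ : ∀ c d (f : Seq) n → shift c (shift d f) n ≡ shift (c ℕ.+ d) f n
  shift-+ zero d f n = refl
  shift-+ (suc c) d f zero = refl
  shift-+ (suc c) d f (suc n) = shift-+ c d f n

  shift-≥ : ∀ c (f : Seq) n → shift c f (c ℕ.+ n) ≡ f n
  shift-≥ zero f n = refl
  shift-≥ (suc c) f n = shift-≥ c f n

  shift-< : ∀ c (f : Seq) {n} → n < c → shift c f n ≡ 0#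
  shift-< (suc c) f {zero} _ = refl
  shift-< (suc c) f {suc n} (s≤s n<c) = shift-< c f n<c

  shift-0 : ∀ c n → shift c (λ _ → 0#) n ≡ 0#
  shift-0 zero n = refl
  shift-0 (suc c) zero = refl
  shift-0 (suc c) (suc n) = shift-0 c n

  shift-lin : ∀ c (a : R) (f g : Seq) n → shift c (λ m → f m + (a * g m)) n ≡ shift c f n + (a * shift c g n)
  shift-lin zero a f g n = refl
  shift-lin (suc c) a f g zero = sym (trans (+-identityˡ _) (zeroʳ a))
  shift-lin (suc c) a f g (suc n) = shift-lin c a f g n

  shift-* : ∀ c (a : R) (g : Seq) n → shift c (λ m → a * g m) n ≡ a * shift c g n
  shift-* zero a g n = refl
  shift-* (suc c) a g zero = sym (zeroʳ a)
  shift-* (suc c) a g (suc n) = shift-* c a g n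

  shift-Σ : ∀ c L (a : Seq) (f : ℕ → Seq) n →
    shift c (λ m → Σ< L (λ l → a l * f l m)) n ≡ Σ< L (λ l → a l * shift c (f l) n)
  shift-Σ zero L a f n = refl
  shift-Σ (suc c) L a f zero = sym (Σ<-zero L λ l _ → zeroʳ (a l))
  shift-Σ (suc c) L a f (suc n) = shift-Σ c L a f n

  shift-swap : ∀ c d (g : ℕ → Seq) n k →
    shift c (λ n′ → shift d (g n′) k) n ≡ shift d (λ k′ → shift c (λ n′ → g n′ k′) n) k
  shift-swap zero d g n k = refl
  shift-swap (suc c) d g zero k = sym (shift-0 d k)
  shift-swap (suc c) d g (suc n) k = shift-swap c d g n k

  conv : Seq → Seq → Seq
  conv h r n = Σ< (suc n) λ k → h k * r (n ∸ k)

  conv-flip : ∀ h r n → conv h r n ≡ Σ< (suc n) (λ k → h (n ∸ k) * r k)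
  conv-flip h r n = trans (Σ<-reverse n (λ k → h k * r (n ∸ k))) (Σ<-cong (suc n) λ { k (s≤s k≤n) → cong (λ m → h (n ∸ k) * r m) (ℕ.m∸[m∸n]≡n k≤n) })

  private
    -- With the second factor read from its constant term upwards, a shift of that factor only adds
    -- a vanishing first summand, so induction on the shift goes through.
    flipped : Seq → Seq → Seq
    flipped h r n = Σ< (suc n) λ k → h (n ∸ k) * r k

    flipped-one : ∀ h n → flipped h one n ≡ h n
    flipped-one h n = trans (cong₂ _+_ (*-identityʳ (h n)) (Σ<-zero n λ k _ → zeroʳ _)) (+-identityʳ (h n))

    flipped-shift : ∀ c h r n → flipped h (shift c r) n ≡ shift c (flipped h r) n
    flipped-shift zero h r n = refl
    flipped-shift (suc c) h r zero = trans (cong (_+ 0#) (zeroʳ (h 0))) (+-identityˡ 0#)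
    flipped-shift (suc c) h r (suc n) = trans (cong (_+ flipped h (shift c r) n) (zeroʳ (h (suc n))))
      (trans (+-identityˡ _) (flipped-shift c h r n))

  conv-one : ∀ h n → conv h one n ≡ h n
  conv-one h n = trans (conv-flip h one n) (flipped-one h n)

  conv-shift : ∀ c h r n → conv h (shift c r) n ≡ shift c (conv h r) n
  conv-shift c h r n = trans (conv-flip h (shift c r) n) (trans (flipped-shift c h r n)
    (shift-cong c n λ m _ → sym (conv-flip h r m)))

  conv-congʳ : ∀ h {r r′ : Seq} n → (∀ k → k ≤ n → r k ≡ r′ k) → conv h r n ≡ conv h r′ n
  conv-congʳ h n p = Σ<-cong (suc n) λ k _ → cong (h k *_) (p (n ∸ k) (ℕ.m∸n≤m n k))

  conv-comm : ∀ h r n → conv h r n ≡ conv r h n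
  conv-comm h r n = trans (conv-flip h r n) (Σ<-cong (suc n) λ k _ → *-comm (h (n ∸ k)) (r k))

  conv-linʳ : ∀ h (f g : Seq) x n → conv h (λ k → f k + (x * g k)) n ≡ conv h f n + (x * conv h g n)
  conv-linʳ h f g x n = trans
    (Σ<-cong (suc n) λ k _ → solve 4 (λ h f x g → h :* (f :+ x :* g) := h :* f :+ x :* (h :* g)) refl (h k) (f (n ∸ k)) x (g (n ∸ k)))
    (trans (Σ<-+ (suc n) (λ k → h k * f (n ∸ k)) (λ k → x * (h k * g (n ∸ k)))) (cong (conv h f n +_) (Σ<-* (suc n) x (λ k → h k * g (n ∸ k)))))

  conv-Σʳ : ∀ h L (a : Seq) (f : ℕ → Seq) n → conv h (λ k → Σ< L (λ l → a l * f l k)) n ≡ Σ< L (λ l → a l * conv h (f l) n)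
  conv-Σʳ h L a f n = begin
    Σ< (suc n) (λ k → h k * Σ< L (λ l → a l * f l (n ∸ k)))
      ≡⟨ Σ<-cong (suc n) (λ k _ → trans (sym (Σ<-* L (h k) _)) (Σ<-cong L λ l _ →
           solve 3 (λ h a f → h :* (a :* f) := a :* (h :* f)) refl (h k) (a l) (f l (n ∸ k)))) ⟩
    Σ< (suc n) (λ k → Σ< L (λ l → a l * (h k * f l (n ∸ k))))
      ≡⟨ Σ<-swap (suc n) L (λ k l → a l * (h k * f l (n ∸ k))) ⟩
    Σ< L (λ l → Σ< (suc n) (λ k → a l * (h k * f l (n ∸ k))))
      ≡⟨ Σ<-cong L (λ l _ → Σ<-* (suc n) (a l) (λ k → h k * f l (n ∸ k))) ⟩
    Σ< L (λ l → a l * conv h (f l) n) ∎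

  -- Since i ≥ 1, the equation e = h + x uⁱ e determines e from h.
  geometric-unique : ∀ i x (h e e′ : Seq) →
    (∀ n → e n ≡ h n + (x * shift (suc i) e n)) → (∀ n → e′ n ≡ h n + (x * shift (suc i) e′ n)) → ∀ n → e n ≡ e′ n
  geometric-unique i x h e e′ p p′ n = go (suc n) n (ℕ.n<1+n n)
    where
    go : ∀ b n → n < b → e n ≡ e′ n
    go (suc b) n (s≤s n≤b) = trans (p n) (trans (cong (λ y → h n + (x * y))
      (shift-cong (suc i) n λ m eq → go b m (ℕ.≤-trans (subst (suc m ≤_) eq (s≤s (ℕ.m≤n+m m i))) n≤b))) (sym (p′ n)))

  -- The coefficients of Σ_l a_l u^{il}.
  dilate : ℕ → Seq → Seq
  dilate i a n = Σ< (suc n) λ l → a l * shift (i ℕ.* l) one n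

  -- Because the exponent is positive, the terms with l > n start beyond degree n. The bound can
  -- therefore be chosen independently of n, as sums over several degrees require.
  dilate-bound : ∀ i a {L n} → n < L → dilate (suc i) a n ≡ Σ< L (λ l → a l * shift (suc i ℕ.* l) one n)
  dilate-bound i a {L} {n} n<L = sym (Σ<-extend-≤ n<L λ l n<l →
    trans (cong (a l *_) (shift-< (suc i ℕ.* l) one (ℕ.≤-trans n<l (ℕ.m≤n*m l (suc i))))) (zeroʳ (a l)))

  dilate-lin : ∀ i x (a b c : Seq) → (∀ s → a s ≡ b s + (x * c s)) → ∀ n → dilate i a n ≡ dilate i b n + (x * dilate i c n)
  dilate-lin i x a b c p n = trans
    (Σ<-cong (suc n) λ l _ → trans (cong (_* shift (i ℕ.* l) one n) (p l))
      (solve 4 (λ b x c o → (b :+ x :* c) :* o := b :* o :+ x :* (c :* o)) refl (b l) x (c l) (shift (i ℕ.* l) one n)))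
    (trans (Σ<-+ (suc n) (λ l → b l * shift (i ℕ.* l) one n) (λ l → x * (c l * shift (i ℕ.* l) one n)))
      (cong (dilate i b n +_) (Σ<-* (suc n) x (λ l → c l * shift (i ℕ.* l) one n))))

  -- Substituting u^{i+1} for u turns a factor u into u^{i+1}.
  dilate-shift : ∀ i a n → dilate (suc i) (shift 1 a) n ≡ shift (suc i) (dilate (suc i) a) n
  dilate-shift i a n = begin
    (0# * shift (suc i ℕ.* 0) one n) + Σ< n (λ l → a l * shift (suc i ℕ.* suc l) one n)
      ≡⟨ trans (cong (_+ Σ< n (λ l → a l * shift (suc i ℕ.* suc l) one n)) (zeroˡ _)) (+-identityˡ _) ⟩
    Σ< n (λ l → a l * shift (suc i ℕ.* suc l) one n)
      ≡⟨ Σ<-cong n (λ l _ → cong (a l *_) (trans (cong (λ e → shift e one n) (ℕ.*-suc (suc i) l)) (sym (shift-+ (suc i) (suc i ℕ.* l) one n)))) ⟩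
    Σ< n (λ l → a l * shift (suc i) (shift (suc i ℕ.* l) one) n)
      ≡⟨ shift-Σ (suc i) n a (λ l → shift (suc i ℕ.* l) one) n ⟨
    shift (suc i) (λ m → Σ< n (λ l → a l * shift (suc i ℕ.* l) one m)) n
      ≡⟨ shift-cong (suc i) n (λ m e → sym (dilate-bound i a (subst (m <_) e (s≤s (ℕ.m≤n+m m i))))) ⟩
    shift (suc i) (dilate (suc i) a) n ∎

  conv-dilate : ∀ i a h {L n} → n < L → conv h (dilate (suc i) a) n ≡ Σ< L (λ l → a l * shift (suc i ℕ.* l) h n)
  conv-dilate i a h {L} {n} n<L = begin
    conv h (dilate (suc i) a) n
      ≡⟨ conv-congʳ h n (λ k k≤n → dilate-bound i a (ℕ.≤-trans (s≤s k≤n) n<L)) ⟩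
    conv h (λ k → Σ< L (λ l → a l * shift (suc i ℕ.* l) one k)) n
      ≡⟨ conv-Σʳ h L a (λ l → shift (suc i ℕ.* l) one) n ⟩
    Σ< L (λ l → a l * conv h (shift (suc i ℕ.* l) one) n)
      ≡⟨ Σ<-cong L (λ l _ → cong (a l *_) (trans (conv-shift (suc i ℕ.* l) h one n) (shift-cong (suc i ℕ.* l) n λ m _ → conv-one h m))) ⟩
    Σ< L (λ l → a l * shift (suc i ℕ.* l) h n) ∎

  Σ<-point : ∀ N s {f : Seq} → s < N → (∀ l → l ≢ s → f l ≡ 0#) → Σ< N f ≡ f s
  Σ<-point (suc N) zero {f} _ p = trans (cong (f 0 +_) (Σ<-zero N λ l _ → p (suc l) λ ())) (+-identityʳ (f 0))
  Σ<-point (suc N) (suc s) {f} (s≤s s<N) p = trans (cong (_+ Σ< N (f ∘ suc)) (p 0 λ ()))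
    (trans (+-identityˡ _) (Σ<-point N s s<N λ l l≢s → p (suc l) (l≢s ∘ ℕ.suc-injective)))

  shift-one-≡ : ∀ c → shift c one c ≡ 1#
  shift-one-≡ zero = refl
  shift-one-≡ (suc c) = shift-one-≡ c

  shift-one-≢ : ∀ c n → c ≢ n → shift c one n ≡ 0#
  shift-one-≢ zero zero c≢n = contradiction refl c≢n
  shift-one-≢ zero (suc n) c≢n = refl
  shift-one-≢ (suc c) zero c≢n = refl
  shift-one-≢ (suc c) (suc n) c≢n = shift-one-≢ c n (c≢n ∘ cong suc)

  -- The index s is found before the series b is chosen, so the partial products and their limit,
  -- dilated by the same exponent, can be compared through the same coefficient.
  dilate-cases : ∀ i n → (∃ λ s → ∀ (b : Seq) → dilate (suc i) b n ≡ b s) ⊎ (∀ (b : Seq) → dilate (suc i) b n ≡ 0#)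
  dilate-cases i n with suc i ∣? n
  ... | no ∤ = inj₂ λ b → Σ<-zero (suc n) λ l _ → trans (cong (b l *_) (shift-one-≢ (suc i ℕ.* l) n
        λ e → ∤ (divides l (trans (sym e) (ℕ.*-comm (suc i) l))))) (zeroʳ (b l))
  ... | yes (divides s refl) = inj₁ (s , λ b → trans
        (Σ<-point (suc (s ℕ.* suc i)) s (s≤s (ℕ.m≤m*n s (suc i))) λ l l≢s → trans (cong (b l *_)
          (shift-one-≢ (suc i ℕ.* l) (s ℕ.* suc i) λ e → l≢s (ℕ.*-cancelʳ-≡ l s (suc i) (trans (ℕ.*-comm l (suc i)) e)))) (zeroʳ (b l)))
        (trans (cong (b s *_) (trans (cong (λ e → shift e one (s ℕ.* suc i)) (ℕ.*-comm (suc i) s)) (shift-one-≡ (s ℕ.* suc i)))) (*-identityʳ (b s))))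

  -- If (1 - p uⁱ) r = 1 then multiplying a series h by r gives e with e = h + p uⁱ e.
  conv-geometric : ∀ i p {f r : Seq} → (∀ k → f k + (p * shift i one k) ≡ one k) → (∀ n → conv f r n ≡ one n) →
    ∀ h n → conv h r n ≡ h n + (p * shift i (conv h r) n)
  conv-geometric i p {f} {r} f-def inv h n = begin
    conv h r n ≡⟨ conv-congʳ h n (λ k _ → r-recursion k) ⟩
    conv h (λ k → one k + (p * shift i r k)) n ≡⟨ conv-linʳ h one (shift i r) p n ⟩
    conv h one n + (p * conv h (shift i r) n) ≡⟨ cong₂ (λ y z → y + (p * z)) (conv-one h n) (conv-shift i h r n) ⟩
    h n + (p * shift i (conv h r) n) ∎
    where
    r-recursion : ∀ k → r k ≡ one k + (p * shift i r k)
    r-recursion k = begin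
      r k ≡⟨ conv-one r k ⟨
      conv r one k ≡⟨ conv-congʳ r k (λ j _ → f-def j) ⟨
      conv r (λ j → f j + (p * shift i one j)) k ≡⟨ conv-linʳ r f (shift i one) p k ⟩
      conv r f k + (p * conv r (shift i one) k) ≡⟨ cong₂ (λ y z → y + (p * z)) (trans (conv-comm r f k) (inv k))
                                                                (trans (conv-shift i r one k) (shift-cong i k λ m _ → conv-one r m)) ⟩
      one k + (p * shift i r k) ∎

  -- Bivariate series, with u marking the first index and t the second.
  Array : Set
  Array = ℕ → Seq

  infix 4 _≗₂_
  _≗₂_ : Array → Array → Set
  g ≗₂ h = ∀ n k → g n k ≡ h n k

  -- The substitution t ↦ u t.
  tilt : Array → Array
  tilt g n k = shift k (λ n′ → g n′ k) n

  -- In the factor with i = 0, which is Σ a_l tˡ, the power of u puts no bound on l. Cutting every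
  -- factor at l < L keeps the sums finite and changes no coefficient with k < L.
  module _ (a : Seq) (L : ℕ) where

    -- Multiplication by Σ_{l<L} a_l u^{il} tˡ.
    mult : ℕ → Array → Array
    mult i g n k = Σ< L λ l → a l * shift (i ℕ.* l) (λ n′ → shift l (g n′) k) n

    mult-cong : ∀ i {g h} → g ≗₂ h → mult i g ≗₂ mult i h
    mult-cong i p n k = Σ<-cong L λ l _ → cong (a l *_) (shift-cong (i ℕ.* l) n λ n′ _ → shift-cong l k λ k′ _ → p n′ k′)

    tilt-cong : ∀ {g h} → g ≗₂ h → tilt g ≗₂ tilt h
    tilt-cong p n k = shift-cong k n λ n′ _ → p n′ k

    -- The substitution turns u^{il} tˡ into u^{(i+1)l} tˡ and so moves each factor to the next
    -- index. In the coefficient of t^k both sides vanish for l > k; for k = l + d both shifts of u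
    -- total (i+1) l + d.
    tilt-mult : ∀ i g → tilt (mult i g) ≗₂ mult (suc i) (tilt g)
    tilt-mult i g n k = trans (shift-Σ k L a (λ l → shift (i ℕ.* l) (λ n″ → shift l (g n″) k)) n)
      (Σ<-cong L λ l _ → cong (a l *_) (trans (shift-+ k (i ℕ.* l) (λ n″ → shift l (g n″) k) n) (term l)))
      where
      term : ∀ l → shift (k ℕ.+ i ℕ.* l) (λ n″ → shift l (g n″) k) n ≡
        shift (suc i ℕ.* l) (λ n′ → shift l (tilt g n′) k) n
      term l with l ℕ.≤? k
      ... | no l≰k = trans
        (trans (shift-cong (k ℕ.+ i ℕ.* l) n λ n″ _ → shift-< l (g n″) (ℕ.≰⇒> l≰k)) (shift-0 (k ℕ.+ i ℕ.* l) n))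
        (sym (trans (shift-cong (suc i ℕ.* l) n λ n′ _ → shift-< l (tilt g n′) (ℕ.≰⇒> l≰k)) (shift-0 (suc i ℕ.* l) n)))
      ... | yes l≤k with d , refl ← ℕ.m≤n⇒∃[o]m+o≡n l≤k = begin
        shift (l ℕ.+ d ℕ.+ i ℕ.* l) (λ n″ → shift l (g n″) (l ℕ.+ d)) n
          ≡⟨ shift-cong (l ℕ.+ d ℕ.+ i ℕ.* l) n (λ n″ _ → shift-≥ l (g n″) d) ⟩
        shift (l ℕ.+ d ℕ.+ i ℕ.* l) (λ n″ → g n″ d) n
          ≡⟨ cong (λ e → shift e (λ n″ → g n″ d) n) (trans (ℕ.+-assoc l d (i ℕ.* l)) (trans (cong (l ℕ.+_) (ℕ.+-comm d _)) (sym (ℕ.+-assoc l (i ℕ.* l) d)))) ⟩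
        shift (suc i ℕ.* l ℕ.+ d) (λ n″ → g n″ d) n
          ≡⟨ shift-+ (suc i ℕ.* l) d (λ n″ → g n″ d) n ⟨
        shift (suc i ℕ.* l) (λ n′ → tilt g n′ d) n
          ≡⟨ shift-cong (suc i ℕ.* l) n (λ n′ _ → shift-≥ l (tilt g n′) d) ⟨
        shift (suc i ℕ.* l) (λ n′ → shift l (tilt g n′) (l ℕ.+ d)) n ∎

    mult-expand : ∀ i j g n k → mult i (mult j g) n k ≡
      Σ< L (λ l → Σ< L (λ l′ → a l * (a l′ * shift (i ℕ.* l ℕ.+ j ℕ.* l′) (λ n′ → shift (l ℕ.+ l′) (g n′) k) n)))
    mult-expand i j g n k = Σ<-cong L λ l _ → begin
      a l * shift (i ℕ.* l) (λ n′ → shift l (mult j g n′) k) n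
        ≡⟨ cong (a l *_) (shift-cong (i ℕ.* l) n λ n′ _ → trans
             (shift-Σ l L a (λ l′ k′ → shift (j ℕ.* l′) (λ n″ → shift l′ (g n″) k′) n′) k)
             (Σ<-cong L λ l′ _ → cong (a l′ *_) (trans (sym (shift-swap (j ℕ.* l′) l (λ n″ → shift l′ (g n″)) n′ k))
               (shift-cong (j ℕ.* l′) n′ λ n″ _ → shift-+ l l′ (g n″) k)))) ⟩
      a l * shift (i ℕ.* l) (λ n′ → Σ< L (λ l′ → a l′ * shift (j ℕ.* l′) (λ n″ → shift (l ℕ.+ l′) (g n″) k) n′)) n
        ≡⟨ cong (a l *_) (trans (shift-Σ (i ℕ.* l) L a (λ l′ → shift (j ℕ.* l′) (λ n″ → shift (l ℕ.+ l′) (g n″) k)) n)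
             (Σ<-cong L λ l′ _ → cong (a l′ *_) (shift-+ (i ℕ.* l) (j ℕ.* l′) _ n))) ⟩
      a l * Σ< L (λ l′ → a l′ * shift (i ℕ.* l ℕ.+ j ℕ.* l′) (λ n′ → shift (l ℕ.+ l′) (g n′) k) n)
        ≡⟨ Σ<-* L (a l) _ ⟨
      Σ< L (λ l′ → a l * (a l′ * shift (i ℕ.* l ℕ.+ j ℕ.* l′) (λ n′ → shift (l ℕ.+ l′) (g n′) k) n)) ∎

    mult-comm : ∀ i j g → mult i (mult j g) ≗₂ mult j (mult i g)
    mult-comm i j g n k = begin
      mult i (mult j g) n k
        ≡⟨ mult-expand i j g n k ⟩
      Σ< L (λ l → Σ< L (λ l′ → a l * (a l′ * shift (i ℕ.* l ℕ.+ j ℕ.* l′) (λ n′ → shift (l ℕ.+ l′) (g n′) k) n)))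
        ≡⟨ Σ<-swap L L _ ⟩
      Σ< L (λ l′ → Σ< L (λ l → a l * (a l′ * shift (i ℕ.* l ℕ.+ j ℕ.* l′) (λ n′ → shift (l ℕ.+ l′) (g n′) k) n)))
        ≡⟨ Σ<-cong L (λ l′ _ → Σ<-cong L λ l _ → trans
             (solve 3 (λ x y z → x :* (y :* z) := y :* (x :* z)) refl (a l) (a l′) _)
             (cong₂ (λ e d → a l′ * (a l * shift e (λ n′ → shift d (g n′) k) n)) (ℕ.+-comm (i ℕ.* l) _) (ℕ.+-comm l l′))) ⟩
      Σ< L (λ l′ → Σ< L (λ l → a l′ * (a l * shift (j ℕ.* l′ ℕ.+ i ℕ.* l) (λ n′ → shift (l′ ℕ.+ l) (g n′) k) n)))
        ≡⟨ mult-expand j i g n k ⟨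
      mult j (mult i g) n k ∎

    unit : Array
    unit n k = one n * one k

    -- ∏_{i ≤ M} Σ_{l<L} a_l u^{il} tˡ, built by tilting all factors and adding a new first one.
    tower : ℕ → Array
    tower zero = unit
    tower (suc M) = tilt (mult 0 (tower M))

    tilt-unit : tilt unit ≗₂ unit
    tilt-unit n zero = refl
    tilt-unit n (suc k) = trans (shift-cong (suc k) n λ m _ → zeroʳ (one m)) (trans (shift-0 (suc k) n) (sym (zeroʳ (one n))))

    -- `tower` adds a factor at the front because the recursion for g has that form, whereas partial
    -- products append one at the end. Tilting raises all indices and the factors commute, so the
    -- two constructions agree.
    tower-suc : ∀ M → tower (suc M) ≗₂ mult (suc M) (tower M)
    tower-suc zero n k = trans (tilt-mult 0 unit n k) (mult-cong 1 tilt-unit n k)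
    tower-suc (suc M) n k = begin
      tilt (mult 0 (tower (suc M))) n k ≡⟨ tilt-mult 0 (tower (suc M)) n k ⟩
      mult 1 (tilt (tower (suc M))) n k ≡⟨ mult-cong 1 (tilt-cong (tower-suc M)) n k ⟩
      mult 1 (tilt (mult (suc M) (tower M))) n k ≡⟨ mult-cong 1 (tilt-mult (suc M) (tower M)) n k ⟩
      mult 1 (mult (suc (suc M)) (tilt (tower M))) n k ≡⟨ mult-comm 1 (suc (suc M)) (tilt (tower M)) n k ⟩
      mult (suc (suc M)) (mult 1 (tilt (tower M))) n k ≡⟨ mult-cong (suc (suc M)) (tilt-mult 0 (tower M)) n k ⟨
      mult (suc (suc M)) (tower (suc M)) n k ∎

    tower-> : ∀ M n k → n < k → tower M n k ≡ 0#
    tower-> zero n (suc k) _ = zeroʳ (one n)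
    tower-> (suc M) n k n<k = shift-< k (λ n′ → mult 0 (tower M) n′ k) n<k

    -- The specialisation t = 1.
    specialise : Array → Seq
    specialise g n = Σ< (suc n) (g n)

    Σ<-shift : ∀ l N (f : Seq) → Σ< (l ℕ.+ N) (shift l f) ≡ Σ< N f
    Σ<-shift zero N f = refl
    Σ<-shift (suc l) N f = trans (+-identityˡ _) (Σ<-shift l N f)

    -- At t = 1 the powers of t disappear. The range k ≤ n loses no term: g is supported on k ≤ n,
    -- and a term raising k by l raises n by at least l.
    specialise-mult : ∀ i g {n} → n < L → (∀ n k → n < k → g n k ≡ 0#) →
      specialise (mult (suc i) g) n ≡ Σ< L (λ l → a l * shift (suc i ℕ.* l) (specialise g) n)
    specialise-mult i g {n} n<L g-> = begin
      Σ< (suc n) (λ k → Σ< L (λ l → a l * shift (suc i ℕ.* l) (λ n′ → shift l (g n′) k) n))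
        ≡⟨ Σ<-swap (suc n) L (λ k l → a l * shift (suc i ℕ.* l) (λ n′ → shift l (g n′) k) n) ⟩
      Σ< L (λ l → Σ< (suc n) (λ k → a l * shift (suc i ℕ.* l) (λ n′ → shift l (g n′) k) n))
        ≡⟨ Σ<-cong L (λ l _ → trans (Σ<-* (suc n) (a l) (λ k → shift (suc i ℕ.* l) (λ n′ → shift l (g n′) k) n)) (cong (a l *_) (term l))) ⟩
      Σ< L (λ l → a l * shift (suc i ℕ.* l) (specialise g) n) ∎
      where
      term : ∀ l → Σ< (suc n) (λ k → shift (suc i ℕ.* l) (λ n′ → shift l (g n′) k) n) ≡ shift (suc i ℕ.* l) (specialise g) n
      term l with suc i ℕ.* l ℕ.≤? n
      ... | no ≰n = trans (Σ<-zero (suc n) λ k _ → shift-< (suc i ℕ.* l) (λ n′ → shift l (g n′) k) (ℕ.≰⇒> ≰n)) (sym (shift-< (suc i ℕ.* l) _ (ℕ.≰⇒> ≰n)))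
      ... | yes ≤n with m , refl ← ℕ.m≤n⇒∃[o]m+o≡n ≤n = begin
        Σ< (suc (suc i ℕ.* l ℕ.+ m)) (λ k → shift (suc i ℕ.* l) (λ n′ → shift l (g n′) k) (suc i ℕ.* l ℕ.+ m))
          ≡⟨ Σ<-cong (suc (suc i ℕ.* l ℕ.+ m)) (λ k _ → shift-≥ (suc i ℕ.* l) (λ n′ → shift l (g n′) k) m) ⟩
        Σ< (suc (suc i ℕ.* l ℕ.+ m)) (shift l (g m))
          ≡⟨ cong (λ N → Σ< N (shift l (g m))) (rearrange l (i ℕ.* l) m) ⟩
        Σ< (l ℕ.+ (suc m ℕ.+ i ℕ.* l)) (shift l (g m))
          ≡⟨ Σ<-shift l (suc m ℕ.+ i ℕ.* l) (g m) ⟩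
        Σ< (suc m ℕ.+ i ℕ.* l) (g m)
          ≡⟨ Σ<-extend (suc m) (i ℕ.* l) (λ k → g-> m k) ⟩
        Σ< (suc m) (g m)
          ≡⟨ shift-≥ (suc i ℕ.* l) (specialise g) m ⟨
        shift (suc i ℕ.* l) (specialise g) (suc i ℕ.* l ℕ.+ m) ∎
        where
        rearrange : ∀ x y z → suc (x ℕ.+ y ℕ.+ z) ≡ x ℕ.+ (suc z ℕ.+ y)
        rearrange x y z = trans (cong suc (trans (ℕ.+-assoc x y z) (cong (x ℕ.+_) (ℕ.+-comm y z)))) (sym (ℕ.+-suc x (z ℕ.+ y)))

    module _ (g : Array) (g-> : ∀ n k → n < k → g n k ≡ 0#) (g-0 : ∀ n → g n 0 ≡ one n) (a-0 : a 0 ≡ 1#)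
      (g-recursion : ∀ m k → g (m ℕ.+ k) k ≡ conv a (g m) k) where

      mult-0 : ∀ h m {k} → k < L → mult 0 h m k ≡ conv a (h m) k
      mult-0 h m {k} k<L = begin
        Σ< L (λ l → a l * shift l (h m) k)
          ≡⟨ Σ<-extend-≤ k<L (λ l k<l → trans (cong (a l *_) (shift-< l (h m) k<l)) (zeroʳ (a l))) ⟩
        Σ< (suc k) (λ l → a l * shift l (h m) k)
          ≡⟨ Σ<-cong (suc k) (λ { l (s≤s l≤k) → cong (a l *_) (trans (cong (shift l (h m)) (sym (ℕ.m+[n∸m]≡n l≤k))) (shift-≥ l (h m) (k ∸ l))) }) ⟩
        conv a (h m) k ∎

      -- In the columns k ≥ 1 the recursion makes g a fixed point of the step from `tower M` to
      -- `tower (suc M)`, and the entry (n , k) depends only on row n - k < n. Each step thus makes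
      -- one more row correct. In column 0 the recursion is vacuous, and agreement comes from `a-0`
      -- and `g-0`.
      tower-stable : ∀ M n k → n ≤ M → k < L → tower M n k ≡ g n k
      tower-stable zero .0 zero z≤n _ = trans (*-identityˡ 1#) (sym (g-0 0))
      tower-stable zero .0 (suc k) z≤n _ = trans (zeroʳ 1#) (sym (g-> 0 (suc k) (s≤s z≤n)))
      tower-stable (suc M) n zero n≤ 0<L = trans (tower-0 (suc M)) (sym (g-0 n))
        where
        tower-0 : ∀ M → tower M n 0 ≡ one n
        tower-0 zero = *-identityʳ (one n)
        tower-0 (suc M) = trans (mult-0 (tower M) n 0<L) (trans (+-identityʳ _)
          (trans (cong (_* tower M n 0) a-0) (trans (*-identityˡ _) (tower-0 M))))
      tower-stable (suc M) n k@(suc k′) n≤ k<L with k ℕ.≤? n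
      ... | no k≰n = trans (tower-> (suc M) n k (ℕ.≰⇒> k≰n)) (sym (g-> n k (ℕ.≰⇒> k≰n)))
      ... | yes k≤n = subst (λ n → tower (suc M) n k ≡ g n k) (ℕ.m+[n∸m]≡n k≤n) (begin
        shift k (λ n′ → mult 0 (tower M) n′ k) (k ℕ.+ m) ≡⟨ shift-≥ k (λ n′ → mult 0 (tower M) n′ k) m ⟩
        mult 0 (tower M) m k ≡⟨ mult-0 (tower M) m k<L ⟩
        conv a (tower M m) k ≡⟨ conv-congʳ a k (λ j j≤k → tower-stable M m j m≤M (ℕ.≤-trans (s≤s j≤k) k<L)) ⟩
        conv a (g m) k ≡⟨ g-recursion m k ⟨
        g (m ℕ.+ k) k ≡⟨ cong (λ n → g n k) (ℕ.+-comm m k) ⟩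
        g (k ℕ.+ m) k ∎)
        where
        m = n ∸ k
        m≤M : m ≤ M
        m≤M = ℕ.≤-trans (ℕ.∸-monoʳ-≤ {1} {k} n (s≤s z≤n)) (ℕ.∸-monoˡ-≤ 1 n≤)

  module _ (a : Seq) (g : Array) (g-> : ∀ n k → n < k → g n k ≡ 0#) (g-0 : ∀ n → g n 0 ≡ one n) (a-0 : a 0 ≡ 1#)
    (g-recursion : ∀ m k → g (m ℕ.+ k) k ≡ conv a (g m) k)
    (Π : ℕ → Seq) (Π-0 : ∀ n → Π 0 n ≡ one n) (Π-suc : ∀ M n → Π (suc M) n ≡ conv (Π M) (dilate (suc M) a) n) where

    Π≡tower : ∀ M {L n} → n < L → Π M n ≡ Σ< (suc n) (tower a L M n)
    Π≡tower zero {L} {n} n<L = trans (Π-0 n) (sym (trans (cong₂ _+_ (*-identityʳ (one n)) (Σ<-zero n λ k _ → zeroʳ (one n))) (+-identityʳ (one n))))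
    Π≡tower (suc M) {L} {n} n<L = begin
      Π (suc M) n
        ≡⟨ Π-suc M n ⟩
      conv (Π M) (dilate (suc M) a) n
        ≡⟨ conv-dilate M a (Π M) n<L ⟩
      Σ< L (λ l → a l * shift (suc M ℕ.* l) (Π M) n)
        ≡⟨ Σ<-cong L (λ l _ → cong (a l *_) (shift-cong (suc M ℕ.* l) n λ m e → Π≡tower M (ℕ.≤-trans (s≤s (subst (m ≤_) e (ℕ.m≤n+m m (suc M ℕ.* l)))) n<L))) ⟩
      Σ< L (λ l → a l * shift (suc M ℕ.* l) (specialise a L (tower a L M)) n)
        ≡⟨ specialise-mult a L M (tower a L M) n<L (tower-> a L M) ⟨
      specialise a L (mult a L (suc M) (tower a L M)) n
        ≡⟨ Σ<-cong (suc n) (λ k _ → tower-suc a L M n k) ⟨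
      specialise a L (tower a L (suc M)) n ∎

    -- The rows up to n of the tower are final after n factors, and the cut-off L = n + 1 does not
    -- affect them where k ≤ n.
    product-stable : ∀ M n → n ≤ M → Π M n ≡ Σ< (suc n) (g n)
    product-stable M n n≤M = trans (Π≡tower M (ℕ.n<1+n n))
      (Σ<-cong (suc n) λ k k<1+n → tower-stable a (suc n) g g-> g-0 a-0 g-recursion M n k n≤M k<1+n)

  -- Euler's expansion: with c s = 1 - xˢ and a_s = x a_{s-1} / (1 - xˢ), the coefficient of uˢ
  -- in ∏_{l ≤ M} 1 / (1 - xˡ u) is a_s (1 - x^M) ⋯ (1 - x^{M+s-1}).
  module Euler (x : R) (pw c a : Seq) (pw-0 : pw 0 ≡ 1#) (pw-suc : ∀ n → pw (suc n) ≡ x * pw n)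
    (c-pw : ∀ n → c n + pw n ≡ 1#) (a-0 : a 0 ≡ 1#) (a-suc : ∀ s → a (suc s) * c (suc s) ≡ a s * x) where

    rising : ℕ → Seq
    rising M zero = 1#
    rising M (suc s) = c M * rising (suc M) s

    coeff : ℕ → Seq
    coeff M s = a s * rising M s

    rising-0 : ∀ M → rising M 0 ≡ 1#
    rising-0 M = refl

    rising-suc : ∀ M s → rising M (suc s) ≡ c M * rising (suc M) s
    rising-suc M s = refl

    coeff-def : ∀ M s → coeff M s ≡ a s * rising M s
    coeff-def M s = refl

    pw-+ : ∀ m n → pw (m ℕ.+ n) ≡ pw m * pw n
    pw-+ zero n = sym (trans (cong (_* pw n) pw-0) (*-identityˡ (pw n)))
    pw-+ (suc m) n = trans (pw-suc (m ℕ.+ n)) (trans (cong (x *_) (pw-+ m n)) (trans (sym (*-assoc x _ _)) (cong (_* pw n) (sym (pw-suc m)))))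

    c-0 : c 0 ≡ 0#
    c-0 = +-cancelʳ (pw 0) (trans (c-pw 0) (sym (trans (+-identityˡ _) pw-0)))

    c-+ : ∀ m n → c (m ℕ.+ n) ≡ c m + (pw m * c n)
    c-+ m n = +-cancelʳ (pw (m ℕ.+ n)) (begin
      c (m ℕ.+ n) + pw (m ℕ.+ n) ≡⟨ c-pw (m ℕ.+ n) ⟩
      1# ≡⟨ c-pw m ⟨
      c m + pw m ≡⟨ cong (c m +_) (*-identityʳ (pw m)) ⟨
      c m + (pw m * 1#) ≡⟨ cong (λ y → c m + (pw m * y)) (c-pw n) ⟨
      c m + (pw m * (c n + pw n)) ≡⟨ solve 4 (λ d p e r → d :+ p :* (e :+ r) := (d :+ p :* e) :+ p :* r) refl (c m) (pw m) (c n) (pw n) ⟩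
      (c m + (pw m * c n)) + (pw m * pw n) ≡⟨ cong ((c m + (pw m * c n)) +_) (pw-+ m n) ⟨
      (c m + (pw m * c n)) + pw (m ℕ.+ n) ∎)

    rising-last : ∀ M s → rising M (suc s) ≡ rising M s * c (M ℕ.+ s)
    rising-last M zero = trans (*-comm (c M) 1#) (cong (λ m → 1# * c m) (sym (ℕ.+-identityʳ M)))
    rising-last M (suc s) = trans (cong (c M *_) (rising-last (suc M) s)) (trans (sym (*-assoc (c M) _ _))
      (cong (λ m → rising M (suc s) * c m) (sym (ℕ.+-suc M s))))

    -- For s > 0 the product `rising 0 s` begins with c 0 = 0.
    coeff-0 : ∀ s → coeff 0 s ≡ one s
    coeff-0 zero = trans (*-identityʳ (a 0)) a-0
    coeff-0 (suc s) = trans (cong (λ y → a (suc s) * (y * rising 1 s)) c-0) (trans (cong (a (suc s) *_) (zeroˡ _)) (zeroʳ (a (suc s))))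

    -- This is (1 - x^{M+1} u) Π_{M+1} = Π_M in coefficients. The last factor of `rising` splits as
    -- c (M + s + 1) = c M + x^M c (s + 1): the first summand restores `coeff M`, the second becomes
    -- the shifted term by `a-suc`.
    coeff-suc : ∀ M s → coeff (suc M) s ≡ coeff M s + (pw (suc M) * shift 1 (coeff (suc M)) s)
    coeff-suc M zero = sym (trans (cong (coeff M 0 +_) (zeroʳ (pw (suc M)))) (+-identityʳ _))
    coeff-suc M (suc s) = begin
      a (suc s) * rising (suc M) (suc s)
        ≡⟨ cong (a (suc s) *_) (trans (rising-last (suc M) s) (cong (ρ *_) (trans (cong c (sym (ℕ.+-suc M s))) (c-+ M (suc s))))) ⟩
      a (suc s) * (ρ * (c M + (pw M * c (suc s))))
        ≡⟨ solve 5 (λ α ρ d p e → α :* (ρ :* (d :+ p :* e)) := α :* (d :* ρ) :+ (p :* (α :* e)) :* ρ) refl (a (suc s)) ρ (c M) (pw M) (c (suc s)) ⟩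
      (a (suc s) * (c M * ρ)) + ((pw M * (a (suc s) * c (suc s))) * ρ)
        ≡⟨ cong (λ y → (a (suc s) * (c M * ρ)) + ((pw M * y) * ρ)) (a-suc s) ⟩
      (a (suc s) * (c M * ρ)) + ((pw M * (a s * x)) * ρ)
        ≡⟨ cong ((a (suc s) * (c M * ρ)) +_) (trans (solve 4 (λ p α x ρ → (p :* (α :* x)) :* ρ := (x :* p) :* (α :* ρ)) refl (pw M) (a s) x ρ)
             (cong (_* (a s * ρ)) (sym (pw-suc M)))) ⟩
      coeff M (suc s) + (pw (suc M) * coeff (suc M) s) ∎
      where ρ = rising (suc M) s

    -- Substituting u^{i+1} for u in `coeff-suc` shows that the dilation obeys the same equation as
    -- the partial product, and `geometric-unique` identifies the two solutions.
    partial-product : ∀ i (Π : ℕ → Seq) → (∀ n → Π 0 n ≡ one n) →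
      (∀ M n → Π (suc M) n ≡ Π M n + (pw (suc M) * shift (suc i) (Π (suc M)) n)) → ∀ M n → Π M n ≡ dilate (suc i) (coeff M) n
    partial-product i Π Π-0 Π-suc zero n = trans (Π-0 n) (sym (trans
      (cong₂ _+_ (trans (cong₂ _*_ (coeff-0 0) (cong (λ e → shift e one n) (ℕ.*-zeroʳ (suc i)))) (*-identityˡ (one n)))
        (Σ<-zero n λ l _ → trans (cong (_* shift (suc i ℕ.* suc l) one n) (coeff-0 (suc l))) (zeroˡ _))) (+-identityʳ (one n))))
    partial-product i Π Π-0 Π-suc (suc M) = geometric-unique i (pw (suc M)) (Π M) _ _ (Π-suc M) (λ n → begin
      dilate (suc i) (coeff (suc M)) n
        ≡⟨ dilate-lin (suc i) (pw (suc M)) _ (coeff M) (shift 1 (coeff (suc M))) (coeff-suc M) n ⟩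
      dilate (suc i) (coeff M) n + (pw (suc M) * dilate (suc i) (shift 1 (coeff (suc M))) n)
        ≡⟨ cong₂ (λ y z → y + (pw (suc M) * z)) (sym (partial-product i Π Π-0 Π-suc M n)) (dilate-shift i (coeff (suc M)) n) ⟩
      Π M n + (pw (suc M) * shift (suc i) (dilate (suc i) (coeff (suc M))) n) ∎)

-- Dividing by group orders: the recursions for the quotients

module Ratio {R : Set} (_+_ _*_ : R → R → R) (-_ : R → R) (0# 1# : R)
  (isRing : IsCommutativeRing _≡_ _+_ _*_ -_ 0# 1#)
  (ι : ℕ → R) (ι-0 : ι 0 ≡ 0#) (ι-1 : ι 1 ≡ 1#)
  (ι-+ : ∀ m n → ι (m ℕ.+ n) ≡ ι m + ι n) (ι-* : ∀ m n → ι (m ℕ.* n) ≡ ι m * ι n)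
  (𝔽 : FiniteSkewField) (Nil? : ∀ {n} (A : Powers.Mat 𝔽 n n) → Dec (Powers.Nil 𝔽 A))
  (ρ : ℕ → R) (gl*ρ : ∀ n → ι (RankRecursions.gl 𝔽 Nil? n) * ρ n ≡ 1#)
  (x : R) (q*x : ι (RankRecursions.q 𝔽 Nil?) * x ≡ 1#) where

  open RankRecursions 𝔽 Nil?
  open PowerSeriesAlgebra _+_ _*_ -_ 0# 1# isRing public
  open ≡-Reasoning

  pw : Seq
  pw zero = 1#
  pw (suc n) = x * pw n

  pw-0 : pw 0 ≡ 1#
  pw-0 = refl

  pw-suc : ∀ n → pw (suc n) ≡ x * pw n
  pw-suc n = refl

  pw-+ : ∀ m n → pw (m ℕ.+ n) ≡ pw m * pw n
  pw-+ zero n = sym (*-identityˡ (pw n))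
  pw-+ (suc m) n = trans (cong (x *_) (pw-+ m n)) (sym (*-assoc x _ _))

  q^*pw : ∀ n → ι (q ℕ.^ n) * pw n ≡ 1#
  q^*pw zero = trans (*-identityʳ _) ι-1
  q^*pw (suc n) = begin
    ι (q ℕ.* q ℕ.^ n) * (x * pw n) ≡⟨ cong (_* (x * pw n)) (ι-* q (q ℕ.^ n)) ⟩
    (ι q * ι (q ℕ.^ n)) * (x * pw n) ≡⟨ solve 4 (λ a b c d → (a :* b) :* (c :* d) := (a :* c) :* (b :* d)) refl (ι q) (ι (q ℕ.^ n)) x (pw n) ⟩
    (ι q * x) * (ι (q ℕ.^ n) * pw n) ≡⟨ cong₂ _*_ q*x (q^*pw n) ⟩
    1# * 1# ≡⟨ *-identityˡ 1# ⟩
    1# ∎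

  γ : Seq
  γ n = ι (gl n)

  ι-∑< : ∀ n f → ι (∑< n f) ≡ Σ< n (ι ∘ f)
  ι-∑< zero f = ι-0
  ι-∑< (suc n) f = trans (ι-+ (f 0) _) (cong (ι (f 0) +_) (ι-∑< n (f ∘ suc)))

  cross-multiply : ∀ {X Y c c′ d d′} → X * d ≡ c * Y → c * c′ ≡ 1# → d * d′ ≡ 1# → X * c′ ≡ Y * d′
  cross-multiply {X} {Y} {c} {c′} {d} {d′} e cc′ dd′ = begin
    X * c′ ≡⟨ *-identityʳ _ ⟨
    (X * c′) * 1# ≡⟨ cong ((X * c′) *_) dd′ ⟨
    (X * c′) * (d * d′) ≡⟨ solve 4 (λ X c′ d d′ → (X :* c′) :* (d :* d′) := (X :* d) :* (c′ :* d′)) refl X c′ d d′ ⟩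
    (X * d) * (c′ * d′) ≡⟨ cong (_* (c′ * d′)) e ⟩
    (c * Y) * (c′ * d′) ≡⟨ solve 4 (λ c Y c′ d′ → (c :* Y) :* (c′ :* d′) := (c :* c′) :* (Y :* d′)) refl c Y c′ d′ ⟩
    (c * c′) * (Y * d′) ≡⟨ cong (_* (Y * d′)) cc′ ⟩
    1# * (Y * d′) ≡⟨ *-identityˡ _ ⟩
    Y * d′ ∎

  -- The inverse of the order of the stabiliser counted in `parabolic`.
  weight⁻¹ : ℕ → ℕ → R
  weight⁻¹ m k = (pw (k ℕ.* m) * ρ m) * ρ k

  weight*weight⁻¹ : ∀ m k → ι (q ℕ.^ (k ℕ.* m) ℕ.* gl m ℕ.* gl k) * weight⁻¹ m k ≡ 1#
  weight*weight⁻¹ m k = begin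
    ι (q ℕ.^ (k ℕ.* m) ℕ.* gl m ℕ.* gl k) * weight⁻¹ m k
      ≡⟨ cong (_* weight⁻¹ m k) (trans (ι-* _ (gl k)) (cong (_* γ k) (ι-* _ (gl m)))) ⟩
    ((Q * γ m) * γ k) * ((P * ρ m) * ρ k)
      ≡⟨ solve 6 (λ a b c d e f → ((a :* b) :* c) :* ((d :* e) :* f) := ((a :* d) :* (b :* e)) :* (c :* f)) refl Q (γ m) (γ k) P (ρ m) (ρ k) ⟩
    ((Q * P) * (γ m * ρ m)) * (γ k * ρ k)
      ≡⟨ cong₂ _*_ (trans (cong₂ _*_ (q^*pw (k ℕ.* m)) (gl*ρ m)) (*-identityˡ 1#)) (gl*ρ k) ⟩
    1# * 1#
      ≡⟨ *-identityˡ 1# ⟩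
    1# ∎
    where
    Q = ι (q ℕ.^ (k ℕ.* m))
    P = pw (k ℕ.* m)

  recursion-ratio : ∀ m k N f → N ℕ.* (q ℕ.^ (k ℕ.* m) ℕ.* gl m ℕ.* gl k) ≡ gl (m ℕ.+ k) ℕ.* ∑< (suc m) f →
    ι N * ρ (m ℕ.+ k) ≡ Σ< (suc m) (λ j → ι (f j) * weight⁻¹ m k)
  recursion-ratio m k N f e = trans
    (cross-multiply {d = ι (q ℕ.^ (k ℕ.* m) ℕ.* gl m ℕ.* gl k)} (trans (sym (ι-* N _)) (trans (cong ι e) (ι-* (gl (m ℕ.+ k)) _)))
      (gl*ρ (m ℕ.+ k)) (weight*weight⁻¹ m k))
    (trans (cong (_* weight⁻¹ m k) (ι-∑< (suc m) f)) (sym (Σ<-*ʳ (suc m) (weight⁻¹ m k) (ι ∘ f))))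

  nilRatio : Seq
  nilRatio l = ι (nil l) * ρ l

  ratio : (∀ {n} → Mat n n → ℕ) → Array
  ratio f n k = ι (corankSum n f k) * ρ n

  ratio-> : ∀ (f : ∀ {n} → Mat n n → ℕ) n k → n < k → ratio f n k ≡ 0#
  ratio-> f n k n<k = trans (cong (_* ρ n) (trans (cong ι (corankSum-> n f k n<k)) ι-0)) (zeroˡ (ρ n))

  ρ-0 : ρ 0 ≡ 1#
  ρ-0 = trans (sym (*-identityˡ (ρ 0))) (trans (cong (_* ρ 0) (sym (trans (cong ι gl-0) ι-1))) (gl*ρ 0))

  ratio-0-0 : ∀ (f : ∀ {n} → Mat n n → ℕ) → f (𝟘 {0} {0}) ≡ 1 → ratio f 0 0 ≡ 1#
  ratio-0-0 f e = trans (cong₂ _*_ (trans (cong ι (trans (corankSum-0×0 f) e)) ι-1) ρ-0) (*-identityˡ 1#)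

  ratio-total : ∀ (f : ∀ {n} → Mat n n → ℕ) n → ι (∑ (mats n n) f) * ρ n ≡ Σ< (suc n) (ratio f n)
  ratio-total f n = trans (cong (λ N → ι N * ρ n) (∑-by-corank n f))
    (trans (cong (_* ρ n) (ι-∑< (suc n) (corankSum n f))) (sym (Σ<-*ʳ (suc n) (ρ n) (λ k → ι (corankSum n f k)))))

  pairRatio : Array
  pairRatio = ratio pairWeight

  nilRatio-0 : nilRatio 0 ≡ 1#
  nilRatio-0 = trans (cong₂ _*_ (trans (cong ι nil-0) ι-1) ρ-0) (*-identityˡ 1#)

  pairRatio-0 : ∀ n → pairRatio n 0 ≡ one n
  pairRatio-0 zero = ratio-0-0 pairWeight (cong₂ ℕ._*_ (Nil?-𝟘 0) centraliser-0×0)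
  pairRatio-0 (suc n) = trans (cong (_* ρ (suc n)) (trans (cong ι (corankSum-nil-0 n centraliser)) ι-0)) (zeroˡ _)

  pairRatio-recursion : ∀ m k → pairRatio (m ℕ.+ k) k ≡ conv nilRatio (pairRatio m) k
  pairRatio-recursion m k = begin
    pairRatio (m ℕ.+ k) k
      ≡⟨ recursion-ratio m k _ (corankSum m (pairExtensions m k)) (pair-recursion m k) ⟩
    Σ< (suc m) (λ j → ι (corankSum m (pairExtensions m k) j) * weight⁻¹ m k)
      ≡⟨ Σ<-cong (suc m) (λ { j (s≤s j≤m) → term j j≤m }) ⟩
    Σ< (suc m) φ
      ≡⟨ Σ<-extend (suc m) (suc k) (λ j m<j → φ->m j m<j) ⟨
    Σ< (suc m ℕ.+ suc k) φ
      ≡⟨ cong (λ N → Σ< N φ) (ℕ.+-comm (suc m) (suc k)) ⟩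
    Σ< (suc k ℕ.+ suc m) φ
      ≡⟨ Σ<-extend (suc k) (suc m) (λ j k<j → φ->k j k<j) ⟩
    Σ< (suc k) φ
      ≡⟨ Σ<-cong (suc k) (λ { j (s≤s j≤k) → φ-≤ j j≤k }) ⟩
    Σ< (suc k) (λ j → nilRatio (k ∸ j) * pairRatio m j)
      ≡⟨ conv-flip nilRatio (pairRatio m) k ⟨
    conv nilRatio (pairRatio m) k ∎
    where
    -- The count sums over j ≤ m, the convolution over j ≤ k. Extended by zero beyond k, the summand
    -- vanishes past either bound, so both sums equal the one over m + k + 2 terms.
    φ : Seq
    φ j with j ℕ.≤? k
    ... | yes _ = nilRatio (k ∸ j) * pairRatio m j
    ... | no _ = 0#
    φ-≤ : ∀ j → j ≤ k → φ j ≡ nilRatio (k ∸ j) * pairRatio m j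
    φ-≤ j j≤k with j ℕ.≤? k
    ... | yes _ = refl
    ... | no j≰k = contradiction j≤k j≰k
    φ->k : ∀ j → k < j → φ j ≡ 0#
    φ->k j k<j with j ℕ.≤? k
    ... | yes j≤k = contradiction k<j (ℕ.≤⇒≯ j≤k)
    ... | no _ = refl
    φ->m : ∀ j → m < j → φ j ≡ 0#
    φ->m j m<j with j ℕ.≤? k
    ... | yes _ = trans (cong (nilRatio (k ∸ j) *_) (ratio-> pairWeight m j m<j)) (zeroʳ _)
    ... | no _ = refl
    scale : ∀ l j → j ≤ m → j ℕ.+ l ≡ k → ι (corankSum m (pairExtensions m k) j) * weight⁻¹ m k ≡ nilRatio l * pairRatio m j
    scale l j j≤m refl = begin
      T * weight⁻¹ m k
        -- Inserting 1 = γ l · ρ l supplies the factor `gl l` that `pairExtensions-≤` expects in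
        -- front of the count.
        ≡⟨ trans (sym (*-identityˡ _)) (cong (_* (T * weight⁻¹ m k)) (sym (gl*ρ l))) ⟩
      (γ l * ρ l) * (T * weight⁻¹ m k)
        ≡⟨ solve 4 (λ g r t w → (g :* r) :* (t :* w) := (g :* t) :* (r :* w)) refl (γ l) (ρ l) T (weight⁻¹ m k) ⟩
      (γ l * T) * (ρ l * weight⁻¹ m k)
        ≡⟨ cong (_* (ρ l * weight⁻¹ m k)) (trans (sym (ι-* (gl l) _)) (trans (cong ι (pairExtensions-≤ m j l j≤m))
             (trans (ι-* _ G) (cong (_* ι G) (trans (ι-* _ (nil l)) (cong (_* ι (nil l)) (ι-* (q ℕ.^ (k ℕ.* m)) (gl k)))))))) ⟩
      (((Q * γ k) * ι (nil l)) * ι G) * (ρ l * ((P * ρ m) * ρ k))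
        ≡⟨ solve 8 (λ Q γk N G ρl P ρm ρk → (((Q :* γk) :* N) :* G) :* (ρl :* ((P :* ρm) :* ρk)) := ((Q :* P) :* (γk :* ρk)) :* ((N :* ρl) :* (G :* ρm)))
             refl Q (γ k) (ι (nil l)) (ι G) (ρ l) P (ρ m) (ρ k) ⟩
      ((Q * P) * (γ k * ρ k)) * (nilRatio l * pairRatio m j)
        ≡⟨ cong (_* (nilRatio l * pairRatio m j)) (trans (cong₂ _*_ (q^*pw (k ℕ.* m)) (gl*ρ k)) (*-identityˡ 1#)) ⟩
      1# * (nilRatio l * pairRatio m j)
        ≡⟨ *-identityˡ _ ⟩
      nilRatio l * pairRatio m j ∎
      where
      T = ι (corankSum m (pairExtensions m k) j)
      G = corankSum m pairWeight j
      Q = ι (q ℕ.^ (k ℕ.* m))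
      P = pw (k ℕ.* m)
    term : ∀ j → j ≤ m → ι (corankSum m (pairExtensions m k) j) * weight⁻¹ m k ≡ φ j
    term j j≤m with j ℕ.≤? k
    ... | no j≰k = trans (cong (_* weight⁻¹ m k) (trans (cong ι (pairExtensions-> m k j (ℕ.≰⇒> j≰k) j≤m)) ι-0)) (zeroˡ _)
    ... | yes j≤k = scale (k ∸ j) j j≤m (ℕ.m+[n∸m]≡n j≤k)

  -- The coefficient does not involve m: of x^{km}, the part x^{k(m-j)} cancels against q^{k(m-j)}
  -- and x^{kj} stays. This makes the recursions for sizes m and m + 1 comparable in `allRatio-suc`.
  restriction : ℕ → ℕ → R
  restriction k j = (pw (k ℕ.* j) * ι (surj j k)) * ρ k

  ratio-recursion : (f : ∀ {n} → Mat n n → ℕ) → (∀ {n} → ConjugationInvariant {n} f) →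
    (∀ {m k} (A : Mat m m) (Y : Mat m k) → f (block A Y 𝟘 𝟘) ≡ f A) →
    ∀ m k → ratio f (m ℕ.+ k) k ≡ Σ< (suc m) (λ j → ratio f m j * restriction k j)
  ratio-recursion f f-conj f-block m k = trans
    (recursion-ratio m k _ (λ j → corankSum m f j ℕ.* (q ℕ.^ (k ℕ.* (m ∸ j)) ℕ.* surj j k)) (corankSum-recursion f f-conj f-block m k))
    (Σ<-cong (suc m) λ { j (s≤s j≤m) → begin
      ι (corankSum m f j ℕ.* (q ℕ.^ (k ℕ.* (m ∸ j)) ℕ.* surj j k)) * weight⁻¹ m k
        ≡⟨ cong₂ _*_ (trans (ι-* (corankSum m f j) _) (cong (ι (corankSum m f j) *_) (ι-* _ (surj j k))))
             (cong (λ p → (p * ρ m) * ρ k) (trans (cong pw (trans (cong (k ℕ.*_) (sym (ℕ.m∸n+n≡m j≤m))) (ℕ.*-distribˡ-+ k (m ∸ j) j))) (pw-+ (k ℕ.* (m ∸ j)) (k ℕ.* j)))) ⟩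
      (ι (corankSum m f j) * (Q j * ι (surj j k))) * (((P j * pw (k ℕ.* j)) * ρ m) * ρ k)
        ≡⟨ solve 7 (λ S Q s P p ρm ρk → (S :* (Q :* s)) :* (((P :* p) :* ρm) :* ρk) := (Q :* P) :* ((S :* ρm) :* ((p :* s) :* ρk)))
             refl (ι (corankSum m f j)) (Q j) (ι (surj j k)) (P j) (pw (k ℕ.* j)) (ρ m) (ρ k) ⟩
      (Q j * P j) * (ratio f m j * restriction k j)
        ≡⟨ trans (cong (_* (ratio f m j * restriction k j)) (q^*pw (k ℕ.* (m ∸ j)))) (*-identityˡ _) ⟩
      ratio f m j * restriction k j ∎ })
    where
    Q P : ℕ → R
    Q j = ι (q ℕ.^ (k ℕ.* (m ∸ j)))
    P j = pw (k ℕ.* (m ∸ j))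

  allRatio nilRankRatio : Array
  allRatio = ratio (λ _ → 1)
  nilRankRatio = ratio nilWeight

  allRatio-recursion : ∀ m k → allRatio (m ℕ.+ k) k ≡ Σ< (suc m) (λ j → allRatio m j * restriction k j)
  allRatio-recursion = ratio-recursion (λ _ → 1) (λ _ _ → refl) (λ _ _ → refl)

  nilRankRatio-recursion : ∀ m k → nilRankRatio (m ℕ.+ k) k ≡ Σ< (suc m) (λ j → nilRankRatio m j * restriction k j)
  nilRankRatio-recursion = ratio-recursion nilWeight Nil?-conj nilWeight-block

  allRatio-0 : ∀ n → allRatio n 0 ≡ 1#
  allRatio-0 n = trans (cong (λ N → ι N * ρ n) (corankSum-0 n)) (gl*ρ n)

  nilRankRatio-suc-0 : ∀ n → nilRankRatio (suc n) 0 ≡ 0#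
  nilRankRatio-suc-0 n = trans (cong (_* ρ (suc n)) (trans (cong ι (trans
    (∑-cong (mats (suc n) (suc n)) λ A → cong (⟦ ν A ℕ.≟ 1 ⟧ ℕ.*_) (sym (ℕ.*-identityʳ ⟦ Nil? A ⟧)))
    (corankSum-nil-0 n (λ _ → 1)))) ι-0)) (zeroˡ _)

  -- Both families satisfy the same recursion, which is linear; their differences start the same way.
  allRatio-suc : ∀ n k → allRatio (suc n) k ≡ allRatio n k + nilRankRatio (suc n) k
  allRatio-suc n = go (suc n) n (ℕ.n<1+n n)
    where
    go : ∀ b n → n < b → ∀ k → allRatio (suc n) k ≡ allRatio n k + nilRankRatio (suc n) k
    step : ∀ b n k m → m ℕ.+ suc k ≡ suc n → n < suc b → allRatio (suc n) (suc k) ≡ allRatio n (suc k) + nilRankRatio (suc n) (suc k)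
    -- In size k + 1 and corank k + 1 both recursions reduce to the 0 × 0 matrix, where the two
    -- ratios agree, and in size k there is no matrix of corank k + 1.
    step b .k k zero refl _ = begin
      allRatio (suc k) (suc k)
        ≡⟨ allRatio-recursion 0 (suc k) ⟩
      (allRatio 0 0 * restriction (suc k) 0) + 0#
        ≡⟨ cong (λ z → (z * restriction (suc k) 0) + 0#) (trans (ratio-0-0 (λ _ → 1) refl) (sym (ratio-0-0 nilWeight (Nil?-𝟘 0)))) ⟩
      (nilRankRatio 0 0 * restriction (suc k) 0) + 0#
        ≡⟨ nilRankRatio-recursion 0 (suc k) ⟨
      nilRankRatio (suc k) (suc k)
        ≡⟨ +-identityˡ _ ⟨
      0# + nilRankRatio (suc k) (suc k)
        ≡⟨ cong (_+ nilRankRatio (suc k) (suc k)) (ratio-> (λ _ → 1) k (suc k) (ℕ.n<1+n k)) ⟨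
      allRatio k (suc k) + nilRankRatio (suc k) (suc k) ∎
    -- The values for size m + 1 split by induction. As `restriction` is independent of the size,
    -- the two parts refold into the recursions starting from sizes m and m + 1.
    step b .(m ℕ.+ suc k) k (suc m) refl (s≤s n≤b) = begin
      allRatio (suc m ℕ.+ suc k) (suc k)
        ≡⟨ allRatio-recursion (suc m) (suc k) ⟩
      Σ< (suc (suc m)) (λ j → allRatio (suc m) j * w j)
        ≡⟨ Σ<-cong (suc (suc m)) (λ j _ → trans (cong (_* w j) (go b m m<b j)) (distribʳ (w j) _ _)) ⟩
      Σ< (suc (suc m)) (λ j → (allRatio m j * w j) + (nilRankRatio (suc m) j * w j))
        ≡⟨ Σ<-+ (suc (suc m)) (λ j → allRatio m j * w j) (λ j → nilRankRatio (suc m) j * w j) ⟩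
      Σ< (suc (suc m)) (λ j → allRatio m j * w j) + Σ< (suc (suc m)) (λ j → nilRankRatio (suc m) j * w j)
        ≡⟨ cong₂ _+_ (trans (Σ<-extend-≤ (ℕ.n≤1+n (suc m)) λ j m<j → trans (cong (_* w j) (ratio-> (λ _ → 1) m j m<j)) (zeroˡ (w j)))
             (sym (allRatio-recursion m (suc k)))) (sym (nilRankRatio-recursion (suc m) (suc k))) ⟩
      allRatio (m ℕ.+ suc k) (suc k) + nilRankRatio (suc m ℕ.+ suc k) (suc k) ∎
      where
      w = restriction (suc k)
      m<b : m < b
      m<b = ℕ.≤-trans (subst (suc m ≤_) (sym (ℕ.+-suc m k)) (s≤s (ℕ.m≤m+n m k))) n≤b
    go (suc b) n n<b zero = trans (allRatio-0 (suc n)) (sym (trans (cong₂ _+_ (allRatio-0 n) (nilRankRatio-suc-0 n)) (+-identityʳ 1#)))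
    go (suc b) n n<b (suc k) with suc k ℕ.≤? suc n
    ... | yes k≤n = step b n k (n ∸ k) (ℕ.m∸n+n≡m k≤n) n<b
    ... | no k≰n = trans (ratio-> (λ _ → 1) (suc n) (suc k) n<k) (sym (trans
        (cong₂ _+_ (ratio-> (λ _ → 1) n (suc k) (ℕ.<-trans (ℕ.n<1+n n) n<k)) (ratio-> nilWeight (suc n) (suc k) n<k)) (+-identityˡ 0#)))
      where n<k = ℕ.≰⇒> k≰n

  total : Seq
  total n = ι (q ℕ.^ (n ℕ.* n)) * ρ n

  total≡ : ∀ n → total n ≡ Σ< (suc n) (allRatio n)
  total≡ n = trans (cong (λ N → ι N * ρ n) (trans (sym (card-mats n n)) (trans (sym (trans (∑-const (mats n n) 1) (ℕ.*-identityʳ _)))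
    refl))) (ratio-total (λ _ → 1) n)

  nilRatio≡ : ∀ n → nilRatio n ≡ Σ< (suc n) (nilRankRatio n)
  nilRatio≡ = ratio-total nilWeight

  total-suc : ∀ n → total (suc n) ≡ total n + nilRatio (suc n)
  total-suc n = begin
    total (suc n) ≡⟨ total≡ (suc n) ⟩
    Σ< (suc (suc n)) (allRatio (suc n)) ≡⟨ Σ<-cong (suc (suc n)) (λ k _ → allRatio-suc n k) ⟩
    Σ< (suc (suc n)) (λ k → allRatio n k + nilRankRatio (suc n) k) ≡⟨ Σ<-+ (suc (suc n)) (allRatio n) (nilRankRatio (suc n)) ⟩
    Σ< (suc (suc n)) (allRatio n) + Σ< (suc (suc n)) (nilRankRatio (suc n)) ≡⟨ cong₂ _+_
      (trans (Σ<-extend-≤ (ℕ.n≤1+n (suc n)) λ k n<k → ratio-> (λ _ → 1) n k n<k) (sym (total≡ n))) (sym (nilRatio≡ (suc n))) ⟩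
    total n + nilRatio (suc n) ∎

  -- `gl-suc` in terms of quotients: q^{s+1} total(s) = (q^{s+1} - 1) total(s + 1), with the
  -- subtraction moved across.
  total-q : ∀ s → (ι (q ℕ.^ suc s) * total s) + total (suc s) ≡ ι (q ℕ.^ suc s) * total (suc s)
  total-q s = begin
    (Q * (B * r)) + (ι (q ℕ.^ (suc s ℕ.* suc s)) * r′)
      ≡⟨ cong₂ (λ u v → u + (v * r′)) (trans (sym (*-identityʳ _)) (cong ((Q * (B * r)) *_) (sym (gl*ρ (suc s))))) square ⟩
    ((Q * (B * r)) * (g′ * r′)) + ((B * (U * Q)) * r′)
      ≡⟨ cong (((Q * (B * r)) * (g′ * r′)) +_) (trans (sym (*-identityʳ _)) (cong (((B * (U * Q)) * r′) *_) (sym (gl*ρ s)))) ⟩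
    ((Q * (B * r)) * (g′ * r′)) + (((B * (U * Q)) * r′) * (g * r))
      ≡⟨ solve 7 (λ Q B r g′ r′ U g → (Q :* (B :* r)) :* (g′ :* r′) :+ ((B :* (U :* Q)) :* r′) :* (g :* r) := ((Q :* B) :* (r :* r′)) :* (g′ :+ U :* g))
           refl Q B r g′ r′ U g ⟩
    ((Q * B) * (r * r′)) * (g′ + (U * g))
      ≡⟨ cong (((Q * B) * (r * r′)) *_) (trans (sym (trans (ι-+ (gl (suc s)) _) (cong (g′ +_) (ι-* (q ℕ.^ s) (gl s)))))
           (trans (cong ι (gl-suc s)) (trans (ι-* (q ℕ.^ suc s) _) (cong (Q *_) (ι-* (q ℕ.^ s) (gl s)))))) ⟩
    ((Q * B) * (r * r′)) * (Q * (U * g))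
      ≡⟨ solve 6 (λ Q B r r′ U g → ((Q :* B) :* (r :* r′)) :* (Q :* (U :* g)) := (g :* r) :* (Q :* ((B :* (U :* Q)) :* r′))) refl Q B r r′ U g ⟩
    (g * r) * (Q * ((B * (U * Q)) * r′))
      ≡⟨ trans (cong (_* (Q * ((B * (U * Q)) * r′))) (gl*ρ s)) (*-identityˡ _) ⟩
    Q * ((B * (U * Q)) * r′)
      ≡⟨ cong (λ v → Q * (v * r′)) square ⟨
    Q * (ι (q ℕ.^ (suc s ℕ.* suc s)) * r′) ∎
    where
    Q = ι (q ℕ.^ suc s)
    U = ι (q ℕ.^ s)
    B = ι (q ℕ.^ (s ℕ.* s))
    g = γ s
    g′ = γ (suc s)
    r = ρ s
    r′ = ρ (suc s)
    square : ι (q ℕ.^ (suc s ℕ.* suc s)) ≡ B * (U * Q)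
    square = trans (cong ι (trans (cong (q ℕ.^_) (expand s)) (trans (ℕ.^-distribˡ-+-* q (s ℕ.* s) _) (cong (q ℕ.^ (s ℕ.* s) ℕ.*_) (ℕ.^-distribˡ-+-* q s (suc s))))))
      (trans (ι-* (q ℕ.^ (s ℕ.* s)) _) (cong (B *_) (ι-* (q ℕ.^ s) _)))
      where
      expand : ∀ s → suc s ℕ.* suc s ≡ s ℕ.* s ℕ.+ (s ℕ.+ suc s)
      expand = +-*-Solver.solve 1 (λ s → (con 1 ⊞ s) ⊠ (con 1 ⊞ s) ⊜ s ⊠ s ⊞ (s ⊞ (con 1 ⊞ s))) refl
        where open +-*-Solver using (con) renaming (_:+_ to _⊞_; _:*_ to _⊠_; _:=_ to _⊜_)

  -- The theorem of Fine and Herstein that there are q^{s² - s} nilpotent s × s matrices.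
  fine-herstein : ∀ s → total s ≡ ι (q ℕ.^ s) * nilRatio s
  fine-herstein zero = trans (trans (cong₂ _*_ ι-1 ρ-0) (*-identityˡ 1#)) (sym (trans (cong₂ _*_ ι-1 nilRatio-0) (*-identityˡ 1#)))
  -- Multiplying `total-suc` by q^{s+1} and comparing with `total-q` leaves the claim once the
  -- common summand q^{s+1} total(s) is cancelled.
  fine-herstein (suc s) = +-cancelʳ (ι (q ℕ.^ suc s) * total s) (trans (+-comm _ _) (trans (total-q s)
    (trans (cong (ι (q ℕ.^ suc s) *_) (total-suc s)) (trans (distribˡ _ _ _) (+-comm _ _)))))

  c : Seq
  c n = 1# + (- pw n)

  c-def : ∀ n → c n ≡ 1# + (- pw n)
  c-def n = refl

  c-pw : ∀ n → c n + pw n ≡ 1#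
  c-pw n = trans (+-assoc 1# _ _) (trans (cong (1# +_) (-‿inverseˡ (pw n))) (+-identityʳ 1#))

  -- Writing both totals in `total-q` by `fine-herstein` and dividing by q^{2(s+1)} gives x a_s +
  -- x^{s+1} a_{s+1} = a_{s+1}. This is the relation `a-suc` needed for Euler's expansion.
  nilRatio-suc : ∀ s → nilRatio (suc s) * c (suc s) ≡ nilRatio s * x
  nilRatio-suc s = +-cancelʳ (a′ * pw (suc s)) (begin
    (a′ * c (suc s)) + (a′ * pw (suc s)) ≡⟨ distribˡ a′ _ _ ⟨
    a′ * (c (suc s) + pw (suc s)) ≡⟨ cong (a′ *_) (c-pw (suc s)) ⟩
    a′ * 1# ≡⟨ *-identityʳ a′ ⟩
    a′ ≡⟨ unscale a′ ⟨
    p * (Q * a′) ≡⟨ unscale (p * (Q * a′)) ⟨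
    p * (Q * (p * (Q * a′))) ≡⟨ solve 3 (λ p Q a → p :* (Q :* (p :* (Q :* a))) := (p :* p) :* (Q :* (Q :* a))) refl p Q a′ ⟩
    (p * p) * (Q * (Q * a′)) ≡⟨ cong ((p * p) *_) (trans (cong (Q *_) (sym (fine-herstein (suc s)))) (trans (sym (total-q s))
                                                 (cong₂ (λ u v → (Q * u) + v) (fine-herstein s) (fine-herstein (suc s))))) ⟩
    (p * p) * ((Q * (U * a)) + (Q * a′)) ≡⟨ solve 5 (λ p Q U a a′ → (p :* p) :* (Q :* (U :* a) :+ Q :* a′) := (p :* (Q :* ((p :* U) :* a))) :+ (p :* (Q :* (p :* a′)))) refl p Q U a a′ ⟩
    (p * (Q * ((p * U) * a))) + (p * (Q * (p * a′))) ≡⟨ cong₂ _+_ (unscale _) (unscale _) ⟩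
    ((p * U) * a) + (p * a′) ≡⟨ cong₂ _+_ (trans (cong (_* a) pU) (*-comm x a)) (*-comm p a′) ⟩
    (a * x) + (a′ * pw (suc s)) ∎)
    where
    a = nilRatio s
    a′ = nilRatio (suc s)
    p = pw (suc s)
    Q = ι (q ℕ.^ suc s)
    U = ι (q ℕ.^ s)
    unscale : ∀ z → p * (Q * z) ≡ z
    unscale z = trans (sym (*-assoc p Q z)) (trans (cong (_* z) (trans (*-comm p Q) (q^*pw (suc s)))) (*-identityˡ z))
    pU : p * U ≡ x
    pU = trans (*-assoc x (pw s) U) (trans (cong (x *_) (trans (*-comm (pw s) U) (q^*pw s))) (*-identityʳ x))

-- Transfer from the given field to matrices over `Fin q`

funToFin-cong : ∀ {m n} {f g : Fin m → Fin n} → (∀ i → f i ≡ g i) → funToFin f ≡ funToFin g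
funToFin-cong {zero} p = refl
funToFin-cong {suc m} p = cong₂ combine (p zero) (funToFin-cong (p ∘ suc))

module FiniteFieldTransfer {c ℓ₁ ℓ₂} (F : HeytingField c ℓ₁ ℓ₂) {q : ℕ}
  (fin : Inverse (HeytingField.setoid F) (≡.setoid (Fin q))) (1<q : 1 ℕ.< q) where

  open FiniteField F fin
  private
    module F = CommutativeRing (HeytingCommutativeRing.commutativeRing (HeytingField.heytingCommutativeRing F))
    module S = Algebra.Properties.CommutativeMonoid.Sum F.+-commutativeMonoid
  open F using (Carrier; _≈_)
  open Inverse fin using (to; from; to-cong; from-cong; strictlyInverseˡ; strictlyInverseʳ)

  infixl 6 _+_
  infixl 7 _*_
  -- The field comes with its own equality. Carrying its operations over to `Fin q` makes equality
  -- propositional, as the sums over matrices require.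
  _+_ _*_ : Fin q → Fin q → Fin q
  x + y = to (from x F.+ from y)
  x * y = to (from x F.* from y)

  -_ : Fin q → Fin q
  - x = to (F.- from x)

  0# 1# : Fin q
  0# = to F.0#
  1# = to F.1#

  to-+ : ∀ x y → to (x F.+ y) ≡ to x + to y
  to-+ x y = to-cong (F.+-cong (F.sym (strictlyInverseʳ x)) (F.sym (strictlyInverseʳ y)))

  to-* : ∀ x y → to (x F.* y) ≡ to x * to y
  to-* x y = to-cong (F.*-cong (F.sym (strictlyInverseʳ x)) (F.sym (strictlyInverseʳ y)))

  isRing : IsRing _≡_ _+_ _*_ -_ 0# 1#
  isRing = record
    { +-isAbelianGroup = record
      { isGroup = record
        { isMonoid = record
          { isSemigroup = record
            { isMagma = record { isEquivalence = ≡.isEquivalence ; ∙-cong = cong₂ _+_ }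
            ; assoc = λ x y z → to-cong (F.trans (F.+-congʳ (strictlyInverseʳ _)) (F.trans (F.+-assoc _ _ _) (F.+-congˡ (F.sym (strictlyInverseʳ _)))))
            }
          ; identity = (λ x → trans (to-cong (F.trans (F.+-congʳ (strictlyInverseʳ _)) (F.+-identityˡ _))) (strictlyInverseˡ x))
                     , (λ x → trans (to-cong (F.trans (F.+-congˡ (strictlyInverseʳ _)) (F.+-identityʳ _))) (strictlyInverseˡ x))
          }
        ; inverse = (λ x → to-cong (F.trans (F.+-congʳ (strictlyInverseʳ _)) (F.-‿inverseˡ _)))
                  , (λ x → to-cong (F.trans (F.+-congˡ (strictlyInverseʳ _)) (F.-‿inverseʳ _)))
        ; ⁻¹-cong = cong -_
        }
      ; comm = λ x y → to-cong (F.+-comm _ _)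
      }
    ; *-cong = cong₂ _*_
    ; *-assoc = λ x y z → to-cong (F.trans (F.*-congʳ (strictlyInverseʳ _)) (F.trans (F.*-assoc _ _ _) (F.*-congˡ (F.sym (strictlyInverseʳ _)))))
    ; *-identity = (λ x → trans (to-cong (F.trans (F.*-congʳ (strictlyInverseʳ _)) (F.*-identityˡ _))) (strictlyInverseˡ x))
                 , (λ x → trans (to-cong (F.trans (F.*-congˡ (strictlyInverseʳ _)) (F.*-identityʳ _))) (strictlyInverseˡ x))
    ; distrib = (λ x y z → to-cong (F.trans (F.*-congˡ (strictlyInverseʳ _)) (F.trans (F.distribˡ _ _ _) (F.+-cong (F.sym (strictlyInverseʳ _)) (F.sym (strictlyInverseʳ _))))))
              , (λ x y z → to-cong (F.trans (F.*-congʳ (strictlyInverseʳ _)) (F.trans (F.distribʳ _ _ _) (F.+-cong (F.sym (strictlyInverseʳ _)) (F.sym (strictlyInverseʳ _))))))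
    }

  -- If x were not invertible then x # 0 would be impossible, so x ≈ 0 by tightness.
  inverse : ∀ x → x ≢ 0# → ∃ λ y → x * y ≡ 1# × y * x ≡ 1#
  inverse x x≢0 with Fin.any? (λ y → (x * y Fin.≟ 1#) ×-dec (y * x Fin.≟ 1#))
  ... | yes inv = inv
  ... | no ¬inv = contradiction (trans (sym (strictlyInverseˡ x)) (to-cong (proj₁ (HeytingField.tight F (from x) F.0#) ¬x#0))) x≢0
    where
    -0≈ : from x F.- F.0# ≈ from x
    -0≈ = F.trans (F.+-congˡ (F.trans (F.sym (F.+-identityˡ _)) (F.-‿inverseʳ F.0#))) (F.+-identityʳ _)
    ¬x#0 : ¬ HeytingField._#_ F (from x) F.0#
    ¬x#0 x#0 = let z , zx , xz = HeytingField.#⇒invertible F x#0 in ¬inv (to z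
      , to-cong (F.trans (F.*-cong (F.sym -0≈) (strictlyInverseʳ z)) xz)
      , to-cong (F.trans (F.*-cong (strictlyInverseʳ z) (F.sym -0≈)) zx))

  skewField : FiniteSkewField
  skewField = record
    { isRing = isRing ; finite = finite-Fin q ; 1<card = subst (1 ℕ.<_) (sym (card-Fin q)) 1<q ; inverse = inverse }

  open Powers skewField hiding (q)

  φ : ∀ {n} → Matrix n → Mat n n
  φ A = mk λ i j → to (A i j)

  ψ : ∀ {n} → Mat n n → Matrix n
  ψ M i j = from (M ⟨ i , j ⟩)

  φ-entry : ∀ {n} (A : Matrix n) i j → φ A ⟨ i , j ⟩ ≡ to (A i j)
  φ-entry A = mk-entry _

  φ-ψ : ∀ {n} (M : Mat n n) → φ (ψ M) ≡ M
  φ-ψ M = ext λ i j → trans (φ-entry (ψ M) i j) (strictlyInverseˡ _)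

  ψ-φ : ∀ {n} (A : Matrix n) → ψ (φ A) ≋ A
  ψ-φ A i j = F.trans (from-cong (φ-entry A i j)) (strictlyInverseʳ _)

  φ-cong : ∀ {n} {A B : Matrix n} → A ≋ B → φ A ≡ φ B
  φ-cong {A = A} {B} p = ext λ i j → trans (φ-entry A i j) (trans (to-cong (p i j)) (sym (φ-entry B i j)))

  φ-injective : ∀ {n} {A B : Matrix n} → φ A ≡ φ B → A ≋ B
  φ-injective {A = A} {B} e = ≋-trans (≋-sym (ψ-φ A)) (≋-trans (λ i j → from-cong (cong (_⟨ i , j ⟩) e)) (ψ-φ B))

  to-sum : ∀ {n} (f : Fin n → Carrier) → to (S.sum f) ≡ sum (to ∘ f)
  to-sum {zero} f = sym (sum-empty (to ∘ f))
  to-sum {suc n} f = trans (to-+ (f zero) _) (trans (cong (to (f zero) +_) (to-sum (f ∘ suc))) (sym (sum-suc (to ∘ f))))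

  φ-* : ∀ {n} (A B : Matrix n) → φ (A M.* B) ≡ φ A ⊗ φ B
  φ-* A B = ext λ i j → trans (φ-entry (A M.* B) i j) (trans (to-sum _)
    (trans (sum-cong-≗ λ k → trans (to-* (A i k) (B k j)) (cong₂ _*_ (sym (φ-entry A i k)) (sym (φ-entry B k j))))
      (sym (⊗-entry (φ A) (φ B) i j))))

  φ-0 : ∀ {n} → φ (M.0# {n}) ≡ 𝟘
  φ-0 {n} = ext λ i j → trans (φ-entry (M.0# {n}) i j) (sym (𝟘-entry i j))

  φ-1 : ∀ {n} → φ (M.1# {n}) ≡ 𝟙
  φ-1 {n} = ext λ i j → trans (φ-entry (M.1# {n}) i j) (trans (entry i j) (sym (𝟙-entry i j)))
    where
    entry : ∀ i j → to ((M.1# {n}) i j) ≡ δ i j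
    entry i j with i Fin.≟ j
    ... | yes _ = refl
    ... | no _ = refl

  φ-^ : ∀ {n} (A : Matrix n) k → φ (A M.^ k) ≡ pow (φ A) k
  φ-^ A zero = φ-1
  φ-^ A (suc k) = trans (φ-* A (A M.^ k)) (cong (φ A ⊗_) (φ-^ A k))

  Nilpotent⇒Nil : ∀ {n} {A : Matrix n} → Nilpotent A → Nil (φ A)
  Nilpotent⇒Nil {A = A} (k , e) = k , trans (sym (φ-^ A k)) (trans (φ-cong e) φ-0)

  Nil⇒Nilpotent : ∀ {n} {A : Matrix n} → Nil (φ A) → Nilpotent A
  Nil⇒Nilpotent {A = A} (k , e) = k , φ-injective (trans (φ-^ A k) (trans e (sym φ-0)))

  Nil? : ∀ {n} (M : Mat n n) → Dec (Nil M)
  Nil? M = map′ (λ p → subst Nil (φ-ψ M) (Nilpotent⇒Nil p)) (λ p → Nil⇒Nilpotent (subst Nil (sym (φ-ψ M)) p)) (nilpotent? (ψ M))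

  Invertible⇒Inv : ∀ {n} {A : Matrix n} → Invertible A → Inv (φ A)
  Invertible⇒Inv {A = A} (B , BA , AB) = Inv-intro (φ A) (φ B)
    (trans (sym (φ-* A B)) (trans (φ-cong AB) φ-1)) (trans (sym (φ-* B A)) (trans (φ-cong BA) φ-1))

  Inv⇒Invertible : ∀ {n} {A : Matrix n} → Inv (φ A) → Invertible A
  Inv⇒Invertible {A = A} i = ψ (inv i)
    , φ-injective (trans (φ-* (ψ (inv i)) A) (trans (cong (_⊗ φ A) (φ-ψ (inv i))) (trans (inv-ˡ i) (sym φ-1))))
    , φ-injective (trans (φ-* A (ψ (inv i))) (trans (cong (φ A ⊗_) (φ-ψ (inv i))) (trans (inv-ʳ i) (sym φ-1))))

  open RankRecursions skewField Nil? using (nil; centraliser; pairWeight; gl-0; ∑-0×0; Nil?-𝟘; centraliser-0×0)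

  encode-cong : ∀ {n} {A B : Matrix n} → A ≋ B → encode A ≡ encode B
  encode-cong {n} p = funToFin-cong {n} λ i → funToFin-cong {n} λ j → to-cong (p i j)

  encode-decode : ∀ {n} (c : Fin ((q ℕ.^ n) ℕ.^ n)) → encode {n} (decode c) ≡ c
  encode-decode {n} c = trans
    (funToFin-cong {n} λ i → trans (funToFin-cong {n} λ j → strictlyInverseˡ (finToFun (finToFun c i) j)) (Fin.funToFin-finToFin {n} {q} (finToFun c i)))
    (Fin.funToFin-finToFin {n} {q ℕ.^ n} c)

  -- `φ` turns `_≋_` into propositional equality, so a list containing every matrix once up to `_≋_`
  -- becomes an enumeration of `Mat n n`, with `encode ∘ ψ` recovering the code.
  sumOver-matrices : ∀ n (f : Mat n n → ℕ) → sumOver (matrices n) (f ∘ φ) ≡ ∑ (mats n n) f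
  sumOver-matrices n f = trans (sumOver-map decode (List.allFin _) (f ∘ φ)) (trans (sym (∑≡sumOver (finite-Fin _) _))
    (∑-bijection (finite-Fin _) (mats n n) (φ ∘ decode) (encode ∘ ψ)
      (λ M → trans (φ-cong (decode-encode (ψ M))) (φ-ψ M))
      (λ c → trans (encode-cong (ψ-φ (decode {n} c))) (encode-decode {n} c)) f))

  ∣GL∣≡gl : ∀ n → ∣GL∣ n ≡ gl n
  ∣GL∣≡gl zero = sym gl-0
  ∣GL∣≡gl n@(suc _) = trans (length-filter invertible? (matrices n)) (trans
    (sumOver-cong (matrices n) λ A → ⟦⟧-cong (invertible? A) (Inv? (φ A)) Invertible⇒Inv Inv⇒Invertible)
    (sumOver-matrices n (λ A → ⟦ Inv? A ⟧)))

  NG≡pairs : ∀ n → NG n ≡ ∑ (mats n n) pairWeight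
  NG≡pairs zero = sym (trans (∑-0×0 pairWeight) (cong₂ ℕ._*_ (Nil?-𝟘 0) centraliser-0×0))
  NG≡pairs n@(suc _) = begin
    NG n
      ≡⟨ length-filter commutingNilpotent? (List.cartesianProduct (matrices n) (matrices n)) ⟩
    sumOver (List.cartesianProduct (matrices n) (matrices n)) (λ p → ⟦ commutingNilpotent? p ⟧)
      ≡⟨ sumOver-cartesianProduct (matrices n) (matrices n) _ ⟩
    sumOver (matrices n) (λ A → sumOver (matrices n) (λ B → ⟦ commutingNilpotent? (A , B) ⟧))
      ≡⟨ sumOver-cong (matrices n) (λ A → trans (sumOver-cong (matrices n) (term A)) (sumOver-matrices n _)) ⟩
    sumOver (matrices n) (λ A → ∑ (mats n n) (λ B → ⟦ Nil? (φ A) ⟧ ℕ.* (⟦ Nil? B ⟧ ℕ.* ⟦ φ A ⊗ B ≟ B ⊗ φ A ⟧)))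
      ≡⟨ sumOver-matrices n _ ⟩
    ∑ (mats n n) (λ A → ∑ (mats n n) (λ B → ⟦ Nil? A ⟧ ℕ.* (⟦ Nil? B ⟧ ℕ.* ⟦ A ⊗ B ≟ B ⊗ A ⟧)))
      ≡⟨ ∑-cong (mats n n) (λ A → ∑-*ˡ (mats n n) ⟦ Nil? A ⟧ _) ⟩
    ∑ (mats n n) pairWeight ∎
    where
    open ≡.≡-Reasoning
    term : ∀ A B → ⟦ commutingNilpotent? (A , B) ⟧ ≡ ⟦ Nil? (φ A) ⟧ ℕ.* (⟦ Nil? (φ B) ⟧ ℕ.* ⟦ φ A ⊗ φ B ≟ φ B ⊗ φ A ⟧)
    term A B = trans
      (⟦⟧-cong (commutingNilpotent? (A , B)) (Nil? (φ A) ×-dec (Nil? (φ B) ×-dec (φ A ⊗ φ B ≟ φ B ⊗ φ A)))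
        (λ (p , r , e) → Nilpotent⇒Nil p , Nilpotent⇒Nil r , trans (sym (φ-* A B)) (trans (φ-cong e) (φ-* B A)))
        (λ (p , r , e) → Nil⇒Nilpotent p , Nil⇒Nilpotent r , φ-injective (trans (φ-* A B) (trans e (sym (φ-* B A))))))
      (trans (⟦⟧-× (Nil? (φ A)) _) (cong (⟦ Nil? (φ A) ⟧ ℕ.*_) (⟦⟧-× (Nil? (φ B)) (φ A ⊗ φ B ≟ φ B ⊗ φ A))))

-- Natural numbers and their reciprocals in the rationals

module Rationals where

  open import Data.Rational.Base using (_+_; _*_; -_; _-_; ∣_∣)

  ι : ℕ → ℚ
  ι n = ℤ.+ n / 1

  toℚᵘ-/ : ∀ i d → ℚ.toℚᵘ (i / suc d) ℚᵘ.≃ ℚᵘ.mkℚᵘ i d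
  toℚᵘ-/ i d = ℚ.toℚᵘ-fromℚᵘ (ℚᵘ.mkℚᵘ i d)

  ι-+ : ∀ m n → ι (m ℕ.+ n) ≡ ι m + ι n
  ι-+ m n = ℚ.toℚᵘ-injective (begin
    ℚ.toℚᵘ (ι (m ℕ.+ n)) ≈⟨ toℚᵘ-/ (ℤ.+ (m ℕ.+ n)) 0 ⟩
    ℚᵘ.mkℚᵘ (ℤ.+ (m ℕ.+ n)) 0 ≈⟨ ℚᵘ.*≡* (cong (ℤ._* ℤ.1ℤ) (trans (ℤ.pos-+ m n) (sym (cong₂ ℤ._+_ (ℤ.*-identityʳ (ℤ.+ m)) (ℤ.*-identityʳ (ℤ.+ n)))))) ⟩
    ℚᵘ.mkℚᵘ (ℤ.+ m) 0 ℚᵘ.+ ℚᵘ.mkℚᵘ (ℤ.+ n) 0 ≈⟨ ℚᵘ.+-cong (toℚᵘ-/ (ℤ.+ m) 0) (toℚᵘ-/ (ℤ.+ n) 0) ⟨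
    ℚ.toℚᵘ (ι m) ℚᵘ.+ ℚ.toℚᵘ (ι n) ≈⟨ ℚ.toℚᵘ-homo-+ (ι m) (ι n) ⟨
    ℚ.toℚᵘ (ι m + ι n) ∎)
    where open ℚᵘ.≃-Reasoning

  ι-* : ∀ m n → ι (m ℕ.* n) ≡ ι m * ι n
  ι-* m n = ℚ.toℚᵘ-injective (begin
    ℚ.toℚᵘ (ι (m ℕ.* n)) ≈⟨ toℚᵘ-/ (ℤ.+ (m ℕ.* n)) 0 ⟩
    ℚᵘ.mkℚᵘ (ℤ.+ (m ℕ.* n)) 0 ≈⟨ ℚᵘ.*≡* (cong (ℤ._* ℤ.1ℤ) (ℤ.pos-* m n)) ⟩
    ℚᵘ.mkℚᵘ (ℤ.+ m) 0 ℚᵘ.* ℚᵘ.mkℚᵘ (ℤ.+ n) 0 ≈⟨ ℚᵘ.*-cong (toℚᵘ-/ (ℤ.+ m) 0) (toℚᵘ-/ (ℤ.+ n) 0) ⟨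
    ℚ.toℚᵘ (ι m) ℚᵘ.* ℚ.toℚᵘ (ι n) ≈⟨ ℚ.toℚᵘ-homo-* (ι m) (ι n) ⟨
    ℚ.toℚᵘ (ι m * ι n) ∎)
    where open ℚᵘ.≃-Reasoning

  /≡ι* : ∀ a b .{{_ : NonZero b}} → ℤ.+ a / b ≡ ι a * (ℤ.+ 1 / b)
  /≡ι* a (suc b) = ℚ.toℚᵘ-injective (begin
    ℚ.toℚᵘ (ℤ.+ a / suc b) ≈⟨ toℚᵘ-/ (ℤ.+ a) b ⟩
    ℚᵘ.mkℚᵘ (ℤ.+ a) b ≈⟨ ℚᵘ.*≡* (cong₂ ℤ._*_ (sym (ℤ.*-identityʳ (ℤ.+ a))) (cong ℤ.+_ (ℕ.+-identityʳ (suc b)))) ⟩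
    ℚᵘ.mkℚᵘ (ℤ.+ a) 0 ℚᵘ.* ℚᵘ.mkℚᵘ (ℤ.+ 1) b ≈⟨ ℚᵘ.*-cong (toℚᵘ-/ (ℤ.+ a) 0) (toℚᵘ-/ (ℤ.+ 1) b) ⟨
    ℚ.toℚᵘ (ι a) ℚᵘ.* ℚ.toℚᵘ (ℤ.+ 1 / suc b) ≈⟨ ℚ.toℚᵘ-homo-* (ι a) (ℤ.+ 1 / suc b) ⟨
    ℚ.toℚᵘ (ι a * (ℤ.+ 1 / suc b)) ∎)
    where open ℚᵘ.≃-Reasoning

  ι*1/ : ∀ b .{{_ : NonZero b}} → ι b * (ℤ.+ 1 / b) ≡ 1ℚ
  ι*1/ b@(suc b-1) = trans (sym (/≡ι* b b)) (ℚ.toℚᵘ-injective (ℚᵘ.≃-trans (toℚᵘ-/ (ℤ.+ b) b-1)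
    (ℚᵘ.*≡* (trans (ℤ.*-identityʳ (ℤ.+ b)) (sym (ℤ.*-identityˡ (ℤ.+ b)))))))

  ι-suc : ∀ n → ι (suc n) ≡ 1ℚ + ι n
  ι-suc = ι-+ 1

  0≤1/ : ∀ b .{{_ : NonZero b}} → 0ℚ ℚ.≤ ℤ.+ 1 / b
  0≤1/ b = ℚ.nonNegative⁻¹ (ℤ.+ 1 / b) {{ℚ.normalize-nonNeg 1 b}}

  0<1/ : ∀ b .{{_ : NonZero b}} → 0ℚ ℚ.< ℤ.+ 1 / b
  0<1/ b = ℚ.positive⁻¹ (ℤ.+ 1 / b) {{ℚ.normalize-pos 1 b}}

  0≤ι : ∀ n → 0ℚ ℚ.≤ ι n
  0≤ι n = ℚ.nonNegative⁻¹ (ι n) {{ℚ.normalize-nonNeg n 1}}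

  ι-mono-≤ : ∀ {m n} → m ≤ n → ι m ℚ.≤ ι n
  ι-mono-≤ {m} m≤n with d , refl ← ℕ.m≤n⇒∃[o]m+o≡n m≤n = subst₂ ℚ._≤_ (ℚ.+-identityʳ (ι m)) (sym (ι-+ m d)) (ℚ.+-monoʳ-≤ (ι m) (0≤ι d))

  ι-mono-< : ∀ {m n} → m < n → ι m ℚ.< ι n
  ι-mono-< {m} m<n = ℚ.<-≤-trans (subst₂ ℚ._<_ (ℚ.+-identityˡ (ι m)) (sym (ι-+ 1 m)) (ℚ.+-monoˡ-< (ι m) (ℚ.positive⁻¹ 1ℚ))) (ι-mono-≤ m<n)

  -- The Archimedean property: since the denominator is at least 1, the absolute value of the
  -- numerator is a bound.
  ≤-ι : ∀ p → ∃ λ n → p ℚ.≤ ι n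
  ≤-ι p@(ℚ.mkℚ i d _) = ℤ.∣ i ∣ , ℚ.toℚᵘ-cancel-≤ (ℚᵘ.≤-trans (ℚᵘ.*≤* (bound i)) (ℚᵘ.≤-reflexive (ℚᵘ.≃-sym (toℚᵘ-/ (ℤ.+ ℤ.∣ i ∣) 0))))
    where
    bound : ∀ i → i ℤ.* ℤ.1ℤ ℤ.≤ ℤ.+ ℤ.∣ i ∣ ℤ.* ℤ.+ suc d
    bound (ℤ.+ n) = subst₂ ℤ._≤_ (sym (ℤ.*-identityʳ (ℤ.+ n))) (ℤ.pos-* n (suc d)) (ℤ.+≤+ (ℕ.m≤m*n n (suc d)))
    bound ℤ.-[1+ n ] = subst₂ ℤ._≤_ (sym (ℤ.*-identityʳ ℤ.-[1+ n ])) (ℤ.pos-* (suc n) (suc d)) ℤ.-≤+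

open Rationals

-- Estimates for the products over l

module Limits (q : ℕ) .{{_ : NonZero q}} (1<q : 1 < q) (pw : ℕ → ℚ)
  (q^*pw : ∀ n → ι (q ℕ.^ n) ℚ.* pw n ≡ 1ℚ) (0<pw : ∀ n → 0ℚ ℚ.< pw n) where

  open import Data.Rational.Base using (_+_; _*_; -_; _-_; ∣_∣)

  n<q^n : ∀ n → n < q ℕ.^ n
  n<q^n zero = s≤s z≤n
  n<q^n (suc n) = begin-strict
    suc n ≤⟨ n<q^n n ⟩
    q ℕ.^ n <⟨ ℕ.m<m+n (q ℕ.^ n) (ℕ.m^n>0 q n) ⟩
    q ℕ.^ n ℕ.+ q ℕ.^ n ≡⟨ cong (q ℕ.^ n ℕ.+_) (ℕ.+-identityʳ (q ℕ.^ n)) ⟨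
    2 ℕ.* q ℕ.^ n ≤⟨ ℕ.*-monoˡ-≤ (q ℕ.^ n) 1<q ⟩
    q ℕ.* q ℕ.^ n ∎
    where open ℕ.≤-Reasoning

  -- Take integers A ≥ C and f ≥ 1/ε. Then C `pw M` ≤ ε (A f) `pw M`, and A f ≤ M < q^M for M beyond
  -- N = A f, while q^M `pw M` = 1.
  C*pw-small : ∀ C ε → 0ℚ ℚ.< ε → ∃ λ N → ∀ M → N ≤ M → C * pw M ℚ.< ε
  C*pw-small C ε 0<ε = A ℕ.* f , λ M N≤M → begin-strict
    C * pw M ≤⟨ ℚ.*-monoʳ-≤-nonNeg (pw M) {{ℚ.nonNegative (ℚ.<⇒≤ (0<pw M))}} C≤A ⟩
    ι A * pw M ≡⟨ ℚ.*-identityʳ (ι A * pw M) ⟨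
    ι A * pw M * 1ℚ ≤⟨ ℚ.*-monoˡ-≤-nonNeg (ι A * pw M) {{nonNeg-A*pw M}} 1≤εf ⟩
    ι A * pw M * (ε * ι f) ≡⟨ rearrange (ι A) (pw M) ε (ι f) ⟩
    ε * (ι A * ι f * pw M) ≡⟨ cong (λ z → ε * (z * pw M)) (ι-* A f) ⟨
    ε * (ι (A ℕ.* f) * pw M) <⟨ ℚ.*-monoʳ-<-pos ε {{ℚ.positive 0<ε}} (ℚ.*-monoˡ-<-pos (pw M) {{ℚ.positive (0<pw M)}}
                                                     (ι-mono-< (ℕ.≤-<-trans N≤M (n<q^n M)))) ⟩
    ε * (ι (q ℕ.^ M) * pw M) ≡⟨ cong (ε *_) (q^*pw M) ⟩
    ε * 1ℚ ≡⟨ ℚ.*-identityʳ ε ⟩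
    ε ∎
    where
    open ℚ.≤-Reasoning
    instance
      ε≢0 : ℚ.NonZero ε
      ε≢0 = ℚ.>-nonZero 0<ε
    A = proj₁ (≤-ι C)
    C≤A = proj₂ (≤-ι C)
    f = proj₁ (≤-ι (ℚ.1/ ε))
    1≤εf : 1ℚ ℚ.≤ ε * ι f
    1≤εf = subst (ℚ._≤ ε * ι f) (ℚ.*-inverseʳ ε) (ℚ.*-monoˡ-≤-nonNeg ε {{ℚ.nonNegative (ℚ.<⇒≤ 0<ε)}} (proj₂ (≤-ι (ℚ.1/ ε))))
    nonNeg-A*pw : ∀ M → ℚ.NonNegative (ι A * pw M)
    nonNeg-A*pw M = ℚ.nonNeg*nonNeg⇒nonNeg (ι A) {{ℚ.nonNegative (0≤ι A)}} (pw M) {{ℚ.nonNegative (ℚ.<⇒≤ (0<pw M))}}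
    rearrange : ∀ a p e g → a * p * (e * g) ≡ e * (a * g * p)
    rearrange = solve 4 (λ a p e g → a :* p :* (e :* g) := e :* (a :* g :* p)) refl
      where open PowerSeriesAlgebra _+_ _*_ -_ 0ℚ 1ℚ ℚ.+-*-isCommutativeRing

  -- The inductive step of `rising-near-1` in isolation: γ is the new factor, y the error of the
  -- remaining product, and p stands for 1 - γ. As 0 ≤ γ ≤ 1, the old error does not grow, and the
  -- new one is added to it.
  step-bound : ∀ {γ y p p′ t} → 0ℚ ℚ.≤ γ → γ ℚ.≤ 1ℚ → 0ℚ ℚ.≤ p → 0ℚ ℚ.≤ t → ∣ y ∣ ℚ.≤ t * p′ → p′ ℚ.≤ p →
    ∣ γ * y + - p ∣ ℚ.≤ (1ℚ + t) * p
  step-bound {γ} {y} {p} {p′} {t} 0≤γ γ≤1 0≤p 0≤t y≤ p′≤p = ℚ.≤-trans (ℚ.∣p+q∣≤∣p∣+∣q∣ (γ * y) (- p))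
    (subst₂ (λ u v → u + ∣ - p ∣ ℚ.≤ v) (sym (ℚ.∣p*q∣≡∣p∣*∣q∣ γ y)) refl
      (subst₂ ℚ._≤_ (cong₂ (λ u v → u * ∣ y ∣ + v) (sym (ℚ.0≤p⇒∣p∣≡p 0≤γ)) (sym (trans (ℚ.∣-p∣≡∣p∣ p) (ℚ.0≤p⇒∣p∣≡p 0≤p)))) sum≡
        (ℚ.+-monoˡ-≤ p γy≤)))
    where
    γy≤ : γ * ∣ y ∣ ℚ.≤ t * p
    γy≤ = ℚ.≤-trans (ℚ.*-monoʳ-≤-nonNeg ∣ y ∣ {{ℚ.∣-∣-nonNeg y}} γ≤1)
      (subst (ℚ._≤ t * p) (sym (ℚ.*-identityˡ ∣ y ∣)) (ℚ.≤-trans y≤ (ℚ.*-monoˡ-≤-nonNeg t {{ℚ.nonNegative 0≤t}} p′≤p)))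
    sum≡ : t * p + p ≡ (1ℚ + t) * p
    sum≡ = trans (ℚ.+-comm (t * p) p) (trans (cong (_+ t * p) (sym (ℚ.*-identityˡ p))) (sym (ℚ.*-distribʳ-+ p 1ℚ t)))

  scaled-bound : ∀ y r t p → ∣ r - 1ℚ ∣ ℚ.≤ t * p → ∣ y * r - y ∣ ℚ.≤ ∣ y ∣ * t * p
  scaled-bound y r t p near = subst₂ ℚ._≤_ (sym factored) (sym (ℚ.*-assoc ∣ y ∣ t p))
    (ℚ.*-monoˡ-≤-nonNeg ∣ y ∣ {{ℚ.∣-∣-nonNeg y}} near)
    where
    factored : ∣ y * r - y ∣ ≡ ∣ y ∣ * ∣ r - 1ℚ ∣
    factored = trans (cong ∣_∣ (trans (cong (y * r +_) (trans (cong -_ (sym (ℚ.*-identityʳ y))) (ℚ.neg-distribʳ-* y 1ℚ)))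
      (sym (ℚ.*-distribˡ-+ y r (- 1ℚ))))) (ℚ.∣p*q∣≡∣p∣*∣q∣ y (r - 1ℚ))

  module _ (pw-0 : pw 0 ≡ 1ℚ) (pw-suc≤ : ∀ n → pw (suc n) ℚ.≤ pw n)
    (c : ℕ → ℚ) (c-def : ∀ n → c n ≡ 1ℚ - pw n) (rising : ℕ → ℕ → ℚ)
    (rising-0 : ∀ M → rising M 0 ≡ 1ℚ) (rising-suc : ∀ M s → rising M (suc s) ≡ c M * rising (suc M) s) where

    pw≤1 : ∀ n → pw n ℚ.≤ 1ℚ
    pw≤1 zero = ℚ.≤-reflexive pw-0
    pw≤1 (suc n) = ℚ.≤-trans (pw-suc≤ n) (pw≤1 n)

    0≤c : ∀ n → 0ℚ ℚ.≤ c n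
    0≤c n = subst₂ ℚ._≤_ (ℚ.+-inverseʳ (pw n)) (sym (c-def n)) (ℚ.+-monoˡ-≤ (- pw n) (pw≤1 n))

    c≤1 : ∀ n → c n ℚ.≤ 1ℚ
    c≤1 n = subst₂ ℚ._≤_ (sym (c-def n)) (ℚ.+-identityʳ 1ℚ) (ℚ.+-monoʳ-≤ 1ℚ (ℚ.neg-antimono-≤ (ℚ.<⇒≤ (0<pw n))))

    -- Each of the s factors lies in [0, 1] and misses 1 by at most `pw M`, and such errors add up:
    -- c ρ′ - 1 = c (ρ′ - 1) - `pw M`.
    rising-near-1 : ∀ M s → ∣ rising M s - 1ℚ ∣ ℚ.≤ ι s * pw M
    rising-near-1 M zero = ℚ.≤-reflexive (trans (cong (λ z → ∣ z - 1ℚ ∣) (rising-0 M)) (sym (ℚ.*-zeroˡ (pw M))))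
    rising-near-1 M (suc s) = subst₂ ℚ._≤_ (cong ∣_∣ (sym (trans (cong (_- 1ℚ) (rising-suc M s)) split))) (cong (_* pw M) (sym (ι-suc s)))
      (step-bound (0≤c M) (c≤1 M) (ℚ.<⇒≤ (0<pw M)) (0≤ι s) (rising-near-1 (suc M) s) (pw-suc≤ M))
      where
      ρ′ = rising (suc M) s
      c+pw : c M + pw M ≡ 1ℚ
      c+pw = trans (cong (_+ pw M) (c-def M)) (trans (ℚ.+-assoc 1ℚ (- pw M) (pw M)) (trans (cong (1ℚ +_) (ℚ.+-inverseˡ (pw M))) (ℚ.+-identityʳ 1ℚ)))
      split : c M * ρ′ - 1ℚ ≡ c M * (ρ′ - 1ℚ) + - pw M
      split = sym (≡R.begin
        c M * (ρ′ - 1ℚ) + - pw M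
          ≡R.≡⟨ cong (_+ - pw M) (ℚ.*-distribˡ-+ (c M) ρ′ (- 1ℚ)) ⟩
        c M * ρ′ + c M * (- 1ℚ) + - pw M
          ≡R.≡⟨ ℚ.+-assoc (c M * ρ′) _ _ ⟩
        c M * ρ′ + (c M * (- 1ℚ) + - pw M)
          ≡R.≡⟨ cong (λ z → c M * ρ′ + (z + - pw M)) (trans (sym (ℚ.neg-distribʳ-* (c M) 1ℚ)) (cong -_ (ℚ.*-identityʳ (c M)))) ⟩
        c M * ρ′ + (- c M + - pw M)
          ≡R.≡⟨ cong (c M * ρ′ +_) (trans (sym (ℚ.neg-distrib-+ (c M) (pw M))) (cong -_ c+pw)) ⟩
        c M * ρ′ - 1ℚ ≡R.∎)
        where module ≡R = ≡.≡-Reasoning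

    rising-converges : ∀ y s ε → 0ℚ ℚ.< ε → ∃ λ N → ∀ M → N ≤ M → ∣ y * rising M s - y ∣ ℚ.< ε
    rising-converges y s ε 0<ε = let N , small = C*pw-small (∣ y ∣ * ι s) ε 0<ε in N , λ M N≤M →
      ℚ.≤-<-trans (scaled-bound y (rising M s) (ι s) (pw M) (rising-near-1 M s)) (small M N≤M)

-- Assembly of the two infinite products

module MainTheorem {a ℓ₁ ℓ₂} (q : ℕ) .{{q≢0 : NonZero q}} (1<q : 1 < q)
  (F : HeytingField a ℓ₁ ℓ₂) (fin : Inverse (HeytingField.setoid F) (setoid (Fin q))) where

  open import Data.Rational.Base using (_+_; _*_; -_; _-_; ∣_∣)

  open FiniteField F fin using (NG; ∣GL∣; ∣GL∣-nonZero)
  open FiniteFieldTransfer F fin 1<q using (skewField; Nil?; ∣GL∣≡gl; NG≡pairs)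

  open RankRecursions skewField Nil? using (pairWeight)

  ρ : ℕ → ℚ
  ρ n = _/_ (ℤ.+ 1) (∣GL∣ n) {{∣GL∣-nonZero n}}

  x : ℚ
  x = ℤ.+ 1 / q

  q≡ : RankRecursions.q skewField Nil? ≡ q
  q≡ = card-Fin q

  open Ratio _+_ _*_ -_ 0ℚ 1ℚ ℚ.+-*-isCommutativeRing ι refl refl ι-+ ι-* skewField Nil? ρ
    (λ n → trans (cong (λ g → ι g * ρ n) (sym (∣GL∣≡gl n))) (ι*1/ (∣GL∣ n) {{∣GL∣-nonZero n}}))
    x (trans (cong (λ r → ι r * x) q≡) (ι*1/ q))

  open Euler x pw c nilRatio pw-0 pw-suc c-pw nilRatio-0 nilRatio-suc using (rising; rising-0; rising-suc; coeff; coeff-def; partial-product)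

  q^n*pw : ∀ n → ι (q ℕ.^ n) * pw n ≡ 1ℚ
  q^n*pw n = trans (cong (λ r → ι (r ℕ.^ n) * pw n) (sym q≡)) (q^*pw n)

  0<pw : ∀ n → 0ℚ ℚ.< pw n
  0<pw zero = ℚ.positive⁻¹ 1ℚ
  0<pw (suc n) = ℚ.positive⁻¹ (x * pw n) {{ℚ.pos*pos⇒pos x {{ℚ.positive (0<1/ q)}} (pw n) {{ℚ.positive (0<pw n)}}}}

  1/q^≡pw : ∀ l → _/_ (ℤ.+ 1) (q ℕ.^ l) {{ℕ.m^n≢0 q l}} ≡ pw l
  1/q^≡pw l = begin
    y ≡⟨ ℚ.*-identityʳ y ⟨
    y * 1ℚ ≡⟨ cong (y *_) (q^n*pw l) ⟨
    y * (ι (q ℕ.^ l) * pw l) ≡⟨ ℚ.*-assoc y _ _ ⟨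
    y * ι (q ℕ.^ l) * pw l ≡⟨ cong (_* pw l) (trans (ℚ.*-comm y _) (ι*1/ (q ℕ.^ l) {{ℕ.m^n≢0 q l}})) ⟩
    1ℚ * pw l ≡⟨ ℚ.*-identityˡ (pw l) ⟩
    pw l ∎
    where
    open ≡.≡-Reasoning
    y = _/_ (ℤ.+ 1) (q ℕ.^ l) {{ℕ.m^n≢0 q l}}

  open Limits q 1<q pw q^n*pw 0<pw

  ⊛≡conv : ∀ f g n → (f ⊛ g) n ≡ conv f g n
  ⊛≡conv f g n = go (suc n) (λ k → f k * g (n ∸ k))
    where
    go : ∀ m (h : ℕ → ℚ) → Algebra.Definitions.RawMonoid.sum ℚ.+-0-rawMonoid {m} (λ k → h (toℕ k)) ≡ Σ< m h
    go zero h = refl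
    go (suc m) h = cong (h 0 +_) (go m (h ∘ suc))

  𝟏≡one : ∀ n → 𝟏 n ≡ one n
  𝟏≡one zero = refl
  𝟏≡one (suc n) = refl

  u^≡shift : ∀ i n → (u^ i) n ≡ shift i one n
  u^≡shift zero n = 𝟏≡one n
  u^≡shift (suc i) zero = refl
  u^≡shift (suc i) (suc n) = u^≡shift i n

  ∏-geometric : ∀ i (f r : ℕ → PowerSeries) → (∀ l k → f l k + pw l * shift (suc i) one k ≡ one k) →
    (∀ l n → (f l ⊛ r l) n ≡ 𝟏 n) → ∀ M n → ∏[1… M ] r n ≡ dilate (suc i) (coeff M) n
  ∏-geometric i f r f-def inv = partial-product i (λ M → ∏[1… M ] r) 𝟏≡one λ M n → trans (⊛≡conv (∏[1… M ] r) (r (suc M)) n)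
    (trans (conv-geometric (suc i) (pw (suc M)) {f (suc M)} {r (suc M)} (f-def (suc M)) (λ n → trans (sym (⊛≡conv (f (suc M)) (r (suc M)) n)) (trans (inv (suc M) n) (𝟏≡one n)))
      (∏[1… M ] r) n) (cong (λ z → ∏[1… M ] r n + pw (suc M) * z) (shift-cong (suc i) n λ m _ → sym (⊛≡conv (∏[1… M ] r) (r (suc M)) m))))

  1-u^-def : ∀ i l k → (1-u^ i / q ^ l) k + pw l * shift i one k ≡ one k
  1-u^-def i l k = trans (cong₂ (λ y z → 𝟏 k - y * (u^ i) k + pw l * z) (1/q^≡pw l) (sym (u^≡shift i k)))
    (trans (undo (𝟏 k) (pw l * (u^ i) k)) (𝟏≡one k))
    where
    undo : ∀ y z → y - z + z ≡ y
    undo y z = trans (ℚ.+-assoc y (- z) z) (trans (cong (y +_) (ℚ.+-inverseˡ z)) (ℚ.+-identityʳ y))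

  x≤1 : x ℚ.≤ 1ℚ
  x≤1 = subst₂ ℚ._≤_ (ℚ.*-identityʳ x) (trans (ℚ.*-comm x (ι q)) (ι*1/ q))
    (ℚ.*-monoˡ-≤-nonNeg x {{ℚ.nonNegative (0≤1/ q)}} (ι-mono-≤ (ℕ.<⇒≤ 1<q)))

  pw-suc≤ : ∀ n → pw (suc n) ℚ.≤ pw n
  pw-suc≤ n = subst (x * pw n ℚ.≤_) (ℚ.*-identityˡ (pw n)) (ℚ.*-monoʳ-≤-nonNeg (pw n) {{ℚ.nonNegative (ℚ.<⇒≤ (0<pw n))}} x≤1)

  ∣p-r∣<ε : ∀ p r ε → 0ℚ ℚ.< ε → p ≡ r → ∣ p - r ∣ ℚ.< ε
  ∣p-r∣<ε p .p ε 0<ε refl = subst (ℚ._< ε) (sym (cong ∣_∣ (ℚ.+-inverseʳ p))) 0<ε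

  ∣-∣<ε-resp : ∀ p p′ r r′ ε → p ≡ p′ → r ≡ r′ → ∣ p′ - r′ ∣ ℚ.< ε → ∣ p - r ∣ ℚ.< ε
  ∣-∣<ε-resp p .p r .r ε refl refl close = close

  inner-partial-product : ∀ i M n → ∏[1… M ] (λ l → 1/[1-u^ suc i / q ^ l ]) n ≡ dilate (suc i) (coeff M) n
  inner-partial-product i = ∏-geometric i (λ l → 1-u^ suc i / q ^ l) (λ l → 1/[1-u^ suc i / q ^ l ]) (1-u^-def (suc i)) (λ l → factor-inverse (suc i) q l (s≤s z≤n))

  -- Here the coefficients do depend on M: at n = i s the coefficient is a_s times s factors tending
  -- to 1, and at the other n it is 0 throughout.
  inner-product : ∀ i → 1 ≤ i → IsProd≥1 (λ l → 1/[1-u^ i / q ^ l ]) (dilate i nilRatio)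
  inner-product (suc i) _ n ε 0<ε = cases (dilate-cases i n)
    where
    Π : ℕ → ℚ
    Π M = ∏[1… M ] (λ l → 1/[1-u^ suc i / q ^ l ]) n
    cases : (∃ λ s → ∀ (b : Seq) → dilate (suc i) b n ≡ b s) ⊎ (∀ (b : Seq) → dilate (suc i) b n ≡ 0ℚ) →
      ∃ λ N → ∀ M → N ≤ M → ∣ ∏[1… M ] (λ l → 1/[1-u^ suc i / q ^ l ]) n - dilate (suc i) nilRatio n ∣ ℚ.< ε
    cases (inj₁ (s , at-s)) = proj₁ close , λ M N≤M →
      ∣-∣<ε-resp (Π M) (nilRatio s * rising M s) (dilate (suc i) nilRatio n) (nilRatio s) ε
        (trans (inner-partial-product i M n) (trans (at-s (coeff M)) (coeff-def M s))) (at-s nilRatio) (proj₂ close M N≤M)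
      where
      close : ∃ λ N → ∀ M → N ≤ M → ∣ nilRatio s * rising M s - nilRatio s ∣ ℚ.< ε
      close = rising-converges pw-0 pw-suc≤ c c-def rising rising-0 rising-suc (nilRatio s) s ε 0<ε
    cases (inj₂ vanish) = 0 , λ M _ → ∣p-r∣<ε (Π M) (dilate (suc i) nilRatio n) ε 0<ε
      (trans (inner-partial-product i M n) (trans (vanish (coeff M)) (sym (vanish nilRatio))))

  series≡ : ∀ n → commutingNilpotentSeries F fin n ≡ Σ< (suc n) (pairRatio n)
  series≡ n = trans (/≡ι* (NG n) (∣GL∣ n) {{∣GL∣-nonZero n}}) (trans (cong (λ N → ι N * ρ n) (NG≡pairs n)) (ratio-total pairWeight n))

  ∏-suc : ∀ (P : ℕ → PowerSeries) M n → ∏[1… suc M ] P n ≡ conv (∏[1… M ] P) (P (suc M)) n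
  ∏-suc P M n = ⊛≡conv (∏[1… M ] P) (P (suc M)) n

  outer-partial-product : ∀ M n → n ≤ M → ∏[1… M ] (λ i → dilate i nilRatio) n ≡ Σ< (suc n) (pairRatio n)
  outer-partial-product = product-stable nilRatio pairRatio (ratio-> pairWeight) pairRatio-0 nilRatio-0 pairRatio-recursion
    (λ M → ∏[1… M ] (λ i → dilate i nilRatio)) 𝟏≡one (∏-suc (λ i → dilate i nilRatio))

  -- A factor with i > n is 1 up to degree n, so the n-th coefficient is final from M = n on and N =
  -- n serves for every ε.
  outer-product : IsProd≥1 (λ i → dilate i nilRatio) (commutingNilpotentSeries F fin)
  outer-product n ε 0<ε = n , λ M n≤M → ∣p-r∣<ε (∏[1… M ] (λ i → dilate i nilRatio) n) (commutingNilpotentSeries F fin n) ε 0<ε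
    (trans (outer-partial-product M n n≤M) (sym (series≡ n)))

  product-formula : ∃ λ (P : ℕ → PowerSeries) →
    (∀ i → 1 ≤ i → IsProd≥1 (λ l → 1/[1-u^ i / q ^ l ]) (P i)) × IsProd≥1 P (commutingNilpotentSeries F fin)
  product-formula = (λ i → dilate i nilRatio) , inner-product , outer-product

1<primePower : ∀ {q} → IsPrimePower q → 1 < q
1<primePower (p , k , p-prime , 1≤k , refl) = ℕ.≤-trans (ℕ.nonTrivial⇒n>1 p) (subst (_≤ p ℕ.^ k) (ℕ.^-identityʳ p) (ℕ.^-monoʳ-≤ p 1≤k))
  where instance
  p-nonTrivial : NonTrivial p
  p-nonTrivial = prime⇒nonTrivial p-prime
  p-nonZero : NonZero p
  p-nonZero = prime⇒nonZero p-prime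

theorem2p7 : ∀ {c ℓ₁ ℓ₂} (q : ℕ) .{{_ : NonZero q}} → IsPrimePower q →
    (F : HeytingField c ℓ₁ ℓ₂) (fin : Inverse (HeytingField.setoid F) (setoid (Fin q))) →
    ∃ λ (P : ℕ → PowerSeries) →
    (∀ i → 1 ≤ i → IsProd≥1 (λ l → 1/[1-u^ i / q ^ l ]) (P i)) ×
    IsProd≥1 P (commutingNilpotentSeries F fin)
theorem2p7 q q-primePower F fin = MainTheorem.product-formula q (1<primePower q-primePower) F fin
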